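{- For $|q|<1$, $$\sum_{m,k,n\geq0} \frac{q^{2T(k)+2T(m+k)+2T(n)}}{(q)_m(q)_{2k+1}}\begin{bmatrix} k\\ n\end{bmatrix}_q=\frac{(q^{21},q^5,q^{16};q^{21})_\infty}{(q)_\infty}.$$
   Context: For $m$ a nonnegative integer, $(a)_m=(a;q)_m=\prod_{j=0}^{m-1}(1-aq^j)$ (with $(a)_0=1$), $(a;q)_\infty=\prod_{j\ge0}(1-aq^j)$, $(q)_\infty=(q;q)_\infty$, and $(a_1,\ldots,a_r;q)_\infty=(a_1;q)_\infty\cdots(a_r;q)_\infty$. In particular $(q)_m=\prod_{j=1}^m(1-q^j)$. The $q$-binomial coefficient is $\begin{bmatrix} m+n\\ m\end{bmatrix}_q=\frac{(q)_{m+n}}{(q)_m(q)_n}$ if $m,n$ are nonnegative integers, and it is $0$ otherwise (so $\begin{bmatrix} A\\ B\end{bmatrix}_q=0$ unless $0\le B\le A$). $T(j)=\frac{j(j+1)}{2}$. -}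

module Defs where

open import Algebra.Apartness.Bundles using (HeytingCommutativeRing; HeytingField)
open import Algebra.Bundles using (CommutativeRing)
open import Algebra.Bundles.Raw using (RawSemiring)
import Algebra.Definitions.RawMonoid as RawMonoidOps
import Algebra.Definitions.RawSemiring as RawSemiringOps
import Algebra.Properties.AbelianGroup as AbelianGroupProperties
import Algebra.Properties.Ring as RingProperties
import Algebra.Solver.Ring.NaturalCoefficients.Default as SemiringSolver
open import Data.Empty using (⊥-elim)
open import Data.List.Base using (List; []; _∷_; map; foldr)
open import Data.List.Membership.Propositional using (_∈_)
open import Data.List.Relation.Unary.Unique.Propositional using (Unique)
open import Data.Nat.Base as ℕ using (ℕ; zero; suc)
import Data.Nat.DivMod as ℕ
import Data.Nat.Properties as ℕ
open import Data.Product.Base using (∃-syntax; _×_; _,_; proj₁)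
open import Data.Sum.Base using (_⊎_; inj₁; inj₂)
open import Function.Bundles using (_⇔_; Equivalence)
open import Level using (Lift; _⊔_) renaming (suc to lsuc)
open import Relation.Binary.Core using (Rel)
open import Relation.Binary.Structures using (IsStrictPartialOrder)
import Relation.Binary.Reasoning.Setoid as SetoidReasoning
open import Relation.Nullary.Decidable.Core using (yes; no)
open import Relation.Nullary.Negation.Core using (¬_)

-- The real numbers, given axiomatically as an Archimedean, Cauchy complete
-- ordered field; the axioms determine ℝ up to isomorphism (classically).
record RealField c ℓ₁ ℓ₂ ℓ₃ : Set (lsuc (c ⊔ ℓ₁ ⊔ ℓ₂ ⊔ ℓ₃)) where
  field
    heytingField : HeytingField c ℓ₁ ℓ₂

  open HeytingField heytingField public
  open HeytingCommutativeRing heytingCommutativeRing public using (commutativeRing)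
  open CommutativeRing commutativeRing public using (+-rawMonoid)
  open RawMonoidOps +-rawMonoid using () renaming (_×_ to _·_)

  infix 4 _<_
  field
    _<_                  : Rel Carrier ℓ₃
    isStrictPartialOrder : IsStrictPartialOrder _≈_ _<_
    #⇔<⊎>                : ∀ {x y} → x # y ⇔ (x < y ⊎ y < x)
    +-monoʳ-<            : ∀ z {x y} → x < y → z + x < z + y
    *-pos                : ∀ {x y} → 0# < x → 0# < y → 0# < x * y
    archimedean          : ∀ x → ∃[ n ] x < n · 1#

  IsCauchy : (ℕ → Carrier) → Set (c ⊔ ℓ₃)
  IsCauchy u = ∀ ε → 0# < ε → ∃[ N ] ∀ m n → N ℕ.≤ m → N ℕ.≤ n →
    (- ε < u m - u n) × (u m - u n < ε)

  IsLimit : (ℕ → Carrier) → Carrier → Set (c ⊔ ℓ₃)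
  IsLimit u x = ∀ ε → 0# < ε → ∃[ N ] ∀ n → N ℕ.≤ n →
    (- ε < u n - x) × (u n - x < ε)

  field
    complete : ∀ u → IsCauchy u → ∃[ x ] IsLimit u x

module RealFieldProperties {c ℓ₁ ℓ₂ ℓ₃} (ℝ : RealField c ℓ₁ ℓ₂ ℓ₃) where
  open RealField ℝ
  open IsStrictPartialOrder isStrictPartialOrder public
    using (<-respˡ-≈; <-respʳ-≈) renaming (irrefl to <-irrefl; trans to <-trans)
  open CommutativeRing commutativeRing using (ring; +-abelianGroup; commutativeSemiring)
  open RingProperties ring using (-‿distribˡ-*; -‿distribʳ-*; -‿involutive)
  open AbelianGroupProperties +-abelianGroup using (xyx⁻¹≈y; ∙-cancelʳ)
  open SemiringSolver commutativeSemiring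

  <-cotrans : ∀ {x y} → x < y → ∀ z → x < z ⊎ z < y
  <-cotrans x<y z with #-cotrans (Equivalence.from #⇔<⊎> (inj₁ x<y)) z
  ... | inj₁ x#z with Equivalence.to #⇔<⊎> x#z
  ...   | inj₁ x<z = inj₁ x<z
  ...   | inj₂ z<x = inj₂ (<-trans z<x x<y)
  <-cotrans x<y z | inj₂ z#y with Equivalence.to #⇔<⊎> z#y
  ...   | inj₁ z<y = inj₂ z<y
  ...   | inj₂ y<z = inj₁ (<-trans x<y y<z)

  0<⇒# : ∀ {x} → 0# < x → x # 0#
  0<⇒# 0<x = Equivalence.from #⇔<⊎> (inj₂ 0<x)

  <0⇒0<- : ∀ {x} → x < 0# → 0# < - x
  <0⇒0<- {x} x<0 =
    <-respˡ-≈ (-‿inverseˡ x) (<-respʳ-≈ (+-identityʳ (- x)) (+-monoʳ-< (- x) x<0))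

  0<-⇒<0 : ∀ {x} → 0# < - x → x < 0#
  0<-⇒<0 {x} 0<-x =
    <-respˡ-≈ (+-identityʳ x) (<-respʳ-≈ (-‿inverseʳ x) (+-monoʳ-< x 0<-x))

  <⇒0<- : ∀ {x y} → x < y → 0# < y - x
  <⇒0<- {x} {y} x<y =
    <-respˡ-≈ (-‿inverseˡ x) (<-respʳ-≈ (+-comm (- x) y) (+-monoʳ-< (- x) x<y))

  0<-⇒< : ∀ {x y} → 0# < y - x → x < y
  0<-⇒< {x} {y} p = <-respˡ-≈ (+-identityʳ x)
    (<-respʳ-≈ (trans (sym (+-assoc x y (- x))) (xyx⁻¹≈y x y)) (+-monoʳ-< x p))

  +-cancelʳ-<0 : ∀ {x y} → x + y < x → y < 0#
  +-cancelʳ-<0 {x} {y} p = <-respˡ-≈ (trans (sym (+-assoc (- x) x y))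
    (trans (+-congʳ (-‿inverseˡ x)) (+-identityˡ y)))
    (<-respʳ-≈ (-‿inverseˡ x) (+-monoʳ-< (- x) p))

  neg*neg : ∀ x y → - x * - y ≈ x * y
  neg*neg x y = trans (sym (-‿distribˡ-* x (- y)))
    (trans (-‿cong (sym (-‿distribʳ-* x y))) (-‿involutive (x * y)))

  -- x ≤ y is encoded as ¬ (y < x).
  0<+0≤ : ∀ {x y} → 0# < x → ¬ y < 0# → 0# < x + y
  0<+0≤ {x} {y} 0<x 0≤y with <-cotrans 0<x (x + y)
  ... | inj₁ p = p
  ... | inj₂ p = ⊥-elim (0≤y (+-cancelʳ-<0 p))

  0≤x*x : ∀ x → ¬ x * x < 0#
  0≤x*x x xx<0 = <-irrefl (trans (*-congʳ x≈0) (zeroˡ x)) xx<0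
    where
    apart : ¬ x # 0#
    apart x#0 with Equivalence.to #⇔<⊎> x#0
    ... | inj₂ 0<x = <-irrefl refl (<-trans xx<0 (*-pos 0<x 0<x))
    ... | inj₁ x<0 = <-irrefl refl (<-trans xx<0
            (<-respʳ-≈ (neg*neg x x) (*-pos (<0⇒0<- x<0) (<0⇒0<- x<0))))
    x≈0 : x ≈ 0#
    x≈0 = proj₁ (tight x 0#) apart

  0≤*0< : ∀ {x y} → ¬ x < 0# → 0# < y → ¬ x * y < 0#
  0≤*0< {x} {y} 0≤x 0<y xy<0 = <-irrefl (trans (*-congʳ x≈0) (zeroˡ y)) xy<0
    where
    apart : ¬ x # 0#
    apart x#0 with Equivalence.to #⇔<⊎> x#0
    ... | inj₂ 0<x = <-irrefl refl (<-trans xy<0 (*-pos 0<x 0<y))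
    ... | inj₁ x<0 = 0≤x x<0
    x≈0 : x ≈ 0#
    x≈0 = proj₁ (tight x 0#) apart

  0≤xx+yy : ∀ x y → ¬ x * x + y * y < 0#
  0≤xx+yy x y p with <-cotrans p (x * x)
  ... | inj₁ q = 0≤x*x y (+-cancelʳ-<0 q)
  ... | inj₂ q = 0≤x*x x q

  0<1 : 0# < 1#
  0<1 with Equivalence.to #⇔<⊎> (invertible⇒# {1#} {0#} (1# , 1*[1-0] , [1-0]*1))
    where
    -0≈0 : - 0# ≈ 0#
    -0≈0 = trans (sym (+-identityˡ (- 0#))) (-‿inverseʳ 0#)
    [1-0]*1 : (1# - 0#) * 1# ≈ 1#
    [1-0]*1 = trans (*-identityʳ _) (trans (+-congˡ -0≈0) (+-identityʳ 1#))
    1*[1-0] : 1# * (1# - 0#) ≈ 1#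
    1*[1-0] = trans (*-comm _ _) [1-0]*1
  ... | inj₂ p = p
  ... | inj₁ p = <-respʳ-≈ (trans (neg*neg 1# 1#) (*-identityˡ 1#)) (*-pos (<0⇒0<- p) (<0⇒0<- p))

  -- (ac − bd)² + (ad + bc)² = (a² + b²)(c² + d²)
  two-squares : ∀ a b c d →
    (a * c - b * d) * (a * c - b * d) + (a * d + b * c) * (a * d + b * c)
      ≈ (a * a + b * b) * (c * c + d * d)
  two-squares a b c d = trans (expand (a * c) (- (b * d)) (a * d) (b * c))
    (trans (+-cong (+-congʳ (+-congˡ (neg*neg _ _))) (+-cong cross cross))
    (trans (+-congˡ (+-identityʳ 0#)) (trans (+-identityʳ _) (collect a b c d))))
    where
    expand : ∀ p m t u → (p + m) * (p + m) + (t + u) * (t + u)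
      ≈ (p * p + m * m + (t * t + u * u)) + ((p * m + t * u) + (p * m + t * u))
    expand = solve 4 (λ p m t u → (p :+ m) :* (p :+ m) :+ (t :+ u) :* (t :+ u)
      := (p :* p :+ m :* m :+ (t :* t :+ u :* u)) :+ ((p :* m :+ t :* u) :+ (p :* m :+ t :* u))) refl
    collect : ∀ a b c d →
      a * c * (a * c) + b * d * (b * d) + (a * d * (a * d) + b * c * (b * c))
        ≈ (a * a + b * b) * (c * c + d * d)
    collect = solve 4 (λ a b c d →
      a :* c :* (a :* c) :+ b :* d :* (b :* d) :+ (a :* d :* (a :* d) :+ b :* c :* (b :* c))
        := (a :* a :+ b :* b) :* (c :* c :+ d :* d)) refl
    swap : ∀ a b c d → a * d * (b * c) ≈ a * c * (b * d)
    swap = solve 4 (λ a b c d → a :* d :* (b :* c) := a :* c :* (b :* d)) refl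
    cross : a * c * - (b * d) + a * d * (b * c) ≈ 0#
    cross = trans (+-cong (sym (-‿distribʳ-* _ _)) (swap a b c d)) (-‿inverseˡ _)

  -- 1 − xy = (1 − x) + x(1 − y)
  0≤x<1∧y<1⇒xy<1 : ∀ {x y} → ¬ x < 0# → x < 1# → y < 1# → x * y < 1#
  0≤x<1∧y<1⇒xy<1 {x} {y} 0≤x x<1 y<1 =
    0<-⇒< (<-respʳ-≈ eq (0<+0≤ (<⇒0<- x<1) (0≤*0< 0≤x (<⇒0<- y<1))))
    where
    eq : 1# - x + x * (1# - y) ≈ 1# - x * y
    eq = trans (+-assoc _ _ _) (+-congˡ (trans (+-congˡ (distribˡ x 1# (- y)))
      (trans (sym (+-assoc _ _ _)) (trans (+-congʳ (trans (+-congˡ (*-identityʳ x)) (-‿inverseˡ x)))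
      (trans (+-identityˡ _) (sym (-‿distribʳ-* x y)))))))

  -- 2(1 − a) = (1 − (a² + b²)) + b² + (1 − a)²
  aa+bb<1⇒0<1-a : ∀ {a b} → a * a + b * b < 1# → 0# < 1# - a
  aa+bb<1⇒0<1-a {a} {b} p = half (<-respʳ-≈ eq
    (0<+0≤ (0<+0≤ (<⇒0<- p) (0≤x*x b)) (0≤x*x (1# - a))))
    where
    open SetoidReasoning setoid
    half : ∀ {x} → 0# < x + x → 0# < x
    half {x} q with <-cotrans q x
    ... | inj₁ 0<x = 0<x
    ... | inj₂ x<x+x = <-respˡ-≈ (-‿inverseˡ x) (<-respʳ-≈ (trans (sym (+-assoc _ _ _))
            (trans (+-congʳ (-‿inverseˡ x)) (+-identityˡ x))) (+-monoʳ-< (- x) x<x+x))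
    split : 1# ≈ (1# - a) + a
    split = sym (trans (+-assoc _ _ _) (trans (+-congˡ (-‿inverseˡ a)) (+-identityʳ 1#)))
    id₁ : ∀ s d a B → (s + B + d * d) + (a * a + B) ≈ (s + (a * a + B)) + (d * d + B)
    id₁ = solve 4 (λ s d a B → (s :+ B :+ d :* d) :+ (a :* a :+ B)
      := (s :+ (a :* a :+ B)) :+ (d :* d :+ B)) refl
    id₂ : ∀ d a B → (d + a) * (d + a) + (d * d + B) ≈ (d * (d + a) + d * (d + a)) + (a * a + B)
    id₂ = solve 3 (λ d a B → (d :+ a) :* (d :+ a) :+ (d :* d :+ B)
      := (d :* (d :+ a) :+ d :* (d :+ a)) :+ (a :* a :+ B)) refl
    lhs = 1# - (a * a + b * b) + b * b + (1# - a) * (1# - a)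
    cancel : ∀ {x y z} → x + z ≈ y + z → x ≈ y
    cancel {x} {y} {z} = ∙-cancelʳ z x y
    eq : lhs ≈ (1# - a) + (1# - a)
    eq = cancel (begin
      lhs + (a * a + b * b)
        ≈⟨ id₁ (1# - (a * a + b * b)) (1# - a) a (b * b) ⟩
      (1# - (a * a + b * b) + (a * a + b * b)) + ((1# - a) * (1# - a) + b * b)
        ≈⟨ +-congʳ (trans (+-assoc _ _ _) (trans (+-congˡ (-‿inverseˡ _)) (+-identityʳ 1#))) ⟩
      1# + ((1# - a) * (1# - a) + b * b)
        ≈⟨ +-congʳ (trans (sym (*-identityˡ 1#)) (*-cong split split)) ⟩
      ((1# - a) + a) * ((1# - a) + a) + ((1# - a) * (1# - a) + b * b)
        ≈⟨ id₂ (1# - a) a (b * b) ⟩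
      ((1# - a) * ((1# - a) + a) + (1# - a) * ((1# - a) + a)) + (a * a + b * b)
        ≈⟨ +-congʳ (+-cong back back) ⟩
      (1# - a) + (1# - a) + (a * a + b * b) ∎)
      where
      back : (1# - a) * ((1# - a) + a) ≈ 1# - a
      back = trans (*-congˡ (sym split)) (*-identityʳ _)

module Complex {c ℓ₁ ℓ₂ ℓ₃} (ℝ : RealField c ℓ₁ ℓ₂ ℓ₃) where

  private
    module ℝ = RealField ℝ
  open ℝ using (0#; 1#; _<_) renaming (Carrier to |ℝ|; _≈_ to _≈ʳ_)
  open RealFieldProperties ℝ

  infix 5 _+i_
  record ℂ : Set c where
    constructor _+i_
    field
      re im : |ℝ|
  open ℂ public

  infix  4 _≈_
  infixl 6 _+_ _-_
  infixl 7 _*_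

  _≈_ : Rel ℂ ℓ₁
  z ≈ w = (re z ≈ʳ re w) × (im z ≈ʳ im w)

  0ℂ 1ℂ : ℂ
  0ℂ = 0# +i 0#
  1ℂ = 1# +i 0#

  _+_ _-_ _*_ : ℂ → ℂ → ℂ
  z + w = (re z ℝ.+ re w) +i (im z ℝ.+ im w)
  z - w = (re z ℝ.- re w) +i (im z ℝ.- im w)
  z * w = (re z ℝ.* re w ℝ.- im z ℝ.* im w) +i (re z ℝ.* im w ℝ.+ im z ℝ.* re w)

  rawSemiring : RawSemiring c ℓ₁
  rawSemiring = record
    { Carrier = ℂ ; _≈_ = _≈_ ; _+_ = _+_ ; _*_ = _*_ ; 0# = 0ℂ ; 1# = 1ℂ }

  open RawSemiringOps rawSemiring public using (_^_)

  ∣_∣² : ℂ → |ℝ|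
  ∣ z ∣² = re z ℝ.* re z ℝ.+ im z ℝ.* im z

  infix 4 ∣_∣<_
  ∣_∣<_ : ℂ → |ℝ| → Set ℓ₃
  ∣ z ∣< r = (0# < r) × (∣ z ∣² < r ℝ.* r)

  _≠0 : ℂ → Set ℓ₃
  z ≠0 = 0# < ∣ z ∣²

  -- z⁻¹ = (re z − i im z) / ∣z∣²
  inverse : (z : ℂ) → z ≠0 → ℂ
  inverse z z≠0 = (re z ℝ.* r) +i (ℝ.- (im z ℝ.* r))
    where
    r : |ℝ|
    r = proj₁ (ℝ.#⇒invertible (0<⇒# z≠0))

  IsLimit : (ℕ → ℂ) → ℂ → Set (c ⊔ ℓ₃)
  IsLimit u z = ∀ ε → 0# < ε → ∃[ N ] ∀ n → N ℕ.≤ n → ∣ u n - z ∣< ε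

  -- Unconditional summation of a family: convergence of the net of sums over
  -- finite subsets, represented as duplicate-free lists.
  HasSum : ∀ {a} {A : Set a} → (A → ℂ) → ℂ → Set (a ⊔ c ⊔ ℓ₃)
  HasSum {A = A} f s = ∀ ε → 0# < ε → ∃[ F₀ ] ∀ (F : List A) → Unique F →
    (∀ {i} → i ∈ F₀ → i ∈ F) → ∣ foldr _+_ 0ℂ (map f F) - s ∣< ε

  -- (a ; q)ₘ
  pochhammer : ℂ → ℂ → ℕ → ℂ
  pochhammer a q zero    = 1ℂ
  pochhammer a q (suc m) = pochhammer a q m * (1ℂ - a * q ^ m)

  -- IsPochhammer∞ (a₁ ∷ … ∷ aᵣ ∷ []) q z : the products (aᵢ ; q)_∞ converge,
  -- and z is (a₁ , … , aᵣ ; q)_∞.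
  IsPochhammer∞ : List ℂ → ℂ → ℂ → Set (c ⊔ ℓ₁ ⊔ ℓ₃)
  IsPochhammer∞ []       q z = Lift (c ⊔ ℓ₁ ⊔ ℓ₃) (z ≈ 1ℂ)
  IsPochhammer∞ (a ∷ as) q z = ∃[ x ] ∃[ y ]
    IsLimit (pochhammer a q) x × IsPochhammer∞ as q y × (z ≈ x * y)

  module _ (q : ℂ) (∣q∣<1 : ∣ q ∣< 1#) where

    private
      ∣*∣² : ∀ z w → ∣ z * w ∣² ≈ʳ ∣ z ∣² ℝ.* ∣ w ∣²
      ∣*∣² z w = two-squares (re z) (im z) (re w) (im w)

      *-≠0 : ∀ z w → z ≠0 → w ≠0 → (z * w) ≠0
      *-≠0 z w z≠0 w≠0 = <-respʳ-≈ (ℝ.sym (∣*∣² z w)) (ℝ.*-pos z≠0 w≠0)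

      ∣1∣² : ∣ 1ℂ ∣² ≈ʳ 1#
      ∣1∣² = ℝ.trans (ℝ.+-cong (ℝ.*-identityˡ 1#) (ℝ.zeroˡ 0#)) (ℝ.+-identityʳ 1#)

      ∣q∣²<1 : ∣ q ∣² < 1#
      ∣q∣²<1 = let (_ , p) = ∣q∣<1 in <-respʳ-≈ (ℝ.*-identityˡ 1#) p

      ∣q*qⁿ∣²<1 : ∀ n → ∣ q * q ^ n ∣² < 1#
      ∣q*qⁿ∣²<1 zero    = <-respˡ-≈ (ℝ.sym (ℝ.trans (∣*∣² q 1ℂ)
        (ℝ.trans (ℝ.*-congˡ ∣1∣²) (ℝ.*-identityʳ _)))) ∣q∣²<1
      ∣q*qⁿ∣²<1 (suc n) = <-respˡ-≈ (ℝ.sym (∣*∣² q (q ^ suc n)))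
        (0≤x<1∧y<1⇒xy<1 (0≤xx+yy (re q) (im q)) ∣q∣²<1 (∣q*qⁿ∣²<1 n))

      1-w≠0 : ∀ w → ∣ w ∣² < 1# → (1ℂ - w) ≠0
      1-w≠0 w p = 0<+0≤ (ℝ.*-pos 0<1-a 0<1-a) (0≤x*x (0# ℝ.- im w))
        where
        0<1-a = aa+bb<1⇒0<1-a {re w} {im w} p

    -- (q)ₘ
    qfac : ℕ → ℂ
    qfac = pochhammer q q

    qfac≠0 : ∀ m → qfac m ≠0
    qfac≠0 zero    = <-respʳ-≈ (ℝ.sym ∣1∣²) 0<1
    qfac≠0 (suc m) = *-≠0 (qfac m) (1ℂ - q * q ^ m) (qfac≠0 m)
      (1-w≠0 (q * q ^ m) (∣q*qⁿ∣²<1 m))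

    1/qfac : ℕ → ℂ
    1/qfac m = inverse (qfac m) (qfac≠0 m)

    qbinomial : ℕ → ℕ → ℂ
    qbinomial A B with B ℕ.≤? A
    ... | yes _ = qfac A * (1/qfac B * 1/qfac (A ℕ.∸ B))
    ... | no  _ = 0ℂ

T : ℕ → ℕ
T j = (j ℕ.* suc j) ℕ./ 2

-- Write eₙ = n² + n, so that 2T(n) = eₙ.  By Bressoud's identity
--   Σₙ q^eₙ [k, n] = Σⱼ (−1)ʲ q^(j(5j+3)/2) [2k+1, k+1+2j]   (j ∈ ℤ)
-- the sequence βₖ = 1/(q)₂ₖ₊₁ Σₙ q^eₙ [k, n] belongs to a Bailey pair relative to a = q, and
-- the sum over m, k, n is what two steps of the Bailey chain make of it:
--   Σₘ,ₖ q^(eₖ+eₘ₊ₖ) βₖ/(q)ₘ = 1/(q)∞ Σⱼ (−1)ʲ q^(j(21j+11)/2),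
-- which the Jacobi triple product turns into the quotient on the right-hand side.
-- Bressoud's identity and the triple product are proved in finite form, from the two Pascal
-- rules, and the Bailey chain is stopped at a finite level L.  All passages to the limit are then
-- estimates O(τ^L) with ∣q∣ ≤ τ < 1.

module Submission where

open import Defs
open import Algebra.Bundles using (CommutativeRing; RawRing)
import Algebra.Definitions.RawMonoid as RawMonoidOps
import Algebra.Properties.AbelianGroup as AbelianGroupProperties
import Algebra.Properties.CommutativeSemiring.Exp as CommutativeExp
import Algebra.Properties.Ring as RingProperties
import Algebra.Properties.Semiring.Exp as Exp
import Algebra.Properties.Semiring.Mult.TCOptimised as TCMult
import Algebra.Solver.Ring as RingSolver
import Algebra.Solver.Ring.NaturalCoefficients.Default as SemiringSolver
open import Algebra.Solver.Ring.AlmostCommutativeRing using (fromCommutativeRing; _-Raw-AlmostCommutative⟶_)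
open import Data.Empty using (⊥-elim)
open import Data.List.Base using (List; []; _∷_; map; foldr; upTo; cartesianProduct)
import Data.List.Membership.DecPropositional as DecMembership
open import Data.List.Membership.Propositional using (_∈_; _∉_)
open import Data.List.Membership.Propositional.Properties using (∈-cartesianProduct⁺; ∈-upTo⁺)
open import Data.List.Relation.Unary.All as All using (All; []; _∷_)
open import Data.List.Relation.Unary.All.Properties using (All¬⇒¬Any)
open import Data.List.Relation.Unary.AllPairs using ([]; _∷_)
open import Data.List.Relation.Unary.Any using (here; there)
open import Data.List.Relation.Unary.Unique.Propositional using (Unique)
open import Data.Maybe.Base using (Maybe; just; nothing)
open import Data.Nat.Base as ℕ using (ℕ; zero; suc; z≤n; s≤s; _∸_)
import Data.Nat.DivMod as ℕ
import Data.Nat.Properties as ℕ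
open import Data.Nat.Tactic.RingSolver using (solve-∀)
open import Data.Product.Base using (Σ-syntax; ∃-syntax; _×_; _,_; proj₁; proj₂)
open import Data.Product.Properties using (≡-dec)
open import Data.Sum.Base using (_⊎_; inj₁; inj₂)
open import Function.Base using (_∘_; id; const)
open import Function.Bundles using (Equivalence)
open import Level using (Level; _⊔_; lift)
open import Relation.Binary.Definitions using (DecidableEquality)
open import Relation.Binary.PropositionalEquality.Core as ≡ using (_≡_; _≢_)
import Relation.Binary.Reasoning.Setoid as SetoidReasoning
open import Relation.Nullary.Decidable.Core using (yes; no)
open import Relation.Nullary.Negation.Core using (¬_)

-- The algebra avoids division and negative indices. A bilateral sum is folded by pairing j with -1
-- - j, so symmetries of ℤ show up as boundary terms at j = 0, and 1/(q)ₙ is a sequence `u` with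
-- `p n * u n ≈ 1#`. The finite identities then hold in any commutative ring with such a `u`, and q
-- = 0 is no special case. Bressoud's identity does not close under induction on k by itself: it is
-- proved together with a companion for Σₙ q^(n²) [k, n], both sides obeying the same pair of
-- recurrences. Level L multiplies the summand by (q)_L/(q)_(L-m-k), which is close to 1 only while
-- m + k stays well below L. The quadratic exponents pay for this: with s = m + k + n the summand is
-- O(τ^(2s)), where one s compensates the slow weight and the other makes the error summable. The
-- theta series is treated in the same way. The order on ℝ is constructive: x ≤ y is a negation,
-- equalities come from tightness, and moduli are compared through squares. That (q)_∞ is nonzero
-- follows from exhibiting its inverse as the limit of 1/(q)ₙ.

-- A ring solver whose integer coefficients are formal differences (a , b) of naturals.
module IntegerCoefficients {c ℓ} (R : CommutativeRing c ℓ) where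
  open CommutativeRing R hiding (zero)
  open RingProperties ring using (-0#≈0#; -‿involutive; -‿distribˡ-*; -‿distribʳ-*)
  open AbelianGroupProperties +-abelianGroup using (⁻¹-∙-comm)
  open TCMult semiring using (×-homo-+; ×1-homo-*) renaming (_×_ to _·_)
  open SetoidReasoning setoid
  private
    module S = SemiringSolver commutativeSemiring

    -- Reduced representatives, because the solver compares normal forms syntactically.
    reduce : ℕ × ℕ → ℕ × ℕ
    reduce (suc a , suc b) = reduce (a , b)
    reduce (a     , b)     = a , b

    differences : RawRing _ _
    differences = record
      { Carrier = ℕ × ℕ
      ; _≈_     = _≡_
      ; _+_     = λ (a , b) (c , d) → reduce (a ℕ.+ c , b ℕ.+ d)
      ; _*_     = λ (a , b) (c , d) → reduce (a ℕ.* c ℕ.+ b ℕ.* d , a ℕ.* d ℕ.+ b ℕ.* c)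
      ; -_      = λ (a , b) → b , a
      ; 0#      = 0 , 0
      ; 1#      = 1 , 0
      }

    -- No subtraction when the second part is 0: the constants 0 and 1 then denote `0#` and `1#`
    -- definitionally, and `0-homo` and `1-homo` are `refl`.
    ⟦_⟧ : ℕ × ℕ → Carrier
    ⟦ a , zero ⟧  = a · 1#
    ⟦ a , suc b ⟧ = a · 1# - suc b · 1#

    ⟦⟧≈ : ∀ a b → ⟦ a , b ⟧ ≈ a · 1# - b · 1#
    ⟦⟧≈ a zero    = sym (trans (+-congˡ -0#≈0#) (+-identityʳ _))
    ⟦⟧≈ a (suc b) = refl

    difference-+ : ∀ a b c d → (a + c) - (b + d) ≈ (a - b) + (c - d)
    difference-+ a b c d = trans (+-congˡ (sym (⁻¹-∙-comm b d)))
      (S.solve 4 (λ a c b d → ((a S.:+ c) S.:+ (b S.:+ d)) S.:= ((a S.:+ b) S.:+ (c S.:+ d))) refl a c (- b) (- d))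

    ⟦reduce⟧ : ∀ a b → ⟦ reduce (a , b) ⟧ ≈ a · 1# - b · 1#
    ⟦reduce⟧ zero    b       = ⟦⟧≈ zero b
    ⟦reduce⟧ (suc a) zero    = ⟦⟧≈ (suc a) zero
    ⟦reduce⟧ (suc a) (suc b) = begin
      ⟦ reduce (a , b) ⟧                         ≈⟨ ⟦reduce⟧ a b ⟩
      a · 1# - b · 1#                            ≈⟨ +-identityˡ _ ⟨
      0# + (a · 1# - b · 1#)                     ≈⟨ +-congʳ (-‿inverseʳ 1#) ⟨
      (1# - 1#) + (a · 1# - b · 1#)              ≈⟨ difference-+ _ _ _ _ ⟨
      (1# + a · 1#) - (1# + b · 1#)              ≈⟨ +-cong (×-homo-+ 1# 1 a) (-‿cong (×-homo-+ 1# 1 b)) ⟨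
      suc a · 1# - suc b · 1#                    ∎

    difference-* : ∀ a b c d → (a * c + b * d) - (a * d + b * c) ≈ (a - b) * (c - d)
    difference-* a b c d = begin
      (a * c + b * d) - (a * d + b * c)
        ≈⟨ difference-+ (a * c) (a * d) (b * d) (b * c) ⟩
      (a * c - a * d) + (b * d - b * c)
        ≈⟨ +-cong (+-congˡ (-‿distribʳ-* a d))
                  (+-cong (sym (trans (sym (-‿distribˡ-* b (- d))) (trans (-‿cong (sym (-‿distribʳ-* b d))) (-‿involutive _)))) (-‿distribˡ-* b c)) ⟩
      (a * c + a * - d) + (- b * - d + - b * c)
        ≈⟨ S.solve 4 (λ a b c d → ((a S.:* c S.:+ a S.:* d) S.:+ (b S.:* d S.:+ b S.:* c)) S.:= ((a S.:+ b) S.:* (c S.:+ d))) refl a (- b) c (- d) ⟩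
      (a - b) * (c - d) ∎

    morphism : differences -Raw-AlmostCommutative⟶ fromCommutativeRing R
    morphism = record
      { ⟦_⟧    = ⟦_⟧
      ; +-homo = λ (a , b) (c , d) → trans (⟦reduce⟧ (a ℕ.+ c) (b ℕ.+ d)) (trans
          (+-cong (×-homo-+ 1# a c) (-‿cong (×-homo-+ 1# b d)))
          (trans (difference-+ _ _ _ _) (sym (+-cong (⟦⟧≈ a b) (⟦⟧≈ c d)))))
      ; *-homo = λ (a , b) (c , d) → trans (⟦reduce⟧ (a ℕ.* c ℕ.+ b ℕ.* d) (a ℕ.* d ℕ.+ b ℕ.* c)) (trans
          (+-cong (trans (×-homo-+ 1# (a ℕ.* c) _) (+-cong (×1-homo-* a c) (×1-homo-* b d)))
                  (-‿cong (trans (×-homo-+ 1# (a ℕ.* d) _) (+-cong (×1-homo-* a d) (×1-homo-* b c)))))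
          (trans (difference-* _ _ _ _) (sym (*-cong (⟦⟧≈ a b) (⟦⟧≈ c d)))))
      ; -‿homo = λ (a , b) → trans (⟦⟧≈ b a) (trans (+-comm _ _)
          (trans (+-congˡ (sym (-‿involutive _))) (trans (⁻¹-∙-comm _ _) (-‿cong (sym (⟦⟧≈ a b))))))
      ; 0-homo = refl
      ; 1-homo = refl
      }

    _≟_ : ∀ x y → Maybe (⟦ x ⟧ ≈ ⟦ y ⟧)
    (a , b) ≟ (c , d) with a ℕ.+ d ℕ.≟ c ℕ.+ b
    ... | no _ = nothing
    ... | yes eq = just (trans (⟦⟧≈ a b) (trans
      (begin
        a · 1# - b · 1#                                 ≈⟨ +-identityʳ _ ⟨
        (a · 1# - b · 1#) + 0#                          ≈⟨ +-congˡ (-‿inverseʳ (d · 1#)) ⟨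
        (a · 1# - b · 1#) + (d · 1# - d · 1#)           ≈⟨ difference-+ _ _ _ _ ⟨
        (a · 1# + d · 1#) - (b · 1# + d · 1#)           ≈⟨ +-cong eq′ (-‿cong (+-comm _ _)) ⟩
        (c · 1# + b · 1#) - (d · 1# + b · 1#)           ≈⟨ difference-+ _ _ _ _ ⟩
        (c · 1# - d · 1#) + (b · 1# - b · 1#)           ≈⟨ +-congˡ (-‿inverseʳ (b · 1#)) ⟩
        (c · 1# - d · 1#) + 0#                          ≈⟨ +-identityʳ _ ⟩
        c · 1# - d · 1#                                 ∎)
      (sym (⟦⟧≈ c d))))
      where
      eq′ : a · 1# + d · 1# ≈ c · 1# + b · 1#
      eq′ = trans (sym (×-homo-+ 1# a d)) (trans (reflexive (≡.cong (_· 1#) eq)) (×-homo-+ 1# c b))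

  open RingSolver differences (fromCommutativeRing R) morphism _≟_ public
    using (solve; Polynomial; con; _:+_; _:*_; _:-_; :-_; _:=_)

  one nil : ∀ {n} → Polynomial n
  one = con (1 , 0)
  nil = con (0 , 0)

-- Finite sums and Gaussian binomials over a commutative ring.

-- Recursive, so that `gauss (double (suc n))` unfolds definitionally to rows 2n + 1 and 2n.
double : ℕ → ℕ
double zero    = zero
double (suc n) = suc (suc (double n))

double≡+ : ∀ n → double n ≡ n ℕ.+ n
double≡+ zero    = ≡.refl
double≡+ (suc n) = ≡.cong suc (≡.trans (≡.cong suc (double≡+ n)) (≡.sym (ℕ.+-suc n n)))

-- t n = n(n − 1)/2
t : ℕ → ℕ
t zero    = zero
t (suc n) = t n ℕ.+ n

module Sums {c ℓ} (R : CommutativeRing c ℓ) where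
  open CommutativeRing R hiding (zero)
  open IntegerCoefficients R
  open SetoidReasoning setoid

  *-≈0 : ∀ x {y} → y ≈ 0# → x * y ≈ 0#
  *-≈0 x y≈0 = trans (*-congˡ y≈0) (zeroʳ x)

  ≈0-* : ∀ {x} y → x ≈ 0# → x * y ≈ 0#
  ≈0-* y x≈0 = trans (*-congʳ x≈0) (zeroˡ y)

  sgn : ℕ → Carrier
  sgn zero    = 1#
  sgn (suc n) = - sgn n

  sum : (ℕ → Carrier) → ℕ → Carrier
  sum f zero    = 0#
  sum f (suc n) = sum f n + f n

  sum-cong-< : ∀ {f g} N → (∀ n → n ℕ.< N → f n ≈ g n) → sum f N ≈ sum g N
  sum-cong-< zero    f≈g = refl
  sum-cong-< (suc N) f≈g = +-cong (sum-cong-< N (λ n n<N → f≈g n (ℕ.m<n⇒m<1+n n<N))) (f≈g N ℕ.≤-refl)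

  sum-cong : ∀ {f g} N → (∀ n → f n ≈ g n) → sum f N ≈ sum g N
  sum-cong N f≈g = sum-cong-< N (λ n _ → f≈g n)

  sum-≈0 : ∀ {f : ℕ → Carrier} N → (∀ n → n ℕ.< N → f n ≈ 0#) → sum f N ≈ 0#
  sum-≈0 zero    f≈0 = refl
  sum-≈0 (suc N) f≈0 = trans (+-cong (sum-≈0 N (λ n n<N → f≈0 n (ℕ.m<n⇒m<1+n n<N))) (f≈0 N ℕ.≤-refl)) (+-identityʳ 0#)

  sum-+ : ∀ f g N → sum (λ n → f n + g n) N ≈ sum f N + sum g N
  sum-+ f g zero    = sym (+-identityʳ 0#)
  sum-+ f g (suc N) = trans (+-congʳ (sum-+ f g N))
    (solve 4 (λ a b x y → (a :+ b) :+ (x :+ y) := (a :+ x) :+ (b :+ y)) refl _ _ _ _)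

  sum-*ˡ : ∀ a f N → sum (λ n → a * f n) N ≈ a * sum f N
  sum-*ˡ a f zero    = sym (zeroʳ a)
  sum-*ˡ a f (suc N) = trans (+-congʳ (sum-*ˡ a f N)) (sym (distribˡ a _ _))

  sum-- : ∀ f g N → sum (λ n → f n - g n) N ≈ sum f N - sum g N
  sum-- f g zero    = sym (-‿inverseʳ 0#)
  sum-- f g (suc N) = trans (+-congʳ (sum-- f g N))
    (solve 4 (λ a b x y → (a :- b) :+ (x :- y) := (a :+ x) :- (b :+ y)) refl _ _ _ _)

  sum-swap : ∀ (f : ℕ → ℕ → Carrier) M N → sum (λ m → sum (f m) N) M ≈ sum (λ n → sum (λ m → f m n) M) N
  sum-swap f zero    N = sym (sum-≈0 N (λ _ _ → refl))
  sum-swap f (suc M) N = trans (+-congʳ (sum-swap f M N)) (sym (sum-+ _ _ N))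

  sum-shift : ∀ f N → sum f N + f N ≈ f 0 + sum (λ n → f (suc n)) N
  sum-shift f zero    = +-comm _ _
  sum-shift f (suc N) = trans (+-congʳ (sum-shift f N)) (+-assoc _ _ _)

  sum-split : ∀ f M N → sum f (M ℕ.+ N) ≈ sum f M + sum (λ n → f (M ℕ.+ n)) N
  sum-split f M zero    = trans (reflexive (≡.cong (sum f) (ℕ.+-identityʳ M))) (sym (+-identityʳ _))
  sum-split f M (suc N) = trans (reflexive (≡.cong (sum f) (ℕ.+-suc M N)))
    (trans (+-congʳ (sum-split f M N)) (+-assoc _ _ _))

  sum-extend : ∀ f {M N} → M ℕ.≤ N → (∀ n → M ℕ.≤ n → f n ≈ 0#) → sum f N ≈ sum f M
  sum-extend f {M} {N} M≤N f≈0 = begin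
    sum f N                                          ≡⟨ ≡.cong (sum f) (≡.sym (ℕ.m+[n∸m]≡n M≤N)) ⟩
    sum f (M ℕ.+ (N ∸ M))                            ≈⟨ sum-split f M (N ∸ M) ⟩
    sum f M + sum (λ n → f (M ℕ.+ n)) (N ∸ M)        ≈⟨ +-congˡ (sum-≈0 (N ∸ M) (λ n _ → f≈0 _ (ℕ.m≤m+n M n))) ⟩
    sum f M + 0#                                     ≈⟨ +-identityʳ _ ⟩
    sum f M                                          ∎

  sum-drop : ∀ f {M N} → M ℕ.≤ N → (∀ n → n ℕ.< M → f n ≈ 0#) → sum f N ≈ sum (λ n → f (M ℕ.+ n)) (N ∸ M)
  sum-drop f {M} {N} M≤N f≈0 = begin
    sum f N                                          ≡⟨ ≡.cong (sum f) (≡.sym (ℕ.m+[n∸m]≡n M≤N)) ⟩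
    sum f (M ℕ.+ (N ∸ M))                            ≈⟨ sum-split f M (N ∸ M) ⟩
    sum f M + sum (λ n → f (M ℕ.+ n)) (N ∸ M)        ≈⟨ +-congʳ (sum-≈0 M f≈0) ⟩
    0# + sum (λ n → f (M ℕ.+ n)) (N ∸ M)             ≈⟨ +-identityˡ _ ⟩
    sum (λ n → f (M ℕ.+ n)) (N ∸ M)                  ∎

  sum-first : ∀ f {N} → 0 ℕ.< N → (∀ n → f (suc n) ≈ 0#) → sum f N ≈ f 0
  sum-first f 0<N f≈0 = trans (sum-extend f 0<N (λ { (suc n) _ → f≈0 n })) (+-identityˡ _)

module QSeries {c ℓ} (R : CommutativeRing c ℓ) (q : CommutativeRing.Carrier R) where
  open CommutativeRing R hiding (zero)
  open IntegerCoefficients R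
  open Sums R
  open SetoidReasoning setoid
  open Exp semiring public using (_^_)
  open Exp semiring using (^-homo-*)

  ^-+ : ∀ a b {d} → a ℕ.+ b ≡ d → q ^ a * q ^ b ≈ q ^ d
  ^-+ a b ≡.refl = sym (^-homo-* q a b)

  ^-+-* : ∀ a b {d} → a ℕ.+ b ≡ d → ∀ x → q ^ a * (q ^ b * x) ≈ q ^ d * x
  ^-+-* a b e x = trans (sym (*-assoc _ _ x)) (*-congʳ (^-+ a b e))

  ^-≡ : ∀ {a b} → a ≡ b → q ^ a ≈ q ^ b
  ^-≡ ≡.refl = refl

  -- (q ; q)ₙ
  p : ℕ → Carrier
  p zero    = 1#
  p (suc n) = p n * (1# - q ^ suc n)

  -- Defined by one Pascal rule rather than by a quotient, hence meaningful in every commutative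
  -- ring.
  gauss : ℕ → ℕ → Carrier
  gauss _       zero    = 1#
  gauss zero    (suc m) = 0#
  gauss (suc n) (suc m) = gauss n m + q ^ suc m * gauss n (suc m)

  gauss-< : ∀ {n m} → n ℕ.< m → gauss n m ≈ 0#
  gauss-< {zero}  {suc m} _         = refl
  gauss-< {suc n} {suc m} (s≤s n<m) = trans (+-cong (gauss-< n<m)
    (trans (*-congˡ (gauss-< (ℕ.m<n⇒m<1+n n<m))) (zeroʳ _))) (+-identityʳ 0#)

  -- A chosen inverse of every (q)ₙ gives the quotient formula, and through it the symmetry and the
  -- second Pascal rule, neither of which is visible in the recursion of `gauss`.
  module Reciprocal (u : ℕ → Carrier) (p*u : ∀ n → p n * u n ≈ 1#) where

    u-step : ∀ n → u n ≈ u (suc n) * (1# - q ^ suc n)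
    u-step n = begin
      u n                                              ≈⟨ *-identityʳ _ ⟨
      u n * 1#                                         ≈⟨ *-congˡ (p*u (suc n)) ⟨
      u n * (p n * (1# - q ^ suc n) * u (suc n))       ≈⟨ solve 4 (λ a b d e → a :* (b :* d :* e) := (b :* a) :* (e :* d)) refl _ _ _ _ ⟩
      (p n * u n) * (u (suc n) * (1# - q ^ suc n))     ≈⟨ *-congʳ (p*u n) ⟩
      1# * (u (suc n) * (1# - q ^ suc n))              ≈⟨ *-identityˡ _ ⟩
      u (suc n) * (1# - q ^ suc n)                     ∎

    u0≈1 : u 0 ≈ 1#
    u0≈1 = trans (sym (*-identityˡ _)) (p*u 0)

    -- Over the common denominator (q)_(m+1) (q)_(d+1) the two terms of Pascal's rule have
    -- numerators adding up by (1 - x) + x(1 - y) = 1 - xy, where x = q^(m+1) and y = q^(d+1).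
    gauss-closed : ∀ m d → gauss (m ℕ.+ d) m ≈ p (m ℕ.+ d) * (u m * u d)
    gauss-closed zero    d       = sym (trans (*-congˡ (trans (*-congʳ u0≈1) (*-identityˡ _))) (p*u d))
    gauss-closed (suc m) zero    = begin
      gauss (m ℕ.+ 0) m + q ^ suc m * gauss (m ℕ.+ 0) (suc m)
        ≈⟨ +-cong (gauss-closed m 0) (trans (*-congˡ (gauss-< (s≤s (ℕ.≤-reflexive (ℕ.+-identityʳ m))))) (zeroʳ _)) ⟩
      p (m ℕ.+ 0) * (u m * u 0) + 0#
        ≈⟨ +-congʳ (*-cong (reflexive (≡.cong p (ℕ.+-identityʳ m))) (*-congˡ u0≈1)) ⟩
      p m * (u m * 1#) + 0#
        ≈⟨ solve 2 (λ a b → a :* (b :* one) :+ nil := a :* b) refl _ _ ⟩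
      p m * u m
        ≈⟨ trans (p*u m) (sym (p*u (suc m))) ⟩
      p (suc m) * u (suc m)
        ≈⟨ *-cong (reflexive (≡.cong p (≡.cong suc (≡.sym (ℕ.+-identityʳ m))))) (trans (sym (*-identityʳ _)) (*-congˡ (sym u0≈1))) ⟩
      p (suc (m ℕ.+ 0)) * (u (suc m) * u 0) ∎
    gauss-closed (suc m) (suc d) = begin
      gauss (m ℕ.+ suc d) m + q ^ suc m * gauss (m ℕ.+ suc d) (suc m)
        ≈⟨ +-cong (gauss-closed m (suc d)) (*-congˡ (reflexive (≡.cong (λ n → gauss n (suc m)) m+1+d))) ⟩
      p (m ℕ.+ suc d) * (u m * u (suc d)) + q ^ suc m * gauss (suc m ℕ.+ d) (suc m)
        ≈⟨ +-congˡ (*-congˡ (trans (gauss-closed (suc m) d) (*-congʳ (reflexive (≡.cong p (≡.sym m+1+d)))))) ⟩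
      P * (u m * u (suc d)) + q ^ suc m * (P * (u (suc m) * u d))
        ≈⟨ +-cong (*-congˡ (*-congʳ (u-step m))) (*-congˡ (*-congˡ (*-congˡ (u-step d)))) ⟩
      P * (u (suc m) * (1# - q ^ suc m) * u (suc d)) + q ^ suc m * (P * (u (suc m) * (u (suc d) * (1# - q ^ suc d))))
        ≈⟨ solve 5 (λ P a b x y → P :* (a :* (one :- x) :* b) :+ x :* (P :* (a :* (b :* (one :- y)))) := P :* (one :- x :* y) :* (a :* b)) refl P (u (suc m)) (u (suc d)) (q ^ suc m) (q ^ suc d) ⟩
      P * (1# - q ^ suc m * q ^ suc d) * (u (suc m) * u (suc d))
        ≈⟨ *-congʳ (*-congˡ (+-congˡ (-‿cong (^-+ (suc m) (suc d) ≡.refl)))) ⟩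
      p (suc m ℕ.+ suc d) * (u (suc m) * u (suc d)) ∎
      where
      m+1+d = ℕ.+-suc m d
      P = p (m ℕ.+ suc d)

    gauss-sym : ∀ m d → gauss (m ℕ.+ d) m ≈ gauss (m ℕ.+ d) d
    gauss-sym m d = begin
      gauss (m ℕ.+ d) m            ≈⟨ gauss-closed m d ⟩
      p (m ℕ.+ d) * (u m * u d)    ≈⟨ *-cong (reflexive (≡.cong p (ℕ.+-comm m d))) (*-comm _ _) ⟩
      p (d ℕ.+ m) * (u d * u m)    ≈⟨ gauss-closed d m ⟨
      gauss (d ℕ.+ m) d            ≡⟨ ≡.cong (λ n → gauss n d) (ℕ.+-comm d m) ⟩
      gauss (m ℕ.+ d) d            ∎

    private
      -- The other splitting of the same numerator: 1 - xy = y(1 - x) + (1 - y).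
      pascal-+ : ∀ m d → gauss (suc (m ℕ.+ d)) (suc m) ≈ q ^ d * gauss (m ℕ.+ d) m + gauss (m ℕ.+ d) (suc m)
      pascal-+ m zero = +-cong (sym (*-identityˡ _))
        (trans (*-congˡ m+0<) (trans (zeroʳ _) (sym m+0<)))
        where
        m+0< : gauss (m ℕ.+ 0) (suc m) ≈ 0#
        m+0< = gauss-< (s≤s (ℕ.≤-reflexive (ℕ.+-identityʳ m)))
      pascal-+ m (suc d) = begin
        gauss (suc m ℕ.+ suc d) (suc m)
          ≈⟨ gauss-closed (suc m) (suc d) ⟩
        P * (1# - q ^ (suc m ℕ.+ suc d)) * (u (suc m) * u (suc d))
          ≈⟨ *-congʳ (*-congˡ (+-congˡ (-‿cong (^-+ (suc m) (suc d) ≡.refl)))) ⟨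
        P * (1# - q ^ suc m * q ^ suc d) * (u (suc m) * u (suc d))
          ≈⟨ solve 5 (λ P a b x y → P :* (one :- x :* y) :* (a :* b) := y :* (P :* (a :* (one :- x) :* b)) :+ P :* (a :* (b :* (one :- y)))) refl P (u (suc m)) (u (suc d)) (q ^ suc m) (q ^ suc d) ⟩
        q ^ suc d * (P * (u (suc m) * (1# - q ^ suc m) * u (suc d))) + P * (u (suc m) * (u (suc d) * (1# - q ^ suc d)))
          ≈⟨ +-cong (*-congˡ (*-congˡ (*-congʳ (u-step m)))) (*-congˡ (*-congˡ (u-step d))) ⟨
        q ^ suc d * (P * (u m * u (suc d))) + P * (u (suc m) * u d)
          ≈⟨ +-cong (*-congˡ (sym (gauss-closed m (suc d)))) (*-congʳ (reflexive (≡.cong p m+1+d))) ⟩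
        q ^ suc d * gauss (m ℕ.+ suc d) m + p (suc m ℕ.+ d) * (u (suc m) * u d)
          ≈⟨ +-congˡ (gauss-closed (suc m) d) ⟨
        q ^ suc d * gauss (m ℕ.+ suc d) m + gauss (suc m ℕ.+ d) (suc m)
          ≡⟨ ≡.cong (λ n → q ^ suc d * gauss (m ℕ.+ suc d) m + gauss n (suc m)) (≡.sym m+1+d) ⟩
        q ^ suc d * gauss (m ℕ.+ suc d) m + gauss (m ℕ.+ suc d) (suc m) ∎
        where
        m+1+d = ℕ.+-suc m d
        P = p (m ℕ.+ suc d)

    -- Pascal's rule with the factor qⁿ⁻ᵐ = qᵇ⁻ᵃ, scaled by qᵃ because n − m may be negative.
    pascal₂ : ∀ a b n m → a ℕ.+ n ≡ b ℕ.+ m →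
      q ^ a * gauss (suc n) (suc m) ≈ q ^ b * gauss n m + q ^ a * gauss n (suc m)
    pascal₂ a b n m e with m ℕ.≤? n
    ... | no m≰n = trans (trans (*-congˡ (gauss-< (s≤s n<m))) (zeroʳ _))
            (sym (trans (+-cong (trans (*-congˡ (gauss-< n<m)) (zeroʳ _))
                                (trans (*-congˡ (gauss-< (ℕ.m<n⇒m<1+n n<m))) (zeroʳ _))) (+-identityʳ 0#)))
            where n<m = ℕ.≰⇒> m≰n
    ... | yes m≤n with ℕ.m≤n⇒∃[o]m+o≡n m≤n
    ...   | d , ≡.refl = trans (*-congˡ (pascal-+ m d)) (trans (distribˡ _ _ _) (+-congʳ (^-+-* a d a+d≡b _)))
            where
            a+d≡b : a ℕ.+ d ≡ b
            a+d≡b = ℕ.+-cancelʳ-≡ m (a ℕ.+ d) b (≡.trans (reorder a d m) e)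
              where
              reorder : ∀ a d m → a ℕ.+ d ℕ.+ m ≡ a ℕ.+ (m ℕ.+ d)
              reorder = solve-∀

-- Bressoud's identity and its companion.

module Bressoud {c ℓ} (R : CommutativeRing c ℓ) (q : CommutativeRing.Carrier R)
  (u : ℕ → CommutativeRing.Carrier R)
  (p*u : ∀ n → CommutativeRing._≈_ R (CommutativeRing._*_ R (QSeries.p R q n) (u n)) (CommutativeRing.1# R)) where
  open CommutativeRing R hiding (zero)
  open IntegerCoefficients R
  open Sums R
  open QSeries R q
  open Reciprocal u p*u
  open SetoidReasoning setoid

  -- [2k, k + r] is symmetric under r ↦ -r and [2k + 1, k + 1 + r] under r ↦ -1 - r; hence natural r
  -- represent all of ℤ.
  A B : ℕ → ℕ → Carrier
  A k r = gauss (double k) (k ℕ.+ r)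
  B k r = gauss (suc (double k)) (suc (k ℕ.+ r))

  A-< : ∀ {k r} → k ℕ.< r → A k r ≈ 0#
  A-< {k} {r} k<r = gauss-< (≡.subst (ℕ._< k ℕ.+ r) (≡.sym (double≡+ k)) (ℕ.+-monoʳ-< k k<r))

  B-< : ∀ {k r} → k ℕ.< r → B k r ≈ 0#
  B-< {k} {r} k<r = gauss-< (s≤s (≡.subst (ℕ._< k ℕ.+ r) (≡.sym (double≡+ k)) (ℕ.+-monoʳ-< k k<r)))

  B-pascal₁ : ∀ k r → B k r ≈ A k r + q ^ suc (k ℕ.+ r) * A k (suc r)
  B-pascal₁ k r = +-congˡ (*-congˡ (reflexive (≡.cong (gauss (double k)) (≡.sym (ℕ.+-suc k r)))))

  B-pascal₂ : ∀ a b k r → a ℕ.+ k ≡ b ℕ.+ r → q ^ a * B k r ≈ q ^ b * A k r + q ^ a * A k (suc r)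
  B-pascal₂ a b k r e = trans (pascal₂ a b (double k) (k ℕ.+ r) e′)
    (+-congˡ (*-congˡ (reflexive (≡.cong (gauss (double k)) (≡.sym (ℕ.+-suc k r))))))
    where
    e′ : a ℕ.+ double k ≡ b ℕ.+ (k ℕ.+ r)
    e′ = ≡.trans (≡.cong (a ℕ.+_) (double≡+ k)) (≡.trans (≡.sym (ℕ.+-assoc a k k))
      (≡.trans (≡.cong (ℕ._+ k) e) (≡.trans (ℕ.+-assoc b r k) (≡.cong (b ℕ.+_) (ℕ.+-comm r k)))))

  A-pascal₁ : ∀ k r → A (suc k) (suc r) ≈ B k r + q ^ suc (suc (k ℕ.+ r)) * B k (suc r)
  A-pascal₁ k r = +-cong (reflexive (≡.cong (gauss (suc (double k))) (ℕ.+-suc k r)))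
    (*-congʳ (^-≡ (≡.cong suc (ℕ.+-suc k r))))

  A-pascal₂ : ∀ a b k r → a ℕ.+ k ≡ b ℕ.+ r → q ^ a * A (suc k) (suc r) ≈ q ^ b * B k r + q ^ a * B k (suc r)
  A-pascal₂ a b k r e = trans (pascal₂ a b (suc (double k)) (k ℕ.+ suc r) e′)
    (+-congʳ (*-congˡ (reflexive (≡.cong (gauss (suc (double k))) (ℕ.+-suc k r)))))
    where
    e′ : a ℕ.+ suc (double k) ≡ b ℕ.+ (k ℕ.+ suc r)
    e′ rewrite double≡+ k | ℕ.+-suc k r | ℕ.+-suc a (k ℕ.+ k) | ℕ.+-suc b (k ℕ.+ r) =
      ≡.cong suc (≡.trans (≡.sym (ℕ.+-assoc a k k))
      (≡.trans (≡.cong (ℕ._+ k) e) (≡.trans (ℕ.+-assoc b r k) (≡.cong (b ℕ.+_) (ℕ.+-comm r k)))))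

  -- At the centre Pascal's rule asks for `B k` at r = -1, which symmetry reflects to r = 0.
  A-zero : ∀ k → A (suc k) 0 ≈ B k 0 + q ^ suc k * B k 0
  A-zero k = +-cong (trans (reflexive (≡.cong₂ gauss 1+2k (ℕ.+-identityʳ k)))
      (trans (gauss-sym k (suc k)) (reflexive (≡.cong₂ gauss (≡.sym 1+2k) (≡.cong suc (≡.sym (ℕ.+-identityʳ k)))))))
    (*-congʳ (^-≡ (≡.cong suc (ℕ.+-identityʳ k))))
    where
    1+2k : suc (double k) ≡ k ℕ.+ suc k
    1+2k = ≡.trans (≡.cong suc (double≡+ k)) (≡.sym (ℕ.+-suc k k))

  private
    -- `α` and `β` are the values of j(5j + 3)/2 at j and at -1 - j, `γ` and `δ` those of j(5j +
    -- 1)/2. Writing them through `t` avoids halves and subtraction.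
    α β γ δ : ℕ → ℕ
    α j = 5 ℕ.* t j ℕ.+ 4 ℕ.* j
    β j = 5 ℕ.* t j ℕ.+ 6 ℕ.* j ℕ.+ 1
    γ j = 5 ℕ.* t j ℕ.+ 3 ℕ.* j
    δ j = 5 ℕ.* t j ℕ.+ 7 ℕ.* j ℕ.+ 2

  -- Bilateral sums over ℤ, folded by pairing j with −1 − j.
  rhs₀ rhs₁ : ℕ → ℕ → Carrier
  rhs₀ k N = sum (λ j → sgn j * (q ^ γ j * A k (double j) - q ^ δ j * A k (suc (suc (double j))))) N
  rhs₁ k N = sum (λ j → sgn j * (q ^ α j * B k (double j) - q ^ β j * B k (suc (double j)))) N

  -- Finite forms of the two Rogers-Ramanujan series. `lhs₁` is the sum wanted, `lhs₀` the companion
  -- that makes the induction close.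
  lhs₀ lhs₁ : ℕ → ℕ → Carrier
  lhs₀ k N = sum (λ n → q ^ (n ℕ.* n) * gauss k n) N
  lhs₁ k N = sum (λ n → q ^ (n ℕ.* n ℕ.+ n) * gauss k n) N

  -- The Pascal rule with the factor q^(k-n) fits: (n + 1)² + k - n = (k + 1) + (n² + n), which is
  -- the companion's exponent shifted by k + 1.
  lhs₀-step : ∀ k N → suc k ℕ.< N → lhs₀ (suc k) N ≈ lhs₀ k N + q ^ suc k * lhs₁ k N
  lhs₀-step k (suc N) (s≤s k<N) = begin
    sum f (suc N)
      ≈⟨ head f ⟩
    f 0 + sum (λ n → f (suc n)) N
      ≈⟨ +-congˡ (sum-cong N tail) ⟩
    f 0 + sum (λ n → q ^ suc k * h n + g (suc n)) N
      ≈⟨ +-congˡ (trans (sum-+ _ _ N) (+-congʳ (sum-*ˡ _ h N))) ⟩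
    f 0 + (q ^ suc k * sum h N + sum (λ n → g (suc n)) N)
      ≈⟨ solve 3 (λ a b d → a :+ (b :+ d) := (a :+ d) :+ b) refl _ _ _ ⟩
    f 0 + sum (λ n → g (suc n)) N + q ^ suc k * sum h N
      ≈⟨ +-cong (sym (head g)) (*-congˡ (trans (sym (+-identityʳ _)) (+-congˡ (sym (*-≈0 _ (gauss-< k<N)))))) ⟩
    lhs₀ k (suc N) + q ^ suc k * lhs₁ k (suc N) ∎
    where
    f g h : ℕ → Carrier
    f n = q ^ (n ℕ.* n) * gauss (suc k) n
    g n = q ^ (n ℕ.* n) * gauss k n
    h n = q ^ (n ℕ.* n ℕ.+ n) * gauss k n
    head : ∀ f → sum f (suc N) ≈ f 0 + sum (λ n → f (suc n)) N
    head f = sum-shift f N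
    e : ∀ k n → suc n ℕ.* suc n ℕ.+ k ≡ suc k ℕ.+ (n ℕ.* n ℕ.+ n) ℕ.+ n
    e = solve-∀
    tail : ∀ n → f (suc n) ≈ q ^ suc k * h n + g (suc n)
    tail n = trans (pascal₂ (suc n ℕ.* suc n) (suc k ℕ.+ (n ℕ.* n ℕ.+ n)) k n (e k n))
      (+-congʳ (sym (^-+-* (suc k) (n ℕ.* n ℕ.+ n) ≡.refl _)))

  -- Termwise. Expanding [k + 1, n] on the right by the first Pascal rule cancels the multiple of
  -- q^(k+1) [k, n], and what remains is the second Pascal rule for the left side.
  lhs₁-step : ∀ k N → lhs₁ (suc k) N ≈ q ^ suc k * lhs₀ (suc k) N + (1# - q ^ suc k) * lhs₁ k N
  lhs₁-step k N = sym (begin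
    q ^ suc k * lhs₀ (suc k) N + (1# - q ^ suc k) * lhs₁ k N
      ≈⟨ +-cong (sum-*ˡ _ _ N) (sum-*ˡ _ _ N) ⟨
    sum (λ n → q ^ suc k * (q ^ (n ℕ.* n) * gauss (suc k) n)) N + sum (λ n → (1# - q ^ suc k) * (q ^ (n ℕ.* n ℕ.+ n) * gauss k n)) N
      ≈⟨ sum-+ _ _ N ⟨
    sum (λ n → q ^ suc k * (q ^ (n ℕ.* n) * gauss (suc k) n) + (1# - q ^ suc k) * (q ^ (n ℕ.* n ℕ.+ n) * gauss k n)) N
      ≈⟨ sum-cong N term ⟩
    lhs₁ (suc k) N ∎)
    where
    e : ∀ S k n → S ℕ.+ suc n ℕ.+ k ≡ suc k ℕ.+ S ℕ.+ n
    e = solve-∀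
    term : ∀ n → q ^ suc k * (q ^ (n ℕ.* n) * gauss (suc k) n) + (1# - q ^ suc k) * (q ^ (n ℕ.* n ℕ.+ n) * gauss k n)
      ≈ q ^ (n ℕ.* n ℕ.+ n) * gauss (suc k) n
    term zero    = solve 1 (λ x → x :* (one :* one) :+ (one :- x) :* (one :* one) := one :* one) refl _
    term (suc n) = begin
      Q * (x * gauss (suc k) (suc n)) + (1# - Q) * (q ^ (S ℕ.+ suc n) * g₁)
        ≈⟨ +-congˡ (*-congˡ (*-congʳ (^-+ S (suc n) ≡.refl))) ⟨
      Q * (x * (g₀ + y * g₁)) + (1# - Q) * (x * y * g₁)
        ≈⟨ solve 5 (λ Q x y g₀ g₁ → Q :* (x :* (g₀ :+ y :* g₁)) :+ (one :- Q) :* (x :* y :* g₁)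
             := Q :* x :* g₀ :+ x :* y :* g₁) refl Q x y g₀ g₁ ⟩
      Q * x * g₀ + x * y * g₁
        ≈⟨ +-cong (*-congʳ (^-+ (suc k) S ≡.refl)) (*-congʳ (^-+ S (suc n) ≡.refl)) ⟩
      q ^ (suc k ℕ.+ S) * g₀ + q ^ (S ℕ.+ suc n) * g₁
        ≈⟨ pascal₂ (S ℕ.+ suc n) (suc k ℕ.+ S) k n (e S k n) ⟨
      q ^ (S ℕ.+ suc n) * gauss (suc k) (suc n) ∎
      where
      S = suc n ℕ.* suc n
      Q = q ^ suc k
      x = q ^ S
      y = q ^ suc n
      g₀ = gauss k n
      g₁ = gauss k (suc n)

  -- The reflection of ℤ in folded form. For g with g(j) = `y j` and g(-j) = `x j`, one side pairs
  -- -j with j + 1 and the other j with -1 - j. The hypotheses make the two values at 0 agree, and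
  -- g(N) agree with g(-N), the only terms in which the two ranges differ.
  sum-exchange : ∀ x y N → x 0 ≈ y 0 → x N ≈ y N →
    sum (λ j → x j + y (suc j)) N ≈ sum (λ j → y j + x (suc j)) N
  sum-exchange x y N x₀≈y₀ xN≈yN = begin
    sum (λ j → x j + y (suc j)) N
      ≈⟨ sum-+ _ _ N ⟩
    sum x N + sum (λ j → y (suc j)) N
      ≈⟨ solve 3 (λ a b d → a :+ b := a :+ ((d :+ b) :- d)) refl _ _ (y 0) ⟩
    sum x N + ((y 0 + sum (λ j → y (suc j)) N) - y 0)
      ≈⟨ +-congˡ (+-cong (sym (sum-shift y N)) (-‿cong (sym x₀≈y₀))) ⟩
    sum x N + ((sum y N + y N) - x 0)
      ≈⟨ +-congˡ (+-congʳ (+-congˡ (sym xN≈yN))) ⟩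
    sum x N + ((sum y N + x N) - x 0)
      ≈⟨ solve 4 (λ a b d e → a :+ ((b :+ d) :- e) := b :+ ((a :+ d) :- e)) refl _ _ _ _ ⟩
    sum y N + ((sum x N + x N) - x 0)
      ≈⟨ +-congˡ (+-congʳ (sum-shift x N)) ⟩
    sum y N + ((x 0 + sum (λ j → x (suc j)) N) - x 0)
      ≈⟨ solve 3 (λ a b d → a :+ ((d :+ b) :- d) := a :+ b) refl _ _ (x 0) ⟩
    sum y N + sum (λ j → x (suc j)) N
      ≈⟨ sum-+ _ _ N ⟨
    sum (λ j → y j + x (suc j)) N ∎

  private
    -- The terms common to the two recurrences for rhs₁.
    mid : ℕ → ℕ → Carrier
    mid k N = sum (λ j → sgn j * ((q ^ α j - q ^ β j) * A k (suc (double j)))) N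

    k<2N : ∀ {k N} → k ℕ.< N → k ℕ.< double N
    k<2N {k} {N} k<N = ℕ.<-≤-trans k<N (≡.subst (N ℕ.≤_) (≡.sym (double≡+ N)) (ℕ.m≤m+n N N))

    -- With the second Pascal rule at 2j and the first at 2j + 1, the outer terms share the factor
    -- q^k. They carry the exponents of `rhs₀`, but folded the wrong way round, which `sum-exchange`
    -- repairs.
    rhs₁-mid : ∀ k N → k ℕ.< N → rhs₁ k N ≈ q ^ k * rhs₀ k N + mid k N
    rhs₁-mid k N k<N = begin
      rhs₁ k N
        ≈⟨ sum-cong N term ⟩
      sum (λ j → q ^ k * (x j + y (suc j)) + sgn j * ((q ^ α j - q ^ β j) * A k (suc (double j)))) N
        ≈⟨ trans (sum-+ _ _ N) (+-congʳ (sum-*ˡ _ _ N)) ⟩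
      q ^ k * sum (λ j → x j + y (suc j)) N + mid k N
        ≈⟨ +-congʳ (*-congˡ (sum-exchange x y N refl (trans (*-≈0 _ (*-≈0 _ A≈0)) (sym (*-≈0 _ (*-≈0 _ A≈0)))))) ⟩
      q ^ k * sum (λ j → y j + x (suc j)) N + mid k N
        ≈⟨ +-congʳ (*-congˡ (sum-cong N term′)) ⟩
      q ^ k * rhs₀ k N + mid k N ∎
      where
      A≈0 : A k (double N) ≈ 0#
      A≈0 = A-< (k<2N k<N)
      x y : ℕ → Carrier
      x j = sgn j * (q ^ (5 ℕ.* t j ℕ.+ 2 ℕ.* j) * A k (double j))
      y j = sgn j * (q ^ γ j * A k (double j))
      e₁ : ∀ j k → α j ℕ.+ k ≡ (k ℕ.+ (5 ℕ.* t j ℕ.+ 2 ℕ.* j)) ℕ.+ double j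
      e₁ j k rewrite double≡+ j = go (t j) j k
        where
        go : ∀ T j k → (5 ℕ.* T ℕ.+ 4 ℕ.* j) ℕ.+ k ≡ (k ℕ.+ (5 ℕ.* T ℕ.+ 2 ℕ.* j)) ℕ.+ (j ℕ.+ j)
        go = solve-∀
      e₂ : ∀ j k → β j ℕ.+ suc (k ℕ.+ suc (double j)) ≡ k ℕ.+ γ (suc j)
      e₂ j k rewrite double≡+ j = go (t j) j k
        where
        go : ∀ T j k → (5 ℕ.* T ℕ.+ 6 ℕ.* j ℕ.+ 1) ℕ.+ suc (k ℕ.+ suc (j ℕ.+ j)) ≡ k ℕ.+ (5 ℕ.* (T ℕ.+ j) ℕ.+ 3 ℕ.* suc j)
        go = solve-∀
      e₃ : ∀ T j → 5 ℕ.* (T ℕ.+ j) ℕ.+ 2 ℕ.* suc j ≡ 5 ℕ.* T ℕ.+ 7 ℕ.* j ℕ.+ 2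
      e₃ = solve-∀
      term : ∀ j → sgn j * (q ^ α j * B k (double j) - q ^ β j * B k (suc (double j)))
        ≈ q ^ k * (x j + y (suc j)) + sgn j * ((q ^ α j - q ^ β j) * A k (suc (double j)))
      term j = begin
        sgn j * (q ^ α j * B k (double j) - q ^ β j * B k (suc (double j)))
          ≈⟨ *-congˡ (+-cong (trans (B-pascal₂ (α j) _ k (double j) (e₁ j k)) (+-congʳ (sym (^-+-* k _ ≡.refl _))))
               (-‿cong (trans (*-congˡ (B-pascal₁ k (suc (double j)))) (trans (distribˡ _ _ _)
                 (+-congˡ (trans (^-+-* (β j) _ (e₂ j k) _) (sym (^-+-* k _ ≡.refl _)))))))) ⟩
        sgn j * ((q ^ k * (X * A₀) + q ^ α j * A₁) - (q ^ β j * A₁ + q ^ k * (Y * A₂)))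
          ≈⟨ solve 9 (λ s K X Y a b A₀ A₁ A₂ → s :* ((K :* (X :* A₀) :+ a :* A₁) :- (b :* A₁ :+ K :* (Y :* A₂)))
               := K :* (s :* (X :* A₀) :+ :- s :* (Y :* A₂)) :+ s :* ((a :- b) :* A₁)) refl (sgn j) (q ^ k) X Y (q ^ α j) (q ^ β j) A₀ A₁ A₂ ⟩
        q ^ k * (x j + y (suc j)) + sgn j * ((q ^ α j - q ^ β j) * A₁) ∎
        where
        X = q ^ (5 ℕ.* t j ℕ.+ 2 ℕ.* j)
        Y = q ^ γ (suc j)
        A₀ = A k (double j)
        A₁ = A k (suc (double j))
        A₂ = A k (suc (suc (double j)))
      term′ : ∀ j → y j + x (suc j) ≈ sgn j * (q ^ γ j * A k (double j) - q ^ δ j * A k (suc (suc (double j))))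
      term′ j = trans (+-congˡ (*-congˡ (*-congʳ (^-≡ (e₃ (t j) j)))))
        (solve 5 (λ s a b A₀ A₂ → s :* (a :* A₀) :+ :- s :* (b :* A₂) := s :* (a :* A₀ :- b :* A₂)) refl (sgn j) (q ^ γ j) (q ^ δ j) _ _)

    -- The two copies of `A (suc k) (suc (double j))` are expanded by opposite Pascal rules. As β j
    -- - α j = 2j + 1, both expansions contain the same two terms, with the factor q^(k+1) on one in
    -- the first and on the other in the second; their difference is a multiple of 1 - q^(k+1).
    mid-step : ∀ k N → mid (suc k) N ≈ (1# - q ^ suc k) * rhs₁ k N
    mid-step k N = trans (sum-cong N term) (sum-*ˡ _ _ N)
      where
      e₁ : ∀ j k → α j ℕ.+ suc (suc (k ℕ.+ double j)) ≡ suc k ℕ.+ β j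
      e₁ j k rewrite double≡+ j = go (t j) j k
        where
        go : ∀ T j k → (5 ℕ.* T ℕ.+ 4 ℕ.* j) ℕ.+ suc (suc (k ℕ.+ (j ℕ.+ j))) ≡ suc k ℕ.+ (5 ℕ.* T ℕ.+ 6 ℕ.* j ℕ.+ 1)
        go = solve-∀
      e₂ : ∀ j k → β j ℕ.+ k ≡ (suc k ℕ.+ α j) ℕ.+ double j
      e₂ j k rewrite double≡+ j = go (t j) j k
        where
        go : ∀ T j k → (5 ℕ.* T ℕ.+ 6 ℕ.* j ℕ.+ 1) ℕ.+ k ≡ (suc k ℕ.+ (5 ℕ.* T ℕ.+ 4 ℕ.* j)) ℕ.+ (j ℕ.+ j)
        go = solve-∀
      term : ∀ j → sgn j * ((q ^ α j - q ^ β j) * A (suc k) (suc (double j)))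
        ≈ (1# - q ^ suc k) * (sgn j * (q ^ α j * B k (double j) - q ^ β j * B k (suc (double j))))
      term j = begin
        sgn j * ((q ^ α j - q ^ β j) * A′)
          ≈⟨ *-congˡ (solve 3 (λ a b x → (a :- b) :* x := a :* x :- b :* x) refl _ _ _) ⟩
        sgn j * (q ^ α j * A′ - q ^ β j * A′)
          ≈⟨ *-congˡ (+-cong (trans (*-congˡ (A-pascal₁ k (double j))) (trans (distribˡ _ _ _) (+-congˡ
               (trans (^-+-* (α j) _ (e₁ j k) _) (sym (^-+-* (suc k) _ ≡.refl _))))))
               (-‿cong (trans (A-pascal₂ (β j) _ k (double j) (e₂ j k)) (+-congʳ (sym (^-+-* (suc k) _ ≡.refl _)))))) ⟩
        sgn j * ((q ^ α j * B₀ + q ^ suc k * (q ^ β j * B₁)) - (q ^ suc k * (q ^ α j * B₀) + q ^ β j * B₁))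
          ≈⟨ solve 6 (λ s K a b B₀ B₁ → s :* ((a :* B₀ :+ K :* (b :* B₁)) :- (K :* (a :* B₀) :+ b :* B₁))
               := (one :- K) :* (s :* (a :* B₀ :- b :* B₁))) refl (sgn j) (q ^ suc k) (q ^ α j) (q ^ β j) B₀ B₁ ⟩
        (1# - q ^ suc k) * (sgn j * (q ^ α j * B₀ - q ^ β j * B₁)) ∎
        where
        A′ = A (suc k) (suc (double j))
        B₀ = B k (double j)
        B₁ = B k (suc (double j))

  rhs₁-step : ∀ k N → suc k ℕ.< N → rhs₁ (suc k) N ≈ q ^ suc k * rhs₀ (suc k) N + (1# - q ^ suc k) * rhs₁ k N
  rhs₁-step k N k<N = trans (rhs₁-mid (suc k) N k<N) (+-congˡ (mid-step k N))

  -- The term j = 0 is split off because it is its own mirror image: `A-zero` takes the place of the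
  -- second Pascal rule there. Afterwards the pieces without q^(k+1) regroup to `rhs₀ k`, those with
  -- it to `rhs₁ k`.
  rhs₀-step : ∀ k N → suc k ℕ.< N → rhs₀ (suc k) N ≈ rhs₀ k N + q ^ suc k * rhs₁ k N
  rhs₀-step k N k<N = begin
    rhs₀ (suc k) N
      ≈⟨ sum-cong N (λ j → trans (solve 5 (λ s a b x y → s :* (a :* x :- b :* y) := s :* (a :* x) :+ :- s :* (b :* y)) refl _ _ _ _ _) (+-congˡ (g-term j))) ⟩
    sum (λ j → f j + (ν j + Q * ψ (suc j))) N
      ≈⟨ trans (sum-+ _ _ N) (+-congˡ (trans (sum-+ _ _ N) (+-congˡ (sum-*ˡ Q _ N)))) ⟩
    sum f N + (sum ν N + Q * sum (λ j → ψ (suc j)) N)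
      ≈⟨ +-congʳ (trans (sym (+-identityʳ _)) (trans (+-congˡ (sym (*-≈0 _ (*-≈0 _ (A-< {suc k} {double N} 1+k<2N))))) (sum-shift f N))) ⟩
    f 0 + sum (λ j → f (suc j)) N + (sum ν N + Q * sum (λ j → ψ (suc j)) N)
      ≈⟨ +-congʳ (+-cong f-zero (trans (sum-cong N f-term) (trans (sum-+ _ _ N) (+-congˡ (sum-*ˡ Q _ N))))) ⟩
    (ϕ 0 + Q * ψ 0) + (sum (λ j → ϕ (suc j)) N + Q * sum μ N) + (sum ν N + Q * sum (λ j → ψ (suc j)) N)
      ≈⟨ solve 7 (λ a Q b d e f g → (a :+ Q :* b) :+ (d :+ Q :* e) :+ (f :+ Q :* g) := ((a :+ d) :+ f) :+ Q :* ((b :+ g) :+ e)) refl _ _ _ _ _ _ _ ⟩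
    ((ϕ 0 + sum (λ j → ϕ (suc j)) N) + sum ν N) + Q * ((ψ 0 + sum (λ j → ψ (suc j)) N) + sum μ N)
      ≈⟨ +-cong (+-congʳ (ends ϕ (*-≈0 _ (*-≈0 _ B≈0)))) (*-congˡ (+-congʳ (ends ψ (*-≈0 _ (*-≈0 _ B≈0))))) ⟩
    (sum ϕ N + sum ν N) + Q * (sum ψ N + sum μ N)
      ≈⟨ +-cong (trans (sym (sum-+ _ _ N)) (sum-cong N r₀-term)) (*-congˡ (trans (sym (sum-+ _ _ N)) (sum-cong N r₁-term))) ⟩
    rhs₀ k N + q ^ suc k * rhs₁ k N ∎
    where
    Q = q ^ suc k
    f ϕ ψ μ ν : ℕ → Carrier
    f j = sgn j * (q ^ γ j * A (suc k) (double j))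
    ϕ j = sgn j * (q ^ γ j * B k (double j))
    ψ j = sgn j * (q ^ α j * B k (double j))
    μ j = - sgn j * (q ^ β j * B k (suc (double j)))
    ν j = - sgn j * (q ^ δ j * B k (suc (double j)))
    1+k<2N : suc k ℕ.< double N
    1+k<2N = k<2N k<N
    B≈0 : B k (double N) ≈ 0#
    B≈0 = B-< (ℕ.<-trans (ℕ.n<1+n k) 1+k<2N)
    ends : ∀ h → h N ≈ 0# → h 0 + sum (λ j → h (suc j)) N ≈ sum h N
    ends h hN≈0 = trans (sym (sum-shift h N)) (trans (+-congˡ hN≈0) (+-identityʳ _))
    e₁ : ∀ j → δ j ℕ.+ suc (suc (k ℕ.+ suc (double j))) ≡ suc k ℕ.+ α (suc j)
    e₁ j rewrite double≡+ j = go (t j) j k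
      where
      go : ∀ T j k → (5 ℕ.* T ℕ.+ 7 ℕ.* j ℕ.+ 2) ℕ.+ suc (suc (k ℕ.+ suc (j ℕ.+ j))) ≡ suc k ℕ.+ (5 ℕ.* (T ℕ.+ j) ℕ.+ 4 ℕ.* suc j)
      go = solve-∀
    e₂ : ∀ j → γ (suc j) ℕ.+ k ≡ (suc k ℕ.+ β j) ℕ.+ suc (double j)
    e₂ j rewrite double≡+ j = go (t j) j k
      where
      go : ∀ T j k → (5 ℕ.* (T ℕ.+ j) ℕ.+ 3 ℕ.* suc j) ℕ.+ k ≡ (suc k ℕ.+ (5 ℕ.* T ℕ.+ 6 ℕ.* j ℕ.+ 1)) ℕ.+ suc (j ℕ.+ j)
      go = solve-∀
    e₃ : ∀ j → δ j ℕ.+ k ≡ (γ j ℕ.+ suc (k ℕ.+ double j)) ℕ.+ suc (double j)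
    e₃ j rewrite double≡+ j = go (t j) j k
      where
      go : ∀ T j k → (5 ℕ.* T ℕ.+ 7 ℕ.* j ℕ.+ 2) ℕ.+ k ≡ ((5 ℕ.* T ℕ.+ 3 ℕ.* j) ℕ.+ suc (k ℕ.+ (j ℕ.+ j))) ℕ.+ suc (j ℕ.+ j)
      go = solve-∀
    g-term : ∀ j → - sgn j * (q ^ δ j * A (suc k) (suc (suc (double j)))) ≈ ν j + Q * ψ (suc j)
    g-term j = trans (*-congˡ (trans (*-congˡ (A-pascal₁ k (suc (double j)))) (trans (distribˡ _ _ _) (+-congˡ
        (trans (^-+-* (δ j) _ (e₁ j) _) (sym (^-+-* (suc k) _ ≡.refl _)))))))
      (solve 4 (λ s a Q b → s :* (a :+ Q :* b) := s :* a :+ Q :* (s :* b)) refl _ _ _ _)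
    f-term : ∀ j → f (suc j) ≈ ϕ (suc j) + Q * μ j
    f-term j = trans (*-congˡ (trans (A-pascal₂ (γ (suc j)) (suc k ℕ.+ β j) k (suc (double j)) (e₂ j)) (+-congʳ (sym (^-+-* (suc k) (β j) ≡.refl _)))))
      (solve 4 (λ s a Q b → s :* (Q :* a :+ b) := s :* b :+ Q :* (s :* a)) refl _ _ _ _)
    f-zero : f 0 ≈ ϕ 0 + Q * ψ 0
    f-zero = trans (*-congˡ (*-congˡ (A-zero k)))
      (solve 2 (λ Q b → one :* (one :* (b :+ Q :* b)) := one :* (one :* b) :+ Q :* (one :* (one :* b))) refl _ _)
    -- Opposite Pascal rules produce the middle term `y` with the same exponent in both summands, so
    -- it cancels.
    r₀-term : ∀ j → ϕ j + ν j ≈ sgn j * (q ^ γ j * A k (double j) - q ^ δ j * A k (suc (suc (double j))))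
    r₀-term j = begin
      ϕ j + ν j
        ≈⟨ +-cong (*-congˡ (trans (*-congˡ (B-pascal₁ k (double j))) (trans (distribˡ _ _ _) (+-congˡ (^-+-* (γ j) _ ≡.refl _)))))
                  (*-congˡ (B-pascal₂ (δ j) _ k (suc (double j)) (e₃ j))) ⟩
      sgn j * (x + y) + - sgn j * (y + z)
        ≈⟨ solve 4 (λ s x y z → s :* (x :+ y) :+ :- s :* (y :+ z) := s :* (x :- z)) refl _ _ _ _ ⟩
      sgn j * (x - z) ∎
      where
      x = q ^ γ j * A k (double j)
      y = q ^ (γ j ℕ.+ suc (k ℕ.+ double j)) * A k (suc (double j))
      z = q ^ δ j * A k (suc (suc (double j)))
    r₁-term : ∀ j → ψ j + μ j ≈ sgn j * (q ^ α j * B k (double j) - q ^ β j * B k (suc (double j)))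
    r₁-term j = solve 3 (λ s x y → s :* x :+ :- s :* y := s :* (x :- y)) refl _ _ _

  bressoud : ∀ k N → k ℕ.< N → (lhs₀ k N ≈ rhs₀ k N) × (lhs₁ k N ≈ rhs₁ k N)
  bressoud zero N 0<N =
    trans (sum-first _ 0<N (λ n → *-≈0 _ refl)) (sym (trans (sum-first _ 0<N (λ j → *-≈0 _ (vanish (q ^ γ (suc j)) (q ^ δ (suc j)) refl refl)))
      (solve 1 (λ x → one :* (one :* one :- x :* nil) := one :* one) refl (q ^ δ 0)))) ,
    trans (sum-first _ 0<N (λ n → *-≈0 _ refl)) (sym (trans (sum-first _ 0<N (λ j → *-≈0 _ (vanish (q ^ α (suc j)) (q ^ β (suc j)) (B-< {0} {double (suc j)} (s≤s z≤n)) (B-< {0} {suc (double (suc j))} (s≤s z≤n)))))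
      (trans (*-congˡ (+-congˡ (-‿cong (*-≈0 _ (B-< {0} {1} (s≤s z≤n)))))) (solve 1 (λ x → one :* (one :* (one :+ x :* nil) :- nil) := one :* one) refl (q ^ 1)))))
    where
    vanish : ∀ {x y} a b → x ≈ 0# → y ≈ 0# → a * x - b * y ≈ 0#
    vanish a b x≈0 y≈0 = trans (+-cong (*-≈0 a x≈0) (-‿cong (*-≈0 b y≈0))) (-‿inverseʳ 0#)
  bressoud (suc k) N k<N with bressoud k N (ℕ.<-trans (ℕ.n<1+n k) k<N)
  -- The order matters: the recurrence for index 1 at k + 1 refers to index 0 at k + 1, not at k.
  ... | eq₀ , eq₁ = eq₀′ , trans (lhs₁-step k N) (trans (+-cong (*-congˡ eq₀′) (*-congˡ eq₁)) (sym (rhs₁-step k N k<N)))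
    where
    eq₀′ : lhs₀ (suc k) N ≈ rhs₀ (suc k) N
    eq₀′ = trans (lhs₀-step k N k<N) (trans (+-cong eq₀ (*-congˡ eq₁)) (sym (rhs₀-step k N k<N)))

-- The Bailey chain relative to a = q, at a finite level.

module Bailey {r₁ r₂} (R : CommutativeRing r₁ r₂) (q : CommutativeRing.Carrier R)
  (u : ℕ → CommutativeRing.Carrier R)
  (p*u : ∀ n → CommutativeRing._≈_ R (CommutativeRing._*_ R (QSeries.p R q n) (u n)) (CommutativeRing.1# R)) where
  open CommutativeRing R hiding (zero)
  open IntegerCoefficients R
  open Sums R
  open QSeries R q
  open Reciprocal u p*u
  open SetoidReasoning setoid
  private
    module Br = Bressoud R q u p*u

  -- 1/(q)ₐ₋ᵦ, which is 0 for a < b.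
  u∸ : ℕ → ℕ → Carrier
  u∸ a       zero    = u a
  u∸ zero    (suc b) = 0#
  u∸ (suc a) (suc b) = u∸ a b

  u∸-+ : ∀ b d → u∸ (b ℕ.+ d) b ≡ u d
  u∸-+ zero    d = ≡.refl
  u∸-+ (suc b) d = u∸-+ b d

  u∸-< : ∀ {a b} → a ℕ.< b → u∸ a b ≡ 0#
  u∸-< {zero}  {suc b} _         = ≡.refl
  u∸-< {suc a} {suc b} (s≤s a<b) = u∸-< a<b

  u∸-cancel : ∀ d a b → u∸ (d ℕ.+ a) (d ℕ.+ b) ≡ u∸ a b
  u∸-cancel zero    a b = ≡.refl
  u∸-cancel (suc d) a b = u∸-cancel d a b

  gauss≈ : ∀ n m → gauss n m ≈ p n * (u m * u∸ n m)
  gauss≈ n m with m ℕ.≤? n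
  ... | no m≰n = trans (gauss-< (ℕ.≰⇒> m≰n)) (sym (*-≈0 _ (*-≈0 _ (reflexive (u∸-< (ℕ.≰⇒> m≰n))))))
  ... | yes m≤n with ℕ.m≤n⇒∃[o]m+o≡n m≤n
  ...   | d , ≡.refl = trans (gauss-closed m d) (*-congˡ (*-congˡ (reflexive (≡.sym (u∸-+ m d)))))

  -- A q-Chu-Vandermonde sum, by induction on D for all c. Pascal's rule splits [D + 1, i] into `h`
  -- and a shifted `x`. Since 1/(q)_(c+i) = (1 - y)/(q)_(c+i+1) with y = q^(c+i+1), `h` and `x` at
  -- the same index merge into the term for D and c + 1.
  durfee : ∀ D c N → D ℕ.< N → sum (λ i → q ^ (i ℕ.* i ℕ.+ i ℕ.* c) * (gauss D i * u (c ℕ.+ i))) N ≈ u (c ℕ.+ D)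
  durfee zero    c N       0<N       = trans (sum-first _ 0<N (λ i → *-≈0 _ (zeroˡ _)))
    (trans (*-identityˡ _) (*-identityˡ _))
  durfee (suc D) c (suc N) (s≤s D<N) = begin
    sum f (suc N)
      ≈⟨ sum-shift f N ⟩
    f 0 + sum (λ i → f (suc i)) N
      ≈⟨ +-cong refl (trans (sum-cong N f-suc) (sum-+ _ _ N)) ⟩
    h 0 + (sum (λ i → h (suc i)) N + sum x N)
      ≈⟨ +-assoc _ _ _ ⟨
    h 0 + sum (λ i → h (suc i)) N + sum x N
      ≈⟨ +-cong (sym (sum-shift h N)) (trans (sym (+-identityʳ _)) (+-congˡ (sym (*-≈0 _ (≈0-* _ (gauss-< D<N)))))) ⟩
    sum h (suc N) + sum x (suc N)
      ≈⟨ sum-+ h x (suc N) ⟨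
    sum (λ i → h i + x i) (suc N)
      ≈⟨ sum-cong (suc N) h+x ⟩
    sum (λ i → q ^ (i ℕ.* i ℕ.+ i ℕ.* suc c) * (gauss D i * u (suc c ℕ.+ i))) (suc N)
      ≈⟨ durfee D (suc c) (suc N) (ℕ.m<n⇒m<1+n D<N) ⟩
    u (suc c ℕ.+ D)
      ≡⟨ ≡.cong u (≡.sym (ℕ.+-suc c D)) ⟩
    u (c ℕ.+ suc D) ∎
    where
    f h x : ℕ → Carrier
    f i = q ^ (i ℕ.* i ℕ.+ i ℕ.* c) * (gauss (suc D) i * u (c ℕ.+ i))
    h i = q ^ (i ℕ.* i ℕ.+ i ℕ.* suc c) * (gauss D i * u (c ℕ.+ i))
    x i = q ^ (suc i ℕ.* suc i ℕ.+ suc i ℕ.* c) * (gauss D i * u (suc (c ℕ.+ i)))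
    e₁ : ∀ i c → suc i ℕ.* suc i ℕ.+ suc i ℕ.* c ℕ.+ suc i ≡ suc i ℕ.* suc i ℕ.+ suc i ℕ.* suc c
    e₁ = solve-∀
    e₂ : ∀ i c → i ℕ.* i ℕ.+ i ℕ.* suc c ℕ.+ suc (c ℕ.+ i) ≡ suc i ℕ.* suc i ℕ.+ suc i ℕ.* c
    e₂ = solve-∀
    f-suc : ∀ i → f (suc i) ≈ h (suc i) + x i
    f-suc i = begin
      X * ((gauss D i + q ^ suc i * gauss D (suc i)) * u (c ℕ.+ suc i))
        ≈⟨ solve 5 (λ X g y g′ v → X :* ((g :+ y :* g′) :* v) := X :* y :* (g′ :* v) :+ X :* (g :* v)) refl X _ _ _ _ ⟩
      X * q ^ suc i * (gauss D (suc i) * u (c ℕ.+ suc i)) + X * (gauss D i * u (c ℕ.+ suc i))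
        ≈⟨ +-cong (*-congʳ (^-+ (suc i ℕ.* suc i ℕ.+ suc i ℕ.* c) (suc i) (e₁ i c))) (*-congˡ (*-congˡ (reflexive (≡.cong u (ℕ.+-suc c i))))) ⟩
      h (suc i) + x i ∎
      where X = q ^ (suc i ℕ.* suc i ℕ.+ suc i ℕ.* c)
    h+x : ∀ i → h i + x i ≈ q ^ (i ℕ.* i ℕ.+ i ℕ.* suc c) * (gauss D i * u (suc c ℕ.+ i))
    h+x i = begin
      X * (gauss D i * u (c ℕ.+ i)) + x i
        ≈⟨ +-cong (*-congˡ (*-congˡ (u-step (c ℕ.+ i)))) (*-congʳ (sym (^-+ (i ℕ.* i ℕ.+ i ℕ.* suc c) (suc (c ℕ.+ i)) (e₂ i c)))) ⟩
      X * (gauss D i * (v * (1# - y))) + X * y * (gauss D i * v)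
        ≈⟨ solve 4 (λ X g v y → X :* (g :* (v :* (one :- y))) :+ X :* y :* (g :* v) := X :* (g :* v)) refl X _ v y ⟩
      X * (gauss D i * v) ∎
      where
      X = q ^ (i ℕ.* i ℕ.+ i ℕ.* suc c)
      y = q ^ suc (c ℕ.+ i)
      v = u (suc c ℕ.+ i)

  -- The step β ↦ β′ of the Bailey chain relative to a = q.
  bailey-step : ℕ → (ℕ → Carrier) → ℕ → Carrier
  bailey-step N w M = sum (λ k → q ^ (k ℕ.* k ℕ.+ k) * (u∸ M k * w k)) N

  -- The sequence β of the Bailey pair whose α is concentrated at r.
  unit : ℕ → ℕ → Carrier
  unit r k = u∸ k r * u (suc (k ℕ.+ r))

  bailey-step-cong : ∀ {v w : ℕ → Carrier} N M → (∀ k → k ℕ.< N → v k ≈ w k) → bailey-step N v M ≈ bailey-step N w M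
  bailey-step-cong N M v≈w = sum-cong-< N (λ k k<N → *-congˡ (*-congˡ (v≈w k k<N)))

  bailey-step-linear : ∀ (a b : ℕ → Carrier) (f g : ℕ → ℕ → Carrier) J N M →
    bailey-step N (λ k → sum (λ j → a j * f j k + b j * g j k) J) M
      ≈ sum (λ j → a j * bailey-step N (f j) M + b j * bailey-step N (g j) M) J
  bailey-step-linear a b f g J N M = begin
    sum (λ k → e k * (u∸ M k * sum (λ j → a j * f j k + b j * g j k) J)) N
      ≈⟨ sum-cong N (λ k → trans (sym (*-assoc _ _ _)) (sym (sum-*ˡ _ _ J))) ⟩
    sum (λ k → sum (λ j → e k * u∸ M k * (a j * f j k + b j * g j k)) J) N
      ≈⟨ sum-swap _ N J ⟩
    sum (λ j → sum (λ k → e k * u∸ M k * (a j * f j k + b j * g j k)) N) J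
      ≈⟨ sum-cong J (λ j → trans (sum-cong N (λ k → solve 6 (λ e v a f b g → e :* v :* (a :* f :+ b :* g) := a :* (e :* (v :* f)) :+ b :* (e :* (v :* g))) refl _ _ _ _ _ _))
           (trans (sum-+ _ _ N) (+-cong (sum-*ˡ _ _ N) (sum-*ˡ _ _ N)))) ⟩
    sum (λ j → a j * bailey-step N (f j) M + b j * bailey-step N (g j) M) J ∎
    where
    e : ℕ → Carrier
    e k = q ^ (k ℕ.* k ℕ.+ k)

  -- `unit r` is an eigenvector of the chain step, so iterating the step only multiplies powers of
  -- q. With k = r + i and M = r + D the sum becomes `durfee` at c = 2r + 1.
  bailey-lemma : ∀ r N M → M ℕ.< N → bailey-step N (unit r) M ≈ q ^ (r ℕ.* r ℕ.+ r) * unit r M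
  bailey-lemma r N M M<N with r ℕ.≤? M
  ... | no r≰M = trans (sum-≈0 N term≈0) (sym (*-≈0 _ (≈0-* _ (reflexive (u∸-< (ℕ.≰⇒> r≰M))))))
    where
    term≈0 : ∀ k → k ℕ.< N → q ^ (k ℕ.* k ℕ.+ k) * (u∸ M k * unit r k) ≈ 0#
    term≈0 k _ with k ℕ.≤? M
    ... | yes k≤M = *-≈0 _ (*-≈0 _ (≈0-* _ (reflexive (u∸-< (ℕ.≤-<-trans k≤M (ℕ.≰⇒> r≰M))))))
    ... | no  k≰M = *-≈0 _ (≈0-* _ (reflexive (u∸-< (ℕ.≰⇒> k≰M))))
  ... | yes r≤M with ℕ.m≤n⇒∃[o]m+o≡n r≤M
  ...   | D , ≡.refl = begin
    sum f N
      ≈⟨ sum-drop f (ℕ.<⇒≤ (ℕ.≤-<-trans r≤M M<N)) (λ k k<r → *-≈0 _ (*-≈0 _ (≈0-* _ (reflexive (u∸-< k<r))))) ⟩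
    sum (λ i → f (r ℕ.+ i)) (N ∸ r)
      ≈⟨ sum-cong (N ∸ r) term ⟩
    sum (λ i → q ^ (r ℕ.* r ℕ.+ r) * u D * (q ^ (i ℕ.* i ℕ.+ i ℕ.* c) * (gauss D i * u (c ℕ.+ i)))) (N ∸ r)
      ≈⟨ trans (sum-*ˡ _ _ (N ∸ r)) (*-congˡ (durfee D c (N ∸ r) D<N∸r)) ⟩
    q ^ (r ℕ.* r ℕ.+ r) * u D * u (c ℕ.+ D)
      ≈⟨ *-assoc _ _ _ ⟩
    q ^ (r ℕ.* r ℕ.+ r) * (u D * u (c ℕ.+ D))
      ≈⟨ *-congˡ (*-cong (reflexive (≡.sym (u∸-+ r D))) (reflexive (≡.cong u (index r D)))) ⟩
    q ^ (r ℕ.* r ℕ.+ r) * unit r (r ℕ.+ D) ∎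
    where
    c = suc (r ℕ.+ r)
    f : ℕ → Carrier
    f k = q ^ (k ℕ.* k ℕ.+ k) * (u∸ (r ℕ.+ D) k * unit r k)
    D<N∸r : D ℕ.< N ∸ r
    D<N∸r = ≡.subst (ℕ._< N ∸ r) (ℕ.m+n∸m≡n r D) (ℕ.∸-monoˡ-< M<N (ℕ.m≤m+n r D))
    index : ∀ r i → suc (r ℕ.+ r) ℕ.+ i ≡ suc (r ℕ.+ i ℕ.+ r)
    index = solve-∀
    e : ∀ r i → r ℕ.* r ℕ.+ r ℕ.+ (i ℕ.* i ℕ.+ i ℕ.* suc (r ℕ.+ r)) ≡ (r ℕ.+ i) ℕ.* (r ℕ.+ i) ℕ.+ (r ℕ.+ i)
    e = solve-∀
    term : ∀ i → f (r ℕ.+ i) ≈ q ^ (r ℕ.* r ℕ.+ r) * u D * (q ^ (i ℕ.* i ℕ.+ i ℕ.* c) * (gauss D i * u (c ℕ.+ i)))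
    term i = begin
      q ^ ((r ℕ.+ i) ℕ.* (r ℕ.+ i) ℕ.+ (r ℕ.+ i)) * (u∸ (r ℕ.+ D) (r ℕ.+ i) * (u∸ (r ℕ.+ i) r * u (suc (r ℕ.+ i ℕ.+ r))))
        ≈⟨ *-cong (sym (^-+ (r ℕ.* r ℕ.+ r) (i ℕ.* i ℕ.+ i ℕ.* c) (e r i)))
             (*-cong (reflexive (u∸-cancel r D i)) (*-cong (reflexive (u∸-+ r i)) (reflexive (≡.cong u (≡.sym (index r i)))))) ⟩
      X * Y * (u∸ D i * (u i * V))
        -- The inserted 1 becomes (q)_D times its inverse, which supplies the numerator of [D, i].
        ≈⟨ *-congˡ (*-identityˡ _) ⟨
      X * Y * (1# * (u∸ D i * (u i * V)))
        ≈⟨ *-congˡ (*-congʳ (p*u D)) ⟨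
      X * Y * (p D * u D * (u∸ D i * (u i * V)))
        ≈⟨ solve 7 (λ X Y p v a b V → X :* Y :* (p :* v :* (a :* (b :* V))) := X :* v :* (Y :* (p :* (b :* a) :* V))) refl _ _ _ _ _ _ _ ⟩
      X * u D * (Y * (p D * (u i * u∸ D i) * V))
        ≈⟨ *-congˡ (*-congˡ (*-congʳ (gauss≈ D i))) ⟨
      X * u D * (Y * (gauss D i * V)) ∎
      where
      X = q ^ (r ℕ.* r ℕ.+ r)
      Y = q ^ (i ℕ.* i ℕ.+ i ℕ.* c)
      V = u (c ℕ.+ i)

  private
    B≈ : ∀ k r → Br.B k r ≈ p (suc (double k)) * unit r k
    B≈ k r = trans (gauss≈ (suc (double k)) (suc (k ℕ.+ r)))
      (*-congˡ (trans (*-comm _ _) (*-congʳ (reflexive (≡.trans (≡.cong (λ n → u∸ n (k ℕ.+ r)) (double≡+ k)) (u∸-cancel k k r))))))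

    -- The Bailey pair behind Bressoud's identity: α is a at 2j and b at 2j + 1.
    a b : ℕ → Carrier
    a j = sgn j * q ^ (5 ℕ.* t j ℕ.+ 4 ℕ.* j)
    b j = - sgn j * q ^ (5 ℕ.* t j ℕ.+ 6 ℕ.* j ℕ.+ 1)

  -- Dividing by (q)₂ₖ₊₁ turns [2k + 1, k + 1 + r] into `unit r k`, so Bressoud's identity exhibits
  -- its left side as a combination of eigenvectors.
  bressoud-pair : ∀ k N → k ℕ.< N → u (suc (double k)) * sum (λ n → q ^ (n ℕ.* n ℕ.+ n) * gauss k n) N
    ≈ sum (λ j → a j * unit (double j) k + b j * unit (suc (double j)) k) N
  bressoud-pair k N k<N = begin
    v * sum (λ n → q ^ (n ℕ.* n ℕ.+ n) * gauss k n) N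
      ≈⟨ *-congˡ (proj₂ (Br.bressoud k N k<N)) ⟩
    v * Br.rhs₁ k N
      ≈⟨ sum-*ˡ v _ N ⟨
    sum (λ j → v * (sgn j * (q ^ (5 ℕ.* t j ℕ.+ 4 ℕ.* j) * Br.B k (double j) - q ^ (5 ℕ.* t j ℕ.+ 6 ℕ.* j ℕ.+ 1) * Br.B k (suc (double j))))) N
      ≈⟨ sum-cong N (λ j → trans (*-congˡ (*-congˡ (+-cong (*-congˡ (B≈ k (double j))) (-‿cong (*-congˡ (B≈ k (suc (double j))))))))
           (trans (solve 7 (λ v s x p y z w → v :* (s :* (x :* (p :* y) :- z :* (p :* w))) := (p :* v) :* (s :* x :* y :+ :- s :* z :* w)) refl _ _ _ (p (suc (double k))) _ _ _)
             (trans (*-congʳ (p*u (suc (double k)))) (*-identityˡ _)))) ⟩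
    sum (λ j → a j * unit (double j) k + b j * unit (suc (double j)) k) N ∎
    where v = u (suc (double k))

  private
    sq+ : ℕ → ℕ
    sq+ n = n ℕ.* n ℕ.+ n

  summand : ℕ → ℕ → ℕ → Carrier
  summand m k n = q ^ (sq+ k ℕ.+ sq+ (m ℕ.+ k) ℕ.+ sq+ n) * (u m * u (suc (double k))) * gauss k n

  -- The terms of Σⱼ (−1)ʲ q^(j(21j+11)/2) at j and at −1 − j.
  Y X : ℕ → Carrier
  Y j = sgn j * q ^ (21 ℕ.* t j ℕ.+ 16 ℕ.* j)
  X j = - sgn j * q ^ (21 ℕ.* t j ℕ.+ 26 ℕ.* j ℕ.+ 5)

  private
    t-double : ∀ j → t j ℕ.+ t j ℕ.+ j ≡ j ℕ.* j
    t-double zero    = ≡.refl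
    t-double (suc j) = ≡.trans (reorder (t j) j) (≡.trans (≡.cong (λ z → z ℕ.+ j ℕ.+ j ℕ.+ 1) (t-double j)) (square j))
      where
      reorder : ∀ T j → (T ℕ.+ j) ℕ.+ (T ℕ.+ j) ℕ.+ suc j ≡ (T ℕ.+ T ℕ.+ j) ℕ.+ j ℕ.+ j ℕ.+ 1
      reorder = solve-∀
      square : ∀ j → j ℕ.* j ℕ.+ j ℕ.+ j ℕ.+ 1 ≡ suc j ℕ.* suc j
      square = solve-∀

    -- Two chain steps add 2(r² + r) at r = 2j. Its quadratic part 8j² equals 16 t(j) + 8j, and 5 +
    -- 16 is the origin of the modulus 21.
    exponent-even : ∀ j → 5 ℕ.* t j ℕ.+ 4 ℕ.* j ℕ.+ (sq+ (double j) ℕ.+ sq+ (double j)) ≡ 21 ℕ.* t j ℕ.+ 16 ℕ.* j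
    exponent-even j rewrite double≡+ j = ≡.trans (expand (t j) j) (≡.trans (≡.cong (λ z → 5 ℕ.* t j ℕ.+ 8 ℕ.* z ℕ.+ 8 ℕ.* j) (≡.sym (t-double j))) (collect (t j) j))
      where
      expand : ∀ T j → 5 ℕ.* T ℕ.+ 4 ℕ.* j ℕ.+ (((j ℕ.+ j) ℕ.* (j ℕ.+ j) ℕ.+ (j ℕ.+ j)) ℕ.+ ((j ℕ.+ j) ℕ.* (j ℕ.+ j) ℕ.+ (j ℕ.+ j)))
        ≡ 5 ℕ.* T ℕ.+ 8 ℕ.* (j ℕ.* j) ℕ.+ 8 ℕ.* j
      expand = solve-∀
      collect : ∀ T j → 5 ℕ.* T ℕ.+ 8 ℕ.* (T ℕ.+ T ℕ.+ j) ℕ.+ 8 ℕ.* j ≡ 21 ℕ.* T ℕ.+ 16 ℕ.* j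
      collect = solve-∀

    exponent-odd : ∀ j → 5 ℕ.* t j ℕ.+ 6 ℕ.* j ℕ.+ 1 ℕ.+ (sq+ (suc (double j)) ℕ.+ sq+ (suc (double j))) ≡ 21 ℕ.* t j ℕ.+ 26 ℕ.* j ℕ.+ 5
    exponent-odd j rewrite double≡+ j = ≡.trans (expand (t j) j) (≡.trans (≡.cong (λ z → 5 ℕ.* t j ℕ.+ 8 ℕ.* z ℕ.+ 18 ℕ.* j ℕ.+ 5) (≡.sym (t-double j))) (collect (t j) j))
      where
      expand : ∀ T j → 5 ℕ.* T ℕ.+ 6 ℕ.* j ℕ.+ 1 ℕ.+ ((suc (j ℕ.+ j) ℕ.* suc (j ℕ.+ j) ℕ.+ suc (j ℕ.+ j)) ℕ.+ (suc (j ℕ.+ j) ℕ.* suc (j ℕ.+ j) ℕ.+ suc (j ℕ.+ j)))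
        ≡ 5 ℕ.* T ℕ.+ 8 ℕ.* (j ℕ.* j) ℕ.+ 18 ℕ.* j ℕ.+ 5
      expand = solve-∀
      collect : ∀ T j → 5 ℕ.* T ℕ.+ 8 ℕ.* (T ℕ.+ T ℕ.+ j) ℕ.+ 18 ℕ.* j ℕ.+ 5 ≡ 21 ℕ.* T ℕ.+ 26 ℕ.* j ℕ.+ 5
      collect = solve-∀

  -- Substitution M = m + k. The left sum runs past M = N when k > 0, so `g` has to vanish from N
  -- on.
  reindex : ∀ (g : ℕ → Carrier) k N → k ℕ.≤ N → (∀ M → N ℕ.≤ M → g M ≈ 0#) →
    sum (λ m → u m * g (m ℕ.+ k)) N ≈ sum (λ M → u∸ M k * g M) N
  reindex g k N k≤N g≈0 = sym (begin
    sum (λ M → u∸ M k * g M) N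
      ≈⟨ sum-drop _ k≤N (λ M M<k → ≈0-* _ (reflexive (u∸-< M<k))) ⟩
    sum (λ m → u∸ (k ℕ.+ m) k * g (k ℕ.+ m)) (N ∸ k)
      ≈⟨ sum-cong (N ∸ k) (λ m → *-cong (reflexive (u∸-+ k m)) (reflexive (≡.cong g (ℕ.+-comm k m)))) ⟩
    sum (λ m → u m * g (m ℕ.+ k)) (N ∸ k)
      ≈⟨ sum-extend _ (ℕ.m∸n≤m N k) (λ m N∸k≤m → *-≈0 _ (g≈0 _ (≡.subst (ℕ._≤ m ℕ.+ k) (ℕ.m∸n+n≡m k≤N) (ℕ.+-monoˡ-≤ k N∸k≤m)))) ⟨
    sum (λ m → u m * g (m ℕ.+ k)) N ∎)

  -- The inner chain step produces the sum over k, the outer one, evaluated at L, the sum over M = m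
  -- + k with kernel 1/(q)_(L-M). The factor (q)_L normalises this kernel so that it tends to 1 as L
  -- grows.
  finite-identity : ∀ L →
    sum (λ m → sum (λ k → sum (λ n → summand m k n * (p L * u∸ L (m ℕ.+ k))) (suc L)) (suc L)) (suc L)
      ≈ sum (λ j → Y j * (p L * unit (double j) L) + X j * (p L * unit (suc (double j)) L)) (suc L)
  finite-identity L = begin
    sum (λ m → sum (λ k → sum (λ n → summand m k n * (p L * u∸ L (m ℕ.+ k))) N) N) N
      ≈⟨ sum-cong N (λ m → sum-cong N (λ k → inner m k)) ⟩
    sum (λ m → sum (λ k → p L * (e k * w k * (u m * g (m ℕ.+ k)))) N) N
      ≈⟨ sum-swap _ N N ⟩
    sum (λ k → sum (λ m → p L * (e k * w k * (u m * g (m ℕ.+ k)))) N) N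
      ≈⟨ sum-cong N (λ k → trans (sum-*ˡ _ _ N) (*-congˡ (sum-*ˡ _ _ N))) ⟩
    sum (λ k → p L * (e k * w k * sum (λ m → u m * g (m ℕ.+ k)) N)) N
      ≈⟨ trans (sum-*ˡ _ _ N) (*-congˡ (sum-cong-< N (λ k k<N → *-congˡ (reindex g k N (ℕ.<⇒≤ k<N) (λ M N≤M → *-≈0 _ (reflexive (u∸-< N≤M))))))) ⟩
    p L * sum (λ k → e k * w k * sum (λ M → u∸ M k * g M) N) N
      ≈⟨ *-congˡ (sum-cong N (λ k → sym (sum-*ˡ _ _ N))) ⟩
    p L * sum (λ k → sum (λ M → e k * w k * (u∸ M k * g M)) N) N
      ≈⟨ *-congˡ (sum-swap _ N N) ⟩
    p L * sum (λ M → sum (λ k → e k * w k * (u∸ M k * g M)) N) N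
      ≈⟨ *-congˡ (sum-cong N (λ M → trans (sum-cong N (λ k → solve 5 (λ e w v f z → e :* w :* (v :* (f :* z)) := f :* z :* (e :* (v :* w))) refl _ _ _ _ _))
           (trans (sum-*ˡ _ _ N) (*-assoc _ _ _)))) ⟩
    p L * bailey-step N (bailey-step N w) L
      ≈⟨ *-congˡ (trans (bailey-step-cong N L once) twice) ⟩
    p L * sum (λ j → a j * (e (double j) * (e (double j) * unit (double j) L)) + b j * (e (suc (double j)) * (e (suc (double j)) * unit (suc (double j)) L))) N
      ≈⟨ trans (sym (sum-*ˡ _ _ N)) (sum-cong N final) ⟩
    sum (λ j → Y j * (p L * unit (double j) L) + X j * (p L * unit (suc (double j)) L)) N ∎
    where
    N = suc L
    e w g : ℕ → Carrier
    e k = q ^ sq+ k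
    w k = u (suc (double k)) * sum (λ n → e n * gauss k n) N
    g M = e M * u∸ L M
    inner : ∀ m k → sum (λ n → summand m k n * (p L * u∸ L (m ℕ.+ k))) N ≈ p L * (e k * w k * (u m * g (m ℕ.+ k)))
    inner m k = begin
      sum (λ n → summand m k n * (p L * z)) N
        ≈⟨ sum-cong N (λ n → trans (*-congʳ (*-congʳ (*-congʳ (sym (trans (*-congʳ (^-+ (sq+ k) (sq+ (m ℕ.+ k)) ≡.refl)) (^-+ (sq+ k ℕ.+ sq+ (m ℕ.+ k)) (sq+ n) ≡.refl))))))
             (solve 8 (λ x y v a b g P z → x :* y :* v :* (a :* b) :* g :* (P :* z) := P :* z :* x :* y :* a :* b :* (v :* g)) refl (e k) (e (m ℕ.+ k)) (e n) _ _ _ (p L) z)) ⟩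
      sum (λ n → p L * z * e k * e (m ℕ.+ k) * u m * u (suc (double k)) * (e n * gauss k n)) N
        ≈⟨ sum-*ˡ _ _ N ⟩
      p L * z * e k * e (m ℕ.+ k) * u m * u (suc (double k)) * sum (λ n → e n * gauss k n) N
        ≈⟨ solve 7 (λ P z x y a b s → P :* z :* x :* y :* a :* b :* s := P :* (x :* (b :* s) :* (a :* (y :* z)))) refl _ _ _ _ _ _ _ ⟩
      p L * (e k * w k * (u m * g (m ℕ.+ k))) ∎
      where z = u∸ L (m ℕ.+ k)
    once : ∀ M → M ℕ.< N → bailey-step N w M ≈ sum (λ j → a j * (e (double j) * unit (double j) M) + b j * (e (suc (double j)) * unit (suc (double j)) M)) N
    once M M<N = begin
      bailey-step N w M
        ≈⟨ bailey-step-cong N M (λ k k<N → bressoud-pair k N k<N) ⟩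
      bailey-step N (λ k → sum (λ j → a j * unit (double j) k + b j * unit (suc (double j)) k) N) M
        ≈⟨ bailey-step-linear a b (λ j → unit (double j)) (λ j → unit (suc (double j))) N N M ⟩
      sum (λ j → a j * bailey-step N (unit (double j)) M + b j * bailey-step N (unit (suc (double j))) M) N
        ≈⟨ sum-cong N (λ j → +-cong (*-congˡ (bailey-lemma (double j) N M M<N)) (*-congˡ (bailey-lemma (suc (double j)) N M M<N))) ⟩
      sum (λ j → a j * (e (double j) * unit (double j) M) + b j * (e (suc (double j)) * unit (suc (double j)) M)) N ∎
    bailey-step-* : ∀ x r → bailey-step N (λ M → x * unit r M) L ≈ x * (e r * unit r L)
    bailey-step-* x r = trans (sum-cong N (λ M → solve 4 (λ e v x w → e :* (v :* (x :* w)) := x :* (e :* (v :* w))) refl _ _ _ _))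
      (trans (sum-*ˡ _ _ N) (*-congˡ (bailey-lemma r N L ℕ.≤-refl)))
    twice : bailey-step N (λ M → sum (λ j → a j * (e (double j) * unit (double j) M) + b j * (e (suc (double j)) * unit (suc (double j)) M)) N) L
      ≈ sum (λ j → a j * (e (double j) * (e (double j) * unit (double j) L)) + b j * (e (suc (double j)) * (e (suc (double j)) * unit (suc (double j)) L))) N
    twice = trans (bailey-step-linear a b (λ j M → e (double j) * unit (double j) M) (λ j M → e (suc (double j)) * unit (suc (double j)) M) N N L)
      (sum-cong N (λ j → +-cong (*-congˡ (bailey-step-* _ _)) (*-congˡ (bailey-step-* _ _))))
    final : ∀ j → p L * (a j * (e (double j) * (e (double j) * unit (double j) L)) + b j * (e (suc (double j)) * (e (suc (double j)) * unit (suc (double j)) L)))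
      ≈ Y j * (p L * unit (double j) L) + X j * (p L * unit (suc (double j)) L)
    final j = begin
      p L * (s * x * (v * (v * A)) + - s * y * (z * (z * B)))
        ≈⟨ solve 8 (λ P s x v A y z B → P :* (s :* x :* (v :* (v :* A)) :+ :- s :* y :* (z :* (z :* B)))
             := s :* (x :* (v :* v)) :* (P :* A) :+ :- s :* (y :* (z :* z)) :* (P :* B)) refl _ _ _ _ _ _ _ _ ⟩
      s * (x * (v * v)) * (p L * A) + - s * (y * (z * z)) * (p L * B)
        ≈⟨ +-cong (*-congʳ (*-congˡ (trans (*-congˡ (^-+ (sq+ (double j)) (sq+ (double j)) ≡.refl)) (^-+ (5 ℕ.* t j ℕ.+ 4 ℕ.* j) _ (exponent-even j)))))
                  (*-congʳ (*-congˡ (trans (*-congˡ (^-+ (sq+ (suc (double j))) (sq+ (suc (double j))) ≡.refl)) (^-+ (5 ℕ.* t j ℕ.+ 6 ℕ.* j ℕ.+ 1) _ (exponent-odd j))))) ⟩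
      Y j * (p L * A) + X j * (p L * B) ∎
      where
      s = sgn j
      x = q ^ (5 ℕ.* t j ℕ.+ 4 ℕ.* j)
      y = q ^ (5 ℕ.* t j ℕ.+ 6 ℕ.* j ℕ.+ 1)
      v = e (double j)
      z = e (suc (double j))
      A = unit (double j) L
      B = unit (suc (double j)) L

-- The Jacobi triple product in finite form.

module JacobiTriple {r₁ r₂} (R : CommutativeRing r₁ r₂) (q : CommutativeRing.Carrier R)
  (u : ℕ → CommutativeRing.Carrier R)
  (p*u : ∀ n → CommutativeRing._≈_ R (CommutativeRing._*_ R (QSeries.p R q n) (u n)) (CommutativeRing.1# R)) where
  open CommutativeRing R hiding (zero)
  open IntegerCoefficients R
  open Sums R
  open QSeries R q
  open Reciprocal u p*u
  open SetoidReasoning setoid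

  -- The two parameters stand for y and q/y: negative powers of y are written as powers of x, and
  -- neither has to be invertible.
  module _ (x y : Carrier) (x*y≈q : x * y ≈ q) where

    -- The terms of Σⱼ (-1)ʲ q^(j(j-1)/2) yʲ at j and at -1 - j, the latter rewritten through y⁻¹ =
    -- x/q.
    Y X : ℕ → Carrier
    Y j = sgn j * (q ^ t j * y ^ j)
    X j = - sgn j * (q ^ t (suc j) * x ^ suc j)

    product : ℕ → Carrier
    product zero    = 1#
    product (suc n) = product n * (1# - y * q ^ n) * (1# - x * q ^ n)

    private
      G H : ℕ → ℕ → Carrier
      G n j = gauss (double n) (n ℕ.+ j)
      H n j = gauss (suc (double n)) (n ℕ.+ j)

      G-< : ∀ {n j} → n ℕ.< j → G n j ≈ 0#
      G-< {n} {j} n<j = gauss-< (≡.subst (ℕ._< n ℕ.+ j) (≡.sym (double≡+ n)) (ℕ.+-monoʳ-< n n<j))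

      H-< : ∀ {n j} → suc n ℕ.< j → H n j ≈ 0#
      H-< {n} {j} n<j = gauss-< (≡.subst (ℕ._< n ℕ.+ j) (≡.trans (ℕ.+-suc n n) (≡.cong suc (≡.sym (double≡+ n)))) (ℕ.+-monoʳ-< n n<j))

      double-e : ∀ a n j → a ℕ.+ j ℕ.+ double n ≡ a ℕ.+ n ℕ.+ (n ℕ.+ j)
      double-e a n j rewrite double≡+ n = go a n j
        where
        go : ∀ a n j → a ℕ.+ j ℕ.+ (n ℕ.+ n) ≡ a ℕ.+ n ℕ.+ (n ℕ.+ j)
        go = solve-∀

      H-suc : ∀ n j → H n (suc j) ≈ G n j + q ^ suc (n ℕ.+ j) * G n (suc j)
      H-suc n j = trans (reflexive (≡.cong (gauss (suc (double n))) (ℕ.+-suc n j)))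
        (+-congˡ (*-congˡ (reflexive (≡.cong (gauss (double n)) (≡.sym (ℕ.+-suc n j))))))

      H-suc₂ : ∀ a n j → q ^ (a ℕ.+ j) * H n (suc j) ≈ q ^ (a ℕ.+ n) * G n j + q ^ (a ℕ.+ j) * G n (suc j)
      H-suc₂ a n j = trans (*-congˡ (reflexive (≡.cong (gauss (suc (double n))) (ℕ.+-suc n j))))
        (trans (pascal₂ (a ℕ.+ j) (a ℕ.+ n) (double n) (n ℕ.+ j) (double-e a n j))
          (+-congˡ (*-congˡ (reflexive (≡.cong (gauss (double n)) (≡.sym (ℕ.+-suc n j)))))))

      G-suc : ∀ n j → G (suc n) j ≈ H n j + q ^ suc (n ℕ.+ j) * H n (suc j)
      G-suc n j = +-congˡ (*-congˡ (reflexive (≡.cong (gauss (suc (double n))) (≡.sym (ℕ.+-suc n j)))))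

      G-suc₂ : ∀ a n j → q ^ (a ℕ.+ j) * G (suc n) (suc j) ≈ q ^ (a ℕ.+ n) * H n (suc j) + q ^ (a ℕ.+ j) * H n (suc (suc j))
      G-suc₂ a n j = trans (pascal₂ (a ℕ.+ j) (a ℕ.+ n) (suc (double n)) (n ℕ.+ suc j) e)
          (+-congˡ (*-congˡ (reflexive (≡.cong (gauss (suc (double n))) (≡.sym (ℕ.+-suc n (suc j)))))))
        where
        e : a ℕ.+ j ℕ.+ suc (double n) ≡ a ℕ.+ n ℕ.+ (n ℕ.+ suc j)
        e = ≡.trans (ℕ.+-suc (a ℕ.+ j) (double n)) (≡.trans (≡.cong suc (double-e a n j))
          (≡.trans (≡.sym (ℕ.+-suc (a ℕ.+ n) (n ℕ.+ j))) (≡.cong (a ℕ.+ n ℕ.+_) (≡.sym (ℕ.+-suc n j)))))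

      H-zero : ∀ n → H n 0 ≈ H n 1
      H-zero n = trans (reflexive (≡.cong₂ gauss 1+2n (ℕ.+-identityʳ n)))
        (trans (gauss-sym n (suc n)) (reflexive (≡.cong₂ gauss (≡.sym 1+2n) (≡.sym (ℕ.+-comm n 1)))))
        where
        1+2n : suc (double n) ≡ n ℕ.+ suc n
        1+2n = ≡.trans (≡.cong suc (double≡+ n)) (≡.sym (ℕ.+-suc n n))

      -- The ratio of neighbouring terms: a factor x lowers the index on the y side. In the same way
      -- `y*X` lowers it on the x side.
      x*Y : ∀ j → x * Y (suc j) ≈ - (q ^ suc j * Y j)
      x*Y j = begin
        x * (- sgn j * (q ^ (t j ℕ.+ j) * (y * y ^ j)))
          ≈⟨ *-congˡ (*-congˡ (*-congʳ (sym (^-+ (t j) j ≡.refl)))) ⟩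
        x * (- sgn j * (q ^ t j * q ^ j * (y * y ^ j)))
          ≈⟨ solve 6 (λ x s T J y z → x :* (:- s :* (T :* J :* (y :* z))) := :- ((x :* y) :* J :* (s :* (T :* z)))) refl _ _ _ _ _ _ ⟩
        - (x * y * q ^ j * Y j)
          ≈⟨ -‿cong (*-congʳ (*-congʳ x*y≈q)) ⟩
        - (q ^ suc j * Y j) ∎

      y*X : ∀ j → y * X (suc j) ≈ - (q ^ suc (suc j) * X j)
      y*X j = begin
        y * (- - sgn j * (q ^ (t (suc j) ℕ.+ suc j) * (x * x ^ suc j)))
          ≈⟨ *-congˡ (*-congˡ (*-congʳ (sym (^-+ (t (suc j)) (suc j) ≡.refl)))) ⟩
        y * (- - sgn j * (q ^ t (suc j) * q ^ suc j * (x * x ^ suc j)))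
          ≈⟨ solve 6 (λ y s T J x z → y :* (:- :- s :* (T :* J :* (x :* z))) := :- ((x :* y) :* J :* (:- s :* (T :* z)))) refl _ _ _ _ _ _ ⟩
        - (x * y * q ^ suc j * X j)
          ≈⟨ -‿cong (*-congʳ (*-congʳ x*y≈q)) ⟩
        - (q ^ suc (suc j) * X j) ∎

      ΣG ΣH : ℕ → ℕ → Carrier
      ΣG n N = sum (λ j → Y j * G n j + X j * G n (suc j)) N
      ΣH n N = sum (λ j → Y j * H n j + X j * H n (suc (suc j))) N

      shift₀ : ∀ f N → f N ≈ 0# → sum f N ≈ f 0 + sum (λ j → f (suc j)) N
      shift₀ f N fN≈0 = trans (sym (+-identityʳ _)) (trans (+-congˡ (sym fN≈0)) (sum-shift f N))

      -- A linear factor shifts the index up on one half of ℤ and down on the other. This lemma and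
      -- `sum-step′` treat the two halves and isolate the boundary terms at j = 0, where the halves
      -- meet.
      sum-step : ∀ {f g h : ℕ → Carrier} z N → f N ≈ 0# → g N ≈ 0# → (∀ j → f (suc j) ≈ g (suc j) - z * h j) →
        sum f N ≈ (f 0 - g 0) + (sum g N - z * sum h N)
      sum-step {f} {g} {h} z N fN≈0 gN≈0 f≈ = begin
        sum f N
          ≈⟨ shift₀ f N fN≈0 ⟩
        f 0 + sum (λ j → f (suc j)) N
          ≈⟨ +-congˡ (trans (sum-cong N f≈) (trans (sum-- _ _ N) (+-congˡ (-‿cong (sum-*ˡ z h N))))) ⟩
        f 0 + (sum (λ j → g (suc j)) N - z * sum h N)
          ≈⟨ solve 4 (λ a b d e → a :+ (b :- d) := (a :- e) :+ ((e :+ b) :- d)) refl _ _ _ (g 0) ⟩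
        (f 0 - g 0) + ((g 0 + sum (λ j → g (suc j)) N) - z * sum h N)
          ≈⟨ +-congˡ (+-congʳ (sym (shift₀ g N gN≈0))) ⟩
        (f 0 - g 0) + (sum g N - z * sum h N) ∎

      sum-step′ : ∀ {f g h : ℕ → Carrier} z N → h N ≈ 0# → (∀ j → f j ≈ g j - z * h (suc j)) →
        sum f N ≈ z * h 0 + (sum g N - z * sum h N)
      sum-step′ {f} {g} {h} z N hN≈0 f≈ = begin
        sum f N
          ≈⟨ trans (sum-cong N f≈) (trans (sum-- _ _ N) (+-congˡ (-‿cong (sum-*ˡ z _ N)))) ⟩
        sum g N - z * sum (λ j → h (suc j)) N
          ≈⟨ solve 4 (λ a z b e → a :- z :* b := z :* e :+ (a :- z :* (e :+ b))) refl _ _ _ (h 0) ⟩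
        z * h 0 + (sum g N - z * (h 0 + sum (λ j → h (suc j)) N))
          ≈⟨ +-congˡ (+-congˡ (-‿cong (*-congˡ (sym (shift₀ h N hN≈0))))) ⟩
        z * h 0 + (sum g N - z * sum h N) ∎

      -- One linear factor leads from the even row 2n to the odd row 2n + 1, and `factor-x` leads on
      -- to row 2n + 2. Each uses one Pascal rule on the y side and the other on the x side.
      factor-y : ∀ n N → suc n ℕ.< N → ΣH n N ≈ ΣG n N * (1# - y * q ^ n)
      factor-y n N n<N = begin
        ΣH n N
          ≈⟨ sum-+ _ _ N ⟩
        sum (λ j → Y j * H n j) N + sum (λ j → X j * H n (suc (suc j))) N
          ≈⟨ +-cong (sum-step z N (*-≈0 _ (H-< n<N)) (*-≈0 _ (G-< n<N′)) Y-term)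
                    (sum-step′ z N (*-≈0 _ (G-< (ℕ.m<n⇒m<1+n n<N′))) X-term) ⟩
        ((Y 0 * H n 0 - Y 0 * G n 0) + (a - z * a)) + (z * (X 0 * G n 1) + (b - z * b))
          ≈⟨ solve 4 (λ e f z a → (e :+ (a :- z :* a)) :+ f := (e :+ f) :+ (a :- z :* a)) refl _ _ z a ⟩
        ((Y 0 * H n 0 - Y 0 * G n 0) + (z * (X 0 * G n 1) + (b - z * b))) + (a - z * a)
          ≈⟨ +-congʳ (trans (sym (+-assoc _ _ _)) (trans (+-congʳ ends) (+-identityˡ _))) ⟩
        (b - z * b) + (a - z * a)
          ≈⟨ solve 3 (λ a b z → (b :- z :* b) :+ (a :- z :* a) := (a :+ b) :* (one :- z)) refl a b z ⟩
        (a + b) * (1# - z)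
          ≈⟨ *-congʳ (sym (sum-+ _ _ N)) ⟩
        ΣG n N * (1# - z) ∎
        where
        n<N′ = ℕ.<-trans (ℕ.n<1+n n) n<N
        z = y * q ^ n
        a = sum (λ j → Y j * G n j) N
        b = sum (λ j → X j * G n (suc j)) N
        Y-term : ∀ j → Y (suc j) * H n (suc j) ≈ Y (suc j) * G n (suc j) - z * (Y j * G n j)
        Y-term j = begin
          - sgn j * (q ^ (t j ℕ.+ j) * (y * y ^ j)) * H n (suc j)
            ≈⟨ solve 5 (λ s T y w h → :- s :* (T :* (y :* w)) :* h := :- s :* (y :* w) :* (T :* h)) refl _ _ _ _ _ ⟩
          - sgn j * (y * y ^ j) * (q ^ (t j ℕ.+ j) * H n (suc j))
            ≈⟨ *-congˡ (trans (H-suc₂ (t j) n j) (+-congʳ (*-congʳ (sym (^-+ (t j) n ≡.refl))))) ⟩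
          - sgn j * (y * y ^ j) * (q ^ t j * q ^ n * G n j + q ^ (t j ℕ.+ j) * G n (suc j))
            ≈⟨ solve 8 (λ s y w T Q g U g′ → :- s :* (y :* w) :* (T :* Q :* g :+ U :* g′)
                 := :- s :* (U :* (y :* w)) :* g′ :- y :* Q :* (s :* (T :* w) :* g)) refl _ _ _ _ _ _ _ _ ⟩
          Y (suc j) * G n (suc j) - z * (Y j * G n j) ∎
        X-term : ∀ j → X j * H n (suc (suc j)) ≈ X j * G n (suc j) - z * (X (suc j) * G n (suc (suc j)))
        X-term j = begin
          X j * H n (suc (suc j))
            ≈⟨ *-congˡ (trans (H-suc n (suc j)) (+-congˡ (*-congʳ (sym (^-+ (suc (suc j)) n (e j n)))))) ⟩
          X j * (g₁ + q ^ suc (suc j) * q ^ n * g₂)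
            ≈⟨ solve 5 (λ X g J Q h → X :* (g :+ J :* Q :* h) := X :* g :- (:- (J :* X)) :* Q :* h) refl _ _ _ _ _ ⟩
          X j * g₁ - (- (q ^ suc (suc j) * X j)) * q ^ n * g₂
            ≈⟨ +-congˡ (-‿cong (*-congʳ (*-congʳ (sym (y*X j))))) ⟩
          X j * g₁ - y * X (suc j) * q ^ n * g₂
            ≈⟨ +-congˡ (-‿cong (solve 4 (λ y X Q g → y :* X :* Q :* g := y :* Q :* (X :* g)) refl _ _ _ _)) ⟩
          X j * g₁ - z * (X (suc j) * g₂) ∎
          where
          g₁ = G n (suc j)
          g₂ = G n (suc (suc j))
          e : ∀ j n → suc (suc j) ℕ.+ n ≡ suc (n ℕ.+ suc j)
          e = solve-∀
        -- The two halves fit together at 0 because [2n + 1, n] = [2n + 1, n + 1] and xy = q.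
        ends : (Y 0 * H n 0 - Y 0 * G n 0) + z * (X 0 * G n 1) ≈ 0#
        ends = begin
          (Y 0 * H n 0 - Y 0 * G n 0) + z * (X 0 * G n 1)
            ≈⟨ +-congʳ (+-congʳ (*-congˡ (trans (H-zero n) (trans (H-suc n 0) (+-congˡ (*-congʳ (^-≡ (≡.cong suc (ℕ.+-identityʳ n))))))))) ⟩
          (Y 0 * (G n 0 + q * q ^ n * G n 1) - Y 0 * G n 0) + z * (X 0 * G n 1)
            ≈⟨ +-congʳ (+-congʳ (*-congˡ (+-congˡ (*-congʳ (*-congʳ (sym x*y≈q)))))) ⟩
          (Y 0 * (G n 0 + x * y * q ^ n * G n 1) - Y 0 * G n 0) + z * (X 0 * G n 1)
            ≈⟨ solve 5 (λ x y Q g h → (one :* (one :* one) :* (g :+ x :* y :* Q :* h) :- one :* (one :* one) :* g) :+ y :* Q :* (:- one :* (one :* (x :* one)) :* h) := nil) refl x y _ _ _ ⟩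
          0# ∎

      factor-x : ∀ n N → suc n ℕ.< N → ΣG (suc n) N ≈ ΣH n N * (1# - x * q ^ n)
      factor-x n N n<N = begin
        ΣG (suc n) N
          ≈⟨ sum-+ _ _ N ⟩
        sum (λ j → Y j * G (suc n) j) N + sum (λ j → X j * G (suc n) (suc j)) N
          ≈⟨ +-cong (sum-step′ z N (*-≈0 _ (H-< n<N)) Y-term)
                    (sum-step z N (*-≈0 _ (G-< (ℕ.m<n⇒m<1+n n<N))) (*-≈0 _ (H-< (ℕ.m<n⇒m<1+n (ℕ.m<n⇒m<1+n n<N)))) X-term) ⟩
        (z * (Y 0 * H n 0) + (a - z * a)) + ((X 0 * G (suc n) 1 - X 0 * H n 2) + (b - z * b))
          ≈⟨ solve 5 (λ e f z a b → (e :+ (a :- z :* a)) :+ (f :+ (b :- z :* b)) := (e :+ f) :+ (a :+ b) :* (one :- z)) refl _ _ z a b ⟩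
        (z * (Y 0 * H n 0) + (X 0 * G (suc n) 1 - X 0 * H n 2)) + (a + b) * (1# - z)
          ≈⟨ trans (+-congʳ ends) (+-identityˡ _) ⟩
        (a + b) * (1# - z)
          ≈⟨ *-congʳ (sym (sum-+ _ _ N)) ⟩
        ΣH n N * (1# - z) ∎
        where
        z = x * q ^ n
        a = sum (λ j → Y j * H n j) N
        b = sum (λ j → X j * H n (suc (suc j))) N
        Y-term : ∀ j → Y j * G (suc n) j ≈ Y j * H n j - z * (Y (suc j) * H n (suc j))
        Y-term j = begin
          Y j * G (suc n) j
            ≈⟨ *-congˡ (trans (G-suc n j) (+-congˡ (*-congʳ (sym (^-+ (suc j) n (≡.cong suc (ℕ.+-comm j n))))))) ⟩
          Y j * (h₀ + q ^ suc j * q ^ n * h₁)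
            ≈⟨ solve 5 (λ X g J Q h → X :* (g :+ J :* Q :* h) := X :* g :- (:- (J :* X)) :* Q :* h) refl _ _ _ _ _ ⟩
          Y j * h₀ - (- (q ^ suc j * Y j)) * q ^ n * h₁
            ≈⟨ +-congˡ (-‿cong (*-congʳ (*-congʳ (sym (x*Y j))))) ⟩
          Y j * h₀ - x * Y (suc j) * q ^ n * h₁
            ≈⟨ +-congˡ (-‿cong (solve 4 (λ y X Q g → y :* X :* Q :* g := y :* Q :* (X :* g)) refl _ _ _ _)) ⟩
          Y j * h₀ - z * (Y (suc j) * h₁) ∎
          where
          h₀ = H n j
          h₁ = H n (suc j)
        X-term : ∀ j → X (suc j) * G (suc n) (suc (suc j)) ≈ X (suc j) * H n (suc (suc (suc j))) - z * (X j * H n (suc (suc j)))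
        X-term j = begin
          - - sgn j * (q ^ (t (suc j) ℕ.+ suc j) * (x * x ^ suc j)) * G (suc n) (suc (suc j))
            ≈⟨ solve 5 (λ s T y w h → :- :- s :* (T :* (y :* w)) :* h := s :* (y :* w) :* (T :* h)) refl _ _ _ _ _ ⟩
          sgn j * (x * x ^ suc j) * (q ^ (t (suc j) ℕ.+ suc j) * G (suc n) (suc (suc j)))
            ≈⟨ *-congˡ (trans (G-suc₂ (t (suc j)) n (suc j)) (+-congʳ (*-congʳ (sym (^-+ (t (suc j)) n ≡.refl))))) ⟩
          sgn j * (x * x ^ suc j) * (q ^ t (suc j) * q ^ n * H n (suc (suc j)) + q ^ (t (suc j) ℕ.+ suc j) * H n (suc (suc (suc j))))
            ≈⟨ solve 8 (λ s y w T Q g U g′ → s :* (y :* w) :* (T :* Q :* g :+ U :* g′)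
                 := :- :- s :* (U :* (y :* w)) :* g′ :- y :* Q :* (:- s :* (T :* w) :* g)) refl _ _ _ _ _ _ _ _ ⟩
          X (suc j) * H n (suc (suc (suc j))) - z * (X j * H n (suc (suc j))) ∎
        ends : z * (Y 0 * H n 0) + (X 0 * G (suc n) 1 - X 0 * H n 2) ≈ 0#
        ends = begin
          z * (Y 0 * H n 0) + (X 0 * G (suc n) 1 - X 0 * H n 2)
            ≈⟨ +-cong (*-congˡ (*-congˡ (H-zero n))) (+-congʳ (*-congˡ (trans (sym (*-identityˡ _)) (G-suc₂ 0 n 0)))) ⟩
          z * (Y 0 * H n 1) + (X 0 * (q ^ n * H n 1 + 1# * H n 2) - X 0 * H n 2)
            ≈⟨ solve 4 (λ x Q g h → x :* Q :* (one :* (one :* one) :* g) :+ (:- one :* (one :* (x :* one)) :* (Q :* g :+ one :* h) :- :- one :* (one :* (x :* one)) :* h) := nil) refl x _ _ _ ⟩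
          0# ∎

    finite-triple-product : ∀ n N → n ℕ.< N →
      product n ≈ sum (λ j → Y j * gauss (double n) (n ℕ.+ j) + X j * gauss (double n) (n ℕ.+ suc j)) N
    finite-triple-product zero    N 0<N = sym (trans (sum-first _ 0<N (λ j → trans (+-cong (*-≈0 _ refl) (*-≈0 _ refl)) (+-identityʳ 0#)))
      (solve 1 (λ x → one :* (one :* one) :* one :+ :- one :* (one :* (x :* one)) :* nil := one) refl x))
    finite-triple-product (suc n) N n<N = begin
      product n * (1# - y * q ^ n) * (1# - x * q ^ n)
        ≈⟨ *-congʳ (*-congʳ (finite-triple-product n N (ℕ.<-trans (ℕ.n<1+n n) n<N))) ⟩
      ΣG n N * (1# - y * q ^ n) * (1# - x * q ^ n)
        ≈⟨ *-congʳ (factor-y n N n<N) ⟨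
      ΣH n N * (1# - x * q ^ n)
        ≈⟨ factor-x n N n<N ⟨
      ΣG (suc n) N ∎

-- The constructive order on ℝ and geometric decay.

module RealOrder {c ℓ₁ ℓ₂ ℓ₃} (ℝ : RealField c ℓ₁ ℓ₂ ℓ₃) where
  open RealField ℝ hiding (zero)
  open RealFieldProperties ℝ
  open IntegerCoefficients commutativeRing
  open RawMonoidOps +-rawMonoid using () renaming (_×_ to _·_)

  infix 4 _≤_
  _≤_ : Carrier → Carrier → Set ℓ₃
  x ≤ y = ¬ (y < x)

  ≤-reflexive : ∀ {x y} → x ≈ y → x ≤ y
  ≤-reflexive x≈y y<x = <-irrefl (sym x≈y) y<x

  ≤-trans : ∀ {x y z} → x ≤ y → y ≤ z → x ≤ z
  ≤-trans {y = y} x≤y y≤z z<x with <-cotrans z<x y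
  ... | inj₁ z<y = y≤z z<y
  ... | inj₂ y<x = x≤y y<x

  <⇒≤ : ∀ {x y} → x < y → x ≤ y
  <⇒≤ x<y y<x = <-irrefl refl (<-trans x<y y<x)

  <-≤-trans : ∀ {x y z} → x < y → y ≤ z → x < z
  <-≤-trans {z = z} x<y y≤z with <-cotrans x<y z
  ... | inj₁ x<z = x<z
  ... | inj₂ z<y = ⊥-elim (y≤z z<y)

  ≤-<-trans : ∀ {x y z} → x ≤ y → y < z → x < z
  ≤-<-trans {x} x≤y y<z with <-cotrans y<z x
  ... | inj₁ y<x = ⊥-elim (x≤y y<x)
  ... | inj₂ x<z = x<z

  ≤-resp : ∀ {x x′ y y′} → x ≈ x′ → y ≈ y′ → x ≤ y → x′ ≤ y′
  ≤-resp x≈x′ y≈y′ x≤y y′<x′ = x≤y (<-respˡ-≈ (sym y≈y′) (<-respʳ-≈ (sym x≈x′) y′<x′))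

  0≤-⇒≤ : ∀ {x y} → 0# ≤ y - x → x ≤ y
  0≤-⇒≤ {x} {y} 0≤y-x y<x = 0≤y-x (0<-⇒<0 (<-respʳ-≈ (solve 2 (λ x y → x :- y := :- (y :- x)) refl x y) (<⇒0<- y<x)))

  ≤⇒0≤- : ∀ {x y} → x ≤ y → 0# ≤ y - x
  ≤⇒0≤- {x} {y} x≤y y-x<0 = x≤y (0<-⇒< (<-respʳ-≈ (solve 2 (λ x y → :- (y :- x) := x :- y) refl x y) (<0⇒0<- y-x<0)))

  0≤x+y : ∀ {x y} → 0# ≤ x → 0# ≤ y → 0# ≤ x + y
  0≤x+y {x} 0≤x 0≤y x+y<0 with <-cotrans x+y<0 x
  ... | inj₁ x+y<x = 0≤y (+-cancelʳ-<0 x+y<x)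
  ... | inj₂ x<0   = 0≤x x<0

  -- If xy < 0, then y cannot be apart from 0, so tightness gives y ≈ 0, which contradicts xy < 0.
  0≤x*y : ∀ {x y} → 0# ≤ x → 0# ≤ y → 0# ≤ x * y
  0≤x*y {x} {y} 0≤x 0≤y xy<0 = <-irrefl (trans (*-congˡ y≈0) (zeroʳ x)) xy<0
    where
    apart : ¬ y # 0#
    apart y#0 with Equivalence.to #⇔<⊎> y#0
    ... | inj₂ 0<y = 0≤*0< 0≤x 0<y xy<0
    ... | inj₁ y<0 = 0≤y y<0
    y≈0 : y ≈ 0#
    y≈0 = proj₁ (tight y 0#) apart

  +-mono-≤ : ∀ {x y z w} → x ≤ y → z ≤ w → x + z ≤ y + w
  +-mono-≤ {x} {y} {z} {w} x≤y z≤w = 0≤-⇒≤ (≤-resp refl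
    (solve 4 (λ x y z w → (y :- x) :+ (w :- z) := (y :+ w) :- (x :+ z)) refl x y z w)
    (0≤x+y (≤⇒0≤- x≤y) (≤⇒0≤- z≤w)))

  *-mono-≤ : ∀ {x y z w} → 0# ≤ x → 0# ≤ z → x ≤ y → z ≤ w → x * z ≤ y * w
  *-mono-≤ {x} {y} {z} {w} 0≤x 0≤z x≤y z≤w = 0≤-⇒≤ (≤-resp refl
    (solve 4 (λ x y z w → (y :- x) :* w :+ x :* (w :- z) := (y :* w) :- (x :* z)) refl x y z w)
    (0≤x+y (0≤x*y (≤⇒0≤- x≤y) (≤-trans 0≤z z≤w)) (0≤x*y 0≤x (≤⇒0≤- z≤w))))

  *-monoˡ-≤ : ∀ {x z w} → 0# ≤ x → z ≤ w → x * z ≤ x * w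
  *-monoˡ-≤ {x} {z} {w} 0≤x z≤w = 0≤-⇒≤ (≤-resp refl
    (solve 3 (λ x z w → x :* (w :- z) := x :* w :- x :* z) refl x z w) (0≤x*y 0≤x (≤⇒0≤- z≤w)))

  *-monoˡ-< : ∀ {x z w} → 0# < x → z < w → x * z < x * w
  *-monoˡ-< {x} {z} {w} 0<x z<w = 0<-⇒< (<-respʳ-≈
    (solve 3 (λ x z w → x :* (w :- z) := x :* w :- x :* z) refl x z w) (*-pos 0<x (<⇒0<- z<w)))

  x*x≤y*y⇒x≤y : ∀ {x y} → 0# ≤ y → x * x ≤ y * y → x ≤ y
  x*x≤y*y⇒x≤y {x} {y} 0≤y xx≤yy y<x = xx≤yy (0<-⇒< (<-respʳ-≈
    (solve 2 (λ x y → (x :- y) :* (x :+ y) := x :* x :- y :* y) refl x y)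
    (*-pos (<⇒0<- y<x) (0<+0≤ (≤-<-trans 0≤y y<x) 0≤y))))

  x<y⇒x*x<y*y : ∀ {x y} → 0# ≤ x → x < y → x * x < y * y
  x<y⇒x*x<y*y {x} {y} 0≤x x<y = 0<-⇒< (<-respʳ-≈
    (solve 2 (λ x y → (y :- x) :* (y :+ x) := y :* y :- x :* x) refl x y)
    (*-pos (<⇒0<- x<y) (0<+0≤ (≤-<-trans 0≤x x<y) 0≤x)))

  -y<x<y⇒x*x≤y*y : ∀ {x y} → - y < x → x < y → x * x ≤ y * y
  -y<x<y⇒x*x≤y*y {x} {y} -y<x x<y = 0≤-⇒≤ (≤-resp refl
    (solve 2 (λ x y → (y :- x) :* (x :- :- y) := y :* y :- x :* x) refl x y)
    (0≤x*y (<⇒≤ (<⇒0<- x<y)) (<⇒≤ (<⇒0<- -y<x))))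

  x*y≈1⇒x≠0 : ∀ {x y} → x * y ≈ 1# → x # 0#
  x*y≈1⇒x≠0 {x} {y} xy≈1 = invertible⇒# (y ,
    trans (solve 2 (λ x y → y :* (x :- nil) := x :* y) refl x y) xy≈1 ,
    trans (solve 2 (λ x y → (x :- nil) :* y := x :* y) refl x y) xy≈1)

  0≤∧#⇒0< : ∀ {x} → 0# ≤ x → x # 0# → 0# < x
  0≤∧#⇒0< 0≤x x#0 with Equivalence.to #⇔<⊎> x#0
  ... | inj₁ x<0 = ⊥-elim (0≤x x<0)
  ... | inj₂ 0<x = 0<x

  reciprocal : ∀ {x} → 0# < x → ∃[ y ] (x * y ≈ 1# × 0# < y)
  reciprocal {x} 0<x with #⇒invertible (0<⇒# 0<x)
  ... | y , _ , [x-0]*y≈1 = y , xy≈1 , 0≤∧#⇒0< 0≤y (x*y≈1⇒x≠0 (trans (*-comm y x) xy≈1))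
    where
    xy≈1 : x * y ≈ 1#
    xy≈1 = trans (solve 2 (λ x y → x :* y := (x :- nil) :* y) refl x y) [x-0]*y≈1
    -- The inverse is y = x y², hence nonnegative; being invertible, it is apart from 0.
    0≤y : 0# ≤ y
    0≤y = ≤-resp refl (trans (solve 2 (λ x y → x :* (y :* y) := (x :* y) :* y) refl x y) (trans (*-congʳ xy≈1) (*-identityˡ y)))
      (0≤x*y (<⇒≤ 0<x) (0≤x*x y))

  0≤n·1 : ∀ n → 0# ≤ n · 1#
  0≤n·1 zero    = ≤-reflexive refl
  0≤n·1 (suc n) = 0≤x+y (<⇒≤ 0<1) (0≤n·1 n)

  module Geometric (τ : Carrier) (0<τ : 0# < τ) (τ<1 : τ < 1#) where
    open Exp (CommutativeRing.semiring commutativeRing) using (_^_; ^-homo-*)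

    0<τ^ : ∀ n → 0# < τ ^ n
    0<τ^ zero    = 0<1
    0<τ^ (suc n) = *-pos 0<τ (0<τ^ n)

    0≤τ^ : ∀ n → 0# ≤ τ ^ n
    0≤τ^ n = <⇒≤ (0<τ^ n)

    τ^≤1 : ∀ n → τ ^ n ≤ 1#
    τ^≤1 zero    = ≤-reflexive refl
    τ^≤1 (suc n) = ≤-resp refl (*-identityˡ 1#) (*-mono-≤ (<⇒≤ 0<τ) (0≤τ^ n) (<⇒≤ τ<1) (τ^≤1 n))

    τ^-+ : ∀ m n → τ ^ (m ℕ.+ n) ≈ τ ^ m * τ ^ n
    τ^-+ = ^-homo-* τ

    τ^-antitone : ∀ {m n} → m ℕ.≤ n → τ ^ n ≤ τ ^ m
    τ^-antitone {m} {n} m≤n = ≤-resp (sym (trans (reflexive (≡.cong (τ ^_) (≡.sym (ℕ.m+[n∸m]≡n m≤n)))) (τ^-+ m (n ∸ m))))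
      (*-identityʳ _) (*-monoˡ-≤ (0≤τ^ m) (τ^≤1 (n ∸ m)))

    private
      K,_ : ∃[ K ] ((1# - τ) * K ≈ 1# × 0# < K)
      K,_ = reciprocal (<⇒0<- τ<1)

    K : Carrier
    K = proj₁ K,_

    [1-τ]*K≈1 : (1# - τ) * K ≈ 1#
    [1-τ]*K≈1 = proj₁ (proj₂ K,_)

    0<K : 0# < K
    0<K = proj₂ (proj₂ K,_)

    -- Since τⁿ is the smallest of the powers below it, n τⁿ(1 - τ) ≤ Σ τⁱ(1 - τ) over i < n, and
    -- this telescopes to 1 - τⁿ ≤ 1.
    n·τ^n≤K : ∀ n → n · 1# * τ ^ n ≤ K
    n·τ^n≤K n = ≤-resp
      (trans (solve 3 (λ k t y → k :* (t :* y) := (y :* k) :* t) refl K _ (1# - τ)) (trans (*-congʳ [1-τ]*K≈1) (*-identityˡ _)))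
      (*-identityʳ K)
      (*-monoˡ-≤ (<⇒≤ 0<K) (≤-trans (telescope n) (≤-trans (+-mono-≤ (≤-reflexive refl) (<⇒≤ (neg (0<τ^ n)))) (≤-reflexive (+-identityʳ 1#)))))
      where
      neg : ∀ {x} → 0# < x → - x < 0#
      neg {x} 0<x = 0<-⇒<0 (<-respʳ-≈ (solve 1 (λ x → x := :- :- x) refl x) 0<x)
      telescope : ∀ n → n · 1# * τ ^ n * (1# - τ) ≤ 1# - τ ^ n
      telescope zero    = ≤-reflexive (solve 1 (λ t → nil :* one :* (one :- t) := one :- one) refl τ)
      telescope (suc n) = ≤-resp
        (solve 3 (λ k t x → t :* (x :* (one :- t)) :+ t :* (k :* x :* (one :- t)) := (one :+ k) :* (t :* x) :* (one :- t)) refl _ τ (τ ^ n))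
        (solve 2 (λ t x → x :* (one :- t) :+ (one :- x) := one :- t :* x) refl τ (τ ^ n))
        (+-mono-≤ (t*x≤x (0≤x*y (0≤τ^ n) 0≤1-τ)) (≤-trans (t*x≤x (0≤x*y (0≤x*y (0≤n·1 n) (0≤τ^ n)) 0≤1-τ)) (telescope n)))
        where
        0≤1-τ : 0# ≤ 1# - τ
        0≤1-τ = <⇒≤ (<⇒0<- τ<1)
        t*x≤x : ∀ {x} → 0# ≤ x → τ * x ≤ x
        t*x≤x 0≤x = ≤-resp refl (*-identityˡ _) (*-mono-≤ (<⇒≤ 0<τ) 0≤x (<⇒≤ τ<1) (≤-reflexive refl))

    private
      cancelˡ : ∀ C ε δ x → ε * δ ≈ 1# → (1# - τ) * (ε * x * (C * K * δ)) ≈ C * x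
      cancelˡ C ε δ x εδ≈1 = trans
        (solve 6 (λ y e x C K d → y :* (e :* x :* (C :* K :* d)) := (e :* d) :* (y :* K) :* (C :* x)) refl (1# - τ) ε x C K δ)
        (trans (*-congʳ (trans (*-cong εδ≈1 [1-τ]*K≈1) (*-identityˡ 1#))) (*-identityˡ _))

      cancelʳ : ∀ ε → (1# - τ) * (ε * K) ≈ ε
      cancelʳ ε = trans (solve 3 (λ y e K → y :* (e :* K) := e :* (y :* K)) refl (1# - τ) ε K) (trans (*-congˡ [1-τ]*K≈1) (*-identityʳ ε))

      C*τ^N< : ∀ C ε δ N → 0# < ε → ε * δ ≈ 1# → C * K * δ < N · 1# → C * τ ^ N < ε
      C*τ^N< C ε δ N 0<ε εδ≈1 CKδ<N = <-respˡ-≈ (cancelˡ C ε δ (τ ^ N) εδ≈1) (<-respʳ-≈ (cancelʳ ε) (*-monoˡ-< (<⇒0<- τ<1) step))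
        where
        step : ε * τ ^ N * (C * K * δ) < ε * K
        step = <-≤-trans (*-monoˡ-< (*-pos 0<ε (0<τ^ N)) CKδ<N)
          (≤-resp (solve 3 (λ e x n → e :* (n :* x) := e :* x :* n) refl ε (τ ^ N) (N · 1#)) refl (*-monoˡ-≤ (<⇒≤ 0<ε) (n·τ^n≤K N)))

    -- The Archimedean axiom provides N > (1 + C)K/ε. Together with N τ^N ≤ K this gives (1 + C) τ^N
    -- < ε, and later powers are no larger.
    C*τ^n→0 : ∀ C → 0# ≤ C → ∀ ε → 0# < ε → ∃[ N ] ∀ n → N ℕ.≤ n → C * τ ^ n < ε
    C*τ^n→0 C 0≤C ε 0<ε = N , λ n N≤n → ≤-<-trans
      (*-mono-≤ 0≤C (0≤τ^ n) C≤1+C (τ^-antitone N≤n))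
      (C*τ^N< (1# + C) ε δ N 0<ε (proj₁ (proj₂ δ,_)) (proj₂ N,_))
      where
      δ,_ = reciprocal 0<ε
      δ = proj₁ δ,_
      N,_ = archimedean ((1# + C) * K * δ)
      N = proj₁ N,_
      C≤1+C : C ≤ 1# + C
      C≤1+C = ≤-resp (+-identityˡ C) refl (+-mono-≤ (<⇒≤ 0<1) (≤-reflexive refl))

-- The ring ℂ and bounds for moduli.

module ComplexRing {c ℓ₁ ℓ₂ ℓ₃} (ℝ : RealField c ℓ₁ ℓ₂ ℓ₃) where
  private
    module ℝ = RealField ℝ
  open Complex ℝ
  open IntegerCoefficients ℝ.commutativeRing

  complexRing : CommutativeRing c ℓ₁
  complexRing = record
    { Carrier = ℂ ; _≈_ = _≈_ ; _+_ = _+_ ; _*_ = _*_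
    ; -_ = λ z → (ℝ.- re z) +i (ℝ.- im z) ; 0# = 0ℂ ; 1# = 1ℂ
    ; isCommutativeRing = record
      { isRing = record
        { +-isAbelianGroup = record
          { isGroup = record
            { isMonoid = record
              { isSemigroup = record
                { isMagma = record
                  { isEquivalence = record
                    { refl  = ℝ.refl , ℝ.refl
                    ; sym   = λ (p , q) → ℝ.sym p , ℝ.sym q
                    ; trans = λ (p , q) (r , s) → ℝ.trans p r , ℝ.trans q s
                    }
                  ; ∙-cong = λ (p , q) (r , s) → ℝ.+-cong p r , ℝ.+-cong q s
                  }
                ; assoc = λ x y z → ℝ.+-assoc _ _ _ , ℝ.+-assoc _ _ _
                }
              ; identity = (λ x → ℝ.+-identityˡ _ , ℝ.+-identityˡ _) , (λ x → ℝ.+-identityʳ _ , ℝ.+-identityʳ _)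
              }
            ; inverse = (λ x → ℝ.-‿inverseˡ _ , ℝ.-‿inverseˡ _) , (λ x → ℝ.-‿inverseʳ _ , ℝ.-‿inverseʳ _)
            ; ⁻¹-cong = λ (p , q) → ℝ.-‿cong p , ℝ.-‿cong q
            }
          ; comm = λ x y → ℝ.+-comm _ _ , ℝ.+-comm _ _
          }
        ; *-cong = λ (p , q) (r , s) → ℝ.+-cong (ℝ.*-cong p r) (ℝ.-‿cong (ℝ.*-cong q s)) , ℝ.+-cong (ℝ.*-cong p s) (ℝ.*-cong q r)
        ; *-assoc = λ x y z →
            solve 6 (λ a b d e f g → (a :* d :- b :* e) :* f :- (a :* e :+ b :* d) :* g := a :* (d :* f :- e :* g) :- b :* (d :* g :+ e :* f)) ℝ.refl (re x) (im x) (re y) (im y) (re z) (im z) ,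
            solve 6 (λ a b d e f g → (a :* d :- b :* e) :* g :+ (a :* e :+ b :* d) :* f := a :* (d :* g :+ e :* f) :+ b :* (d :* f :- e :* g)) ℝ.refl (re x) (im x) (re y) (im y) (re z) (im z)
        ; *-identity =
            (λ x → solve 2 (λ a b → one :* a :- nil :* b := a) ℝ.refl (re x) (im x) , solve 2 (λ a b → one :* b :+ nil :* a := b) ℝ.refl (re x) (im x)) ,
            (λ x → solve 2 (λ a b → a :* one :- b :* nil := a) ℝ.refl (re x) (im x) , solve 2 (λ a b → a :* nil :+ b :* one := b) ℝ.refl (re x) (im x))
        ; distrib =
            (λ x y z →
              solve 6 (λ a b d e f g → a :* (d :+ f) :- b :* (e :+ g) := (a :* d :- b :* e) :+ (a :* f :- b :* g)) ℝ.refl (re x) (im x) (re y) (im y) (re z) (im z) ,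
              solve 6 (λ a b d e f g → a :* (e :+ g) :+ b :* (d :+ f) := (a :* e :+ b :* d) :+ (a :* g :+ b :* f)) ℝ.refl (re x) (im x) (re y) (im y) (re z) (im z)) ,
            (λ x y z →
              solve 6 (λ a b d e f g → (d :+ f) :* a :- (e :+ g) :* b := (d :* a :- e :* b) :+ (f :* a :- g :* b)) ℝ.refl (re x) (im x) (re y) (im y) (re z) (im z) ,
              solve 6 (λ a b d e f g → (d :+ f) :* b :+ (e :+ g) :* a := (d :* b :+ e :* a) :+ (f :* b :+ g :* a)) ℝ.refl (re x) (im x) (re y) (im y) (re z) (im z))
        }
      ; *-comm = λ x y →
          solve 4 (λ a b d e → a :* d :- b :* e := d :* a :- e :* b) ℝ.refl (re x) (im x) (re y) (im y) ,
          solve 4 (λ a b d e → a :* e :+ b :* d := d :* b :+ e :* a) ℝ.refl (re x) (im x) (re y) (im y)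
      }
    }

module ComplexBounds {c ℓ₁ ℓ₂ ℓ₃} (ℝ : RealField c ℓ₁ ℓ₂ ℓ₃) where
  private
    module ℝ = RealField ℝ
  open ℝ using (0#; 1#; _<_) renaming (Carrier to |ℝ|; _≈_ to _≈ʳ_)
  open Complex ℝ using (ℂ; 0ℂ; 1ℂ; re; im; _+i_; ∣_∣²; inverse; _≠0; ∣_∣<_)
  open RealFieldProperties ℝ
  open RealOrder ℝ
  open IntegerCoefficients ℝ.commutativeRing
  open ComplexRing ℝ public
  open CommutativeRing complexRing hiding (Carrier; zero; 0#; 1#)

  -- Stated through squares because ∣z∣ itself would take a square root; the bound r is any
  -- nonnegative real.
  infix 4 ∣_∣≤_
  ∣_∣≤_ : ℂ → |ℝ| → Set ℓ₃
  ∣ z ∣≤ r = (0# ≤ r) × (∣ z ∣² ≤ r ℝ.* r)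

  ∣∣²-cong : ∀ {z w} → z ≈ w → ∣ z ∣² ≈ʳ ∣ w ∣²
  ∣∣²-cong (p , q) = ℝ.+-cong (ℝ.*-cong p p) (ℝ.*-cong q q)

  ∣*∣² : ∀ z w → ∣ z * w ∣² ≈ʳ ∣ z ∣² ℝ.* ∣ w ∣²
  ∣*∣² z w = two-squares (re z) (im z) (re w) (im w)

  0≤∣∣² : ∀ z → 0# ≤ ∣ z ∣²
  0≤∣∣² z = 0≤xx+yy (re z) (im z)

  ∣1∣² : ∣ 1ℂ ∣² ≈ʳ 1#
  ∣1∣² = solve 0 (one :* one :+ nil :* nil := one) ℝ.refl

  ∣∣≤-cong : ∀ {z w r s} → z ≈ w → r ≈ʳ s → ∣ z ∣≤ r → ∣ w ∣≤ s
  ∣∣≤-cong z≈w r≈s (0≤r , z≤r) = ≤-resp ℝ.refl r≈s 0≤r , ≤-resp (∣∣²-cong z≈w) (ℝ.*-cong r≈s r≈s) z≤r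

  ∣∣≤-mono : ∀ {z r s} → r ≤ s → ∣ z ∣≤ r → ∣ z ∣≤ s
  ∣∣≤-mono r≤s (0≤r , z≤r) = ≤-trans 0≤r r≤s , ≤-trans z≤r (*-mono-≤ 0≤r 0≤r r≤s r≤s)

  ∣0∣≤ : ∀ {r} → 0# ≤ r → ∣ 0ℂ ∣≤ r
  ∣0∣≤ 0≤r = 0≤r , ≤-trans (≤-reflexive (solve 0 (nil :* nil :+ nil :* nil := nil) ℝ.refl)) (0≤x*y 0≤r 0≤r)

  ∣1∣≤1 : ∣ 1ℂ ∣≤ 1#
  ∣1∣≤1 = <⇒≤ 0<1 , ≤-reflexive (ℝ.trans ∣1∣² (ℝ.sym (ℝ.*-identityˡ 1#)))

  ∣*∣≤ : ∀ {z w r s} → ∣ z ∣≤ r → ∣ w ∣≤ s → ∣ z * w ∣≤ r ℝ.* s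
  ∣*∣≤ {z} {w} {r} {s} (0≤r , z≤r) (0≤s , w≤s) = 0≤x*y 0≤r 0≤s ,
    ≤-resp (ℝ.sym (∣*∣² z w)) (solve 2 (λ r s → (r :* r) :* (s :* s) := (r :* s) :* (r :* s)) ℝ.refl r s)
      (*-mono-≤ (0≤∣∣² z) (0≤∣∣² w) z≤r w≤s)

  ∣-∣≤ : ∀ {z r} → ∣ z ∣≤ r → ∣ - z ∣≤ r
  ∣-∣≤ {z} (0≤r , z≤r) = 0≤r , ≤-resp (solve 2 (λ a b → a :* a :+ b :* b := (:- a) :* (:- a) :+ (:- b) :* (:- b)) ℝ.refl (re z) (im z)) ℝ.refl z≤r

  -- Cauchy–Schwarz bounds the cross term 2 Re(z w̄).
  ∣+∣≤ : ∀ {z w r s} → ∣ z ∣≤ r → ∣ w ∣≤ s → ∣ z + w ∣≤ r ℝ.+ s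
  ∣+∣≤ {z} {w} {r} {s} (0≤r , z≤r) (0≤s , w≤s) = 0≤x+y 0≤r 0≤s ,
    ≤-resp (solve 4 (λ a b d e → (a :* a :+ b :* b) :+ (d :* d :+ e :* e) :+ ((a :* d :+ b :* e) :+ (a :* d :+ b :* e)) := (a :+ d) :* (a :+ d) :+ (b :+ e) :* (b :+ e)) ℝ.refl (re z) (im z) (re w) (im w))
           (solve 2 (λ r s → (r :* r) :+ (s :* s) :+ (r :* s :+ r :* s) := (r :+ s) :* (r :+ s)) ℝ.refl r s)
      (+-mono-≤ (+-mono-≤ z≤r w≤s) (+-mono-≤ cross cross))
    where
    x = re z ℝ.* re w ℝ.+ im z ℝ.* im w
    y = re z ℝ.* im w ℝ.- im z ℝ.* re w
    cross : x ≤ r ℝ.* s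
    cross = x*x≤y*y⇒x≤y (0≤x*y 0≤r 0≤s)
      (≤-trans (≤-resp (ℝ.+-identityʳ _) (solve 4 (λ a b d e → (a :* d :+ b :* e) :* (a :* d :+ b :* e) :+ (a :* e :- b :* d) :* (a :* e :- b :* d) := (a :* a :+ b :* b) :* (d :* d :+ e :* e)) ℝ.refl (re z) (im z) (re w) (im w))
          (+-mono-≤ {x ℝ.* x} (≤-reflexive ℝ.refl) (0≤x*x y)))
        (≤-resp ℝ.refl (solve 2 (λ r s → (r :* r) :* (s :* s) := (r :* s) :* (r :* s)) ℝ.refl r s)
          (*-mono-≤ (0≤∣∣² z) (0≤∣∣² w) z≤r w≤s)))

  re≤ : ∀ {z r} → ∣ z ∣≤ r → re z ≤ r
  re≤ {z} (0≤r , z≤r) = x*x≤y*y⇒x≤y 0≤r (≤-trans (≤-resp (ℝ.+-identityʳ _) ℝ.refl (+-mono-≤ {re z ℝ.* re z} (≤-reflexive ℝ.refl) (0≤x*x (im z)))) z≤r)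

  im≤ : ∀ {z r} → ∣ z ∣≤ r → im z ≤ r
  im≤ {z} (0≤r , z≤r) = x*x≤y*y⇒x≤y 0≤r (≤-trans (≤-resp (ℝ.+-identityˡ _) ℝ.refl (+-mono-≤ (0≤x*x (re z)) (≤-reflexive ℝ.refl))) z≤r)

  -- An upper bound for ∣z∣ that is polynomial in the coordinates, from (1 + s)² - s = 1 + s + s²
  -- with s = ∣z∣².
  ∣∣≤1+∣∣² : ∀ z → ∣ z ∣≤ 1# ℝ.+ ∣ z ∣²
  ∣∣≤1+∣∣² z = 0≤x+y (<⇒≤ 0<1) (0≤∣∣² z) , 0≤-⇒≤ (≤-resp ℝ.refl
    (solve 1 (λ s → (one :+ s) :+ s :* s := (one :+ s) :* (one :+ s) :- s) ℝ.refl ∣ z ∣²)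
    (0≤x+y (0≤x+y (<⇒≤ 0<1) (0≤∣∣² z)) (0≤x*y (0≤∣∣² z) (0≤∣∣² z))))

  ∣∣≤∧<⇒∣∣< : ∀ {z r s} → ∣ z ∣≤ r → r < s → ∣ z ∣< s
  ∣∣≤∧<⇒∣∣< (0≤r , z≤r) r<s = ≤-<-trans 0≤r r<s , ≤-<-trans z≤r (x<y⇒x*x<y*y 0≤r r<s)

  components⇒∣∣≤ : ∀ {z r} → 0# < r → ℝ.- r < re z → re z < r → ℝ.- r < im z → im z < r → ∣ z ∣≤ r ℝ.+ r
  components⇒∣∣≤ {z} {r} 0<r -r<x x<r -r<y y<r = 0≤x+y 0≤r 0≤r ,
    ≤-trans (+-mono-≤ (-y<x<y⇒x*x≤y*y -r<x x<r) (-y<x<y⇒x*x≤y*y -r<y y<r))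
      (0≤-⇒≤ (≤-resp ℝ.refl (solve 1 (λ r → r :* r :+ r :* r := (r :+ r) :* (r :+ r) :- (r :* r :+ r :* r)) ℝ.refl r)
        (0≤x+y (0≤x*x r) (0≤x*x r))))
    where 0≤r = <⇒≤ 0<r

  *-inverse : ∀ z z≠0 → z * inverse z z≠0 ≈ 1ℂ
  *-inverse z z≠0 = ℝ.trans (solve 3 (λ a b s → a :* (a :* s) :- b :* (:- (b :* s)) := (a :* a :+ b :* b) :* s) ℝ.refl (re z) (im z) s) ∣z∣²*s≈1 ,
    solve 3 (λ a b s → a :* (:- (b :* s)) :+ b :* (a :* s) := nil) ℝ.refl (re z) (im z) s
    where
    s = proj₁ (ℝ.#⇒invertible (0<⇒# z≠0))
    ∣z∣²*s≈1 : ∣ z ∣² ℝ.* s ≈ʳ 1#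
    ∣z∣²*s≈1 = ℝ.trans (solve 2 (λ x y → x :* y := (x :- nil) :* y) ℝ.refl ∣ z ∣² s) (proj₂ (proj₂ (ℝ.#⇒invertible (0<⇒# z≠0))))

  -- ∣z∣² ∣w∣² = 1 makes ∣z∣² invertible, hence apart from 0.
  *≈1⇒≠0 : ∀ {z w} → z * w ≈ 1ℂ → z ≠0
  *≈1⇒≠0 {z} {w} zw≈1 = 0≤∧#⇒0< (0≤∣∣² z) (x*y≈1⇒x≠0 (ℝ.trans (ℝ.sym (∣*∣² z w)) (ℝ.trans (∣∣²-cong zw≈1) ∣1∣²)))

  inverse-unique : ∀ {z w} z≠0 → z * w ≈ 1ℂ → inverse z z≠0 ≈ w
  inverse-unique {z} {w} z≠0 zw≈1 = begin
    inverse z z≠0              ≈⟨ *-identityʳ _ ⟨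
    inverse z z≠0 * 1ℂ         ≈⟨ *-congˡ zw≈1 ⟨
    inverse z z≠0 * (z * w)    ≈⟨ *-assoc (inverse z z≠0) z w ⟨
    inverse z z≠0 * z * w      ≈⟨ *-congʳ (trans (*-comm (inverse z z≠0) z) (*-inverse z z≠0)) ⟩
    1ℂ * w                     ≈⟨ *-identityˡ w ⟩
    w                          ∎
    where open SetoidReasoning setoid

  -- 1 ≤ (1 − τ)⁻² ∣1 − w∣² as ∣1 − w∣ ≥ 1 − Re w ≥ 1 − τ
  ∣1-w∣-inverse : ∀ {w v τ K} → ∣ w ∣≤ τ → τ < 1# → (1# ℝ.- τ) ℝ.* K ≈ʳ 1# → 0# < K → (1ℂ - w) * v ≈ 1ℂ → ∣ v ∣≤ K
  ∣1-w∣-inverse {w} {v} {τ} {K} w≤τ τ<1 [1-τ]K≈1 0<K [1-w]v≈1 = <⇒≤ 0<K ,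
    ≤-resp (ℝ.trans (solve 3 (λ K d s → (K :* K) :* ((d :* d) :* s) := (d :* K) :* (d :* K) :* s) ℝ.refl K d ∣ v ∣²)
             (ℝ.trans (ℝ.*-congʳ (ℝ.trans (ℝ.*-cong [1-τ]K≈1 [1-τ]K≈1) (ℝ.*-identityˡ 1#))) (ℝ.*-identityˡ _)))
           (ℝ.trans (ℝ.*-congˡ (ℝ.trans (ℝ.sym (∣*∣² (1ℂ - w) v)) (ℝ.trans (∣∣²-cong [1-w]v≈1) ∣1∣²))) (ℝ.*-identityʳ _))
      (*-monoˡ-≤ (0≤x*x K) (*-mono-≤ (0≤x*x d) (0≤∣∣² v) d*d≤ (≤-reflexive ℝ.refl)))
    where
    d = 1# ℝ.- τ
    d≤ : d ≤ 1# ℝ.- re w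
    d≤ = 0≤-⇒≤ (≤-resp ℝ.refl (solve 2 (λ t x → t :- x := (one :- x) :- (one :- t)) ℝ.refl τ (re w)) (≤⇒0≤- (re≤ w≤τ)))
    0≤d = <⇒≤ (<⇒0<- τ<1)
    d*d≤ : d ℝ.* d ≤ ∣ 1ℂ - w ∣²
    d*d≤ = ≤-trans (*-mono-≤ 0≤d 0≤d d≤ d≤)
      (≤-resp (ℝ.+-identityʳ _) ℝ.refl (+-mono-≤ (≤-reflexive ℝ.refl) (0≤x*x (im (1ℂ - w)))))

  -- With τ = (1 + ∣z∣²)/2 one has τ² − ∣z∣² = ((1 − ∣z∣²)/2)².
  radius : ∀ {z} → ∣ z ∣< 1# → ∃[ τ ] (0# < τ × τ < 1# × ∣ z ∣≤ τ)
  radius {z} (_ , z<1) = τ , 0<τ , τ<1 , <⇒≤ 0<τ , z≤τ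
    where
    s = ∣ z ∣²
    s<1 : s < 1#
    s<1 = <-respʳ-≈ (ℝ.*-identityˡ 1#) z<1
    half,_ = reciprocal (0<+0≤ 0<1 (<⇒≤ 0<1))
    h = proj₁ half,_
    2h≈1 : (1# ℝ.+ 1#) ℝ.* h ≈ʳ 1#
    2h≈1 = proj₁ (proj₂ half,_)
    0<h : 0# < h
    0<h = proj₂ (proj₂ half,_)
    τ = (1# ℝ.+ s) ℝ.* h
    0<τ : 0# < τ
    0<τ = ℝ.*-pos (0<+0≤ 0<1 (0≤∣∣² z)) 0<h
    τ<1 : τ < 1#
    τ<1 = 0<-⇒< (<-respʳ-≈ (ℝ.trans (solve 2 (λ s h → (one :- s) :* h := (one :+ one) :* h :- (one :+ s) :* h) ℝ.refl s h) (ℝ.+-congʳ 2h≈1))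
      (ℝ.*-pos (<⇒0<- s<1) 0<h))
    z≤τ : s ≤ τ ℝ.* τ
    z≤τ = 0≤-⇒≤ (≤-resp ℝ.refl
      (ℝ.trans (solve 2 (λ s h → ((one :- s) :* h) :* ((one :- s) :* h) := ((one :+ s) :* h) :* ((one :+ s) :* h) :- ((one :+ one) :* h) :* ((one :+ one) :* h) :* s) ℝ.refl s h)
        (ℝ.+-congˡ (ℝ.-‿cong (ℝ.trans (ℝ.*-congʳ (ℝ.trans (ℝ.*-cong 2h≈1 2h≈1) (ℝ.*-identityˡ 1#))) (ℝ.*-identityˡ s)))))
      (0≤x*x ((1# ℝ.- s) ℝ.* h)))

-- Calculus of uniform estimates O(τ^d).

module Decay {c ℓ₁ ℓ₂ ℓ₃} (ℝ : RealField c ℓ₁ ℓ₂ ℓ₃)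
  (τ : RealField.Carrier ℝ) (0<τ : RealField._<_ ℝ (RealField.0# ℝ) τ) (τ<1 : RealField._<_ ℝ τ (RealField.1# ℝ)) where
  private
    module ℝ = RealField ℝ
  open ℝ using (0#; 1#; _<_) renaming (Carrier to |ℝ|; _≈_ to _≈ʳ_)
  open Complex ℝ using (ℂ; re; im; _+i_; 0ℂ; 1ℂ; ∣_∣²; IsLimit; ∣_∣<_)
  open RealFieldProperties ℝ
  open RealOrder ℝ
  open Geometric τ 0<τ τ<1
  open ComplexBounds ℝ
  open CommutativeRing complexRing hiding (Carrier; zero; 0#; 1#)
  open Sums complexRing
  open RawMonoidOps ℝ.+-rawMonoid using () renaming (_×_ to _·_)
  private
    module S = IntegerCoefficients ℝ.commutativeRing
    module ℂS = IntegerCoefficients complexRing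

  open Exp (CommutativeRing.semiring ℝ.commutativeRing) using () renaming (_^_ to _^ʳ_) public

  private
    variable
      a b : Level
      I : Set a
      J : Set b

  -- f i = O(τ^(d i)), uniformly in i
  infix 4 _≪_
  record _≪_ {a} {I : Set a} (f : I → ℂ) (d : I → ℕ) : Set (a ⊔ c ⊔ ℓ₃) where
    constructor decay
    field
      C     : |ℝ|
      0≤C   : 0# ≤ C
      bound : ∀ i → ∣ f i ∣≤ C ℝ.* τ ^ʳ d i

  ≪-cong : ∀ {f g : I → ℂ} {d} → (∀ i → f i ≈ g i) → f ≪ d → g ≪ d
  ≪-cong f≈g (decay C 0≤C f≤) = decay C 0≤C λ i → ∣∣≤-cong (f≈g i) ℝ.refl (f≤ i)

  ≪-mono : ∀ {f : I → ℂ} {d e} → (∀ i → e i ℕ.≤ d i) → f ≪ d → f ≪ e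
  ≪-mono e≤d (decay C 0≤C f≤) = decay C 0≤C λ i → ∣∣≤-mono (*-monoˡ-≤ 0≤C (τ^-antitone (e≤d i))) (f≤ i)

  ≪-∘ : ∀ {f : I → ℂ} {d} (φ : J → I) → f ≪ d → (f ∘ φ) ≪ (d ∘ φ)
  ≪-∘ φ (decay C 0≤C f≤) = decay C 0≤C λ j → f≤ (φ j)

  ≪-+ : ∀ {f g : I → ℂ} {d} → f ≪ d → g ≪ d → (λ i → f i + g i) ≪ d
  ≪-+ (decay C 0≤C f≤) (decay D 0≤D g≤) = decay (C ℝ.+ D) (0≤x+y 0≤C 0≤D) λ i →
    ∣∣≤-cong refl (ℝ.sym (ℝ.distribʳ _ C D)) (∣+∣≤ (f≤ i) (g≤ i))

  ≪-neg : ∀ {f : I → ℂ} {d} → f ≪ d → (λ i → - f i) ≪ d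
  ≪-neg (decay C 0≤C f≤) = decay C 0≤C λ i → ∣-∣≤ (f≤ i)

  ≪-- : ∀ {f g : I → ℂ} {d} → f ≪ d → g ≪ d → (λ i → f i - g i) ≪ d
  ≪-- f≪d g≪d = ≪-+ f≪d (≪-neg g≪d)

  ≪-* : ∀ {f g : I → ℂ} {d e} → f ≪ d → g ≪ e → (λ i → f i * g i) ≪ (λ i → d i ℕ.+ e i)
  ≪-* {d = d} {e} (decay C 0≤C f≤) (decay D 0≤D g≤) = decay (C ℝ.* D) (0≤x*y 0≤C 0≤D) λ i →
    ∣∣≤-cong refl (ℝ.trans (S.solve 4 (λ C x D y → (C S.:* x) S.:* (D S.:* y) S.:= (C S.:* D) S.:* (x S.:* y)) ℝ.refl C _ D _)
      (ℝ.*-congˡ (ℝ.sym (τ^-+ (d i) (e i))))) (∣*∣≤ (f≤ i) (g≤ i))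

  ≪-zero : ∀ (d : I → ℕ) → (λ _ → 0ℂ) ≪ d
  ≪-zero d = decay 0# (≤-reflexive ℝ.refl) λ i → ∣0∣≤ (0≤x*y (≤-reflexive ℝ.refl) (0≤τ^ (d i)))

  ≪-const : ∀ z → (λ (_ : I) → z) ≪ const 0
  ≪-const z = decay (1# ℝ.+ ∣ z ∣²) (proj₁ (∣∣≤1+∣∣² z)) λ _ → ∣∣≤-cong refl (ℝ.sym (ℝ.*-identityʳ _)) (∣∣≤1+∣∣² z)

  -- For truncated quantities: where `h` stops following `f`, the exponent has dropped to 0 and
  -- boundedness is enough.
  ≪-cases : ∀ {f g h : I → ℂ} {d} → f ≪ d → g ≪ const 0 → (∀ i → h i ≈ f i ⊎ (h i ≈ g i × d i ≡ 0)) → h ≪ d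
  ≪-cases {f = f} {g} {h} {d} (decay C 0≤C f≤) (decay D 0≤D g≤) cases = decay (C ℝ.+ D) (0≤x+y 0≤C 0≤D) bound
    where
    C≤ : C ≤ C ℝ.+ D
    C≤ = ≤-resp (ℝ.+-identityʳ C) ℝ.refl (+-mono-≤ (≤-reflexive ℝ.refl) 0≤D)
    D≤ : D ≤ C ℝ.+ D
    D≤ = ≤-resp (ℝ.+-identityˡ D) ℝ.refl (+-mono-≤ 0≤C (≤-reflexive ℝ.refl))
    bound : ∀ i → ∣ h i ∣≤ (C ℝ.+ D) ℝ.* τ ^ʳ d i
    bound i with cases i
    ... | inj₁ h≈f = ∣∣≤-cong (sym h≈f) ℝ.refl (∣∣≤-mono (*-mono-≤ 0≤C (0≤τ^ (d i)) C≤ (≤-reflexive ℝ.refl)) (f≤ i))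
    ... | inj₂ (h≈g , d≡0) = ∣∣≤-cong (sym h≈g) (ℝ.*-congˡ (ℝ.reflexive (≡.cong (τ ^ʳ_) (≡.sym d≡0))))
      (∣∣≤-mono (*-mono-≤ 0≤D (<⇒≤ 0<1) D≤ (≤-reflexive ℝ.refl)) (g≤ i))

  ≪-*-limit : ∀ {f g : I → ℂ} {x y d} → (λ i → f i - x) ≪ d → (λ i → g i - y) ≪ d → (λ i → f i * g i - x * y) ≪ d
  ≪-*-limit {f = f} {g} {x} {y} f→x g→y = ≪-cong
    (λ i → ℂS.solve 4 (λ f g x y → (f ℂS.:- x) ℂS.:* (g ℂS.:- y) ℂS.:+ (x ℂS.:* (g ℂS.:- y) ℂS.:+ y ℂS.:* (f ℂS.:- x)) ℂS.:= f ℂS.:* g ℂS.:- x ℂS.:* y) refl (f i) (g i) x y)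
    (≪-+ (≪-mono (λ i → ℕ.m≤m+n _ _) (≪-* f→x g→y)) (≪-+ (≪-* (≪-const x) g→y) (≪-* (≪-const y) f→x)))

  -- Summation over j costs the factor K = 1/(1 - τ), uniformly in the length N. The induction
  -- carries the sharper bound K(1 - τ^N), to which adding τ^N gives exactly K(1 - τ^(N+1)).
  ≪-sum : ∀ {f : I → ℕ → ℂ} {d : I → ℕ} →
    (λ ((i , j) : I × ℕ) → f i j) ≪ (λ (i , j) → d i ℕ.+ j) → (λ ((i , N) : I × ℕ) → sum (f i) N) ≪ (λ (i , N) → d i)
  ≪-sum {f = f} {d} (decay C 0≤C f≤) = decay (C ℝ.* K) (0≤x*y 0≤C (<⇒≤ 0<K)) λ (i , N) →
    ∣∣≤-mono (≤-resp ℝ.refl (S.solve 3 (λ C K x → C S.:* x S.:* K S.:= (C S.:* K) S.:* x) ℝ.refl C K (τ ^ʳ d i))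
        (*-monoˡ-≤ (0≤x*y 0≤C (0≤τ^ (d i))) (0≤-⇒≤ (≤-resp ℝ.refl (S.solve 2 (λ K x → K S.:* x S.:= K S.:- K S.:* (S.one S.:- x)) ℝ.refl K (τ ^ʳ N)) (0≤x*y (<⇒≤ 0<K) (0≤τ^ N))))))
      (partial i N)
    where
    0≤1-τ^ : ∀ N → 0# ≤ 1# ℝ.- τ ^ʳ N
    0≤1-τ^ N = ≤⇒0≤- (τ^≤1 N)
    partial : ∀ i N → ∣ sum (f i) N ∣≤ C ℝ.* τ ^ʳ d i ℝ.* (K ℝ.* (1# ℝ.- τ ^ʳ N))
    partial i zero    = ∣0∣≤ (0≤x*y (0≤x*y 0≤C (0≤τ^ (d i))) (0≤x*y (<⇒≤ 0<K) (0≤1-τ^ 0)))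
    partial i (suc N) = ∣∣≤-cong refl
      (ℝ.trans (ℝ.+-congˡ (ℝ.trans (ℝ.*-congˡ (τ^-+ (d i) N)) (ℝ.trans (ℝ.sym (ℝ.*-identityˡ _)) (ℝ.*-congʳ (ℝ.sym [1-τ]*K≈1)))))
        (S.solve 5 (λ C x K y t → C S.:* x S.:* (K S.:* (S.one S.:- y)) S.:+ (S.one S.:- t) S.:* K S.:* (C S.:* (x S.:* y))
           S.:= C S.:* x S.:* (K S.:* (S.one S.:- t S.:* y))) ℝ.refl C (τ ^ʳ d i) K (τ ^ʳ N) τ))
      (∣+∣≤ (partial i N) (f≤ (i , N)))

  -- Πᵢ (1 + C τⁱ) stays bounded: with c = (1 − τ)/2 and C ≤ n c, the partial products are at most
  -- (2 − τ^N)ⁿ, because (2 − τ^N)(1 + c τ^N) ≤ 2 − τ^(N+1) and 1 + n c τ^N ≤ (1 + c τ^N)ⁿ.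
  ≪-product : ∀ {f g : ℕ → ℂ} → g ≪ id → (∀ n → f (suc n) ≈ f n * (1ℂ + g n)) → f ≪ const 0
  ≪-product {f} {g} (decay C 0≤C g≤) f-step = decay B 0≤B λ N →
    ∣∣≤-mono (≤-resp ℝ.refl (ℝ.sym (ℝ.*-identityʳ B)) (*-monoˡ-≤ 0≤f₀ (^-mono (0≤base N) (base≤2 N) n))) (partial N)
    where
    two = 1# ℝ.+ 1#
    0<two : 0# < two
    0<two = 0<+0≤ 0<1 (<⇒≤ 0<1)
    half,_ = reciprocal 0<two
    half = proj₁ half,_
    two*half≈1 : two ℝ.* half ≈ʳ 1#
    two*half≈1 = proj₁ (proj₂ half,_)
    0<half : 0# < half
    0<half = proj₂ (proj₂ half,_)
    s = (1# ℝ.- τ) ℝ.* half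
    0≤s : 0# ≤ s
    0≤s = 0≤x*y (<⇒≤ (<⇒0<- τ<1)) (<⇒≤ 0<half)
    n,_ = ℝ.archimedean (C ℝ.* (K ℝ.* two))
    n = proj₁ n,_
    C≤n*s : C ≤ n · 1# ℝ.* s
    C≤n*s = ≤-resp
      (ℝ.trans (S.solve 5 (λ t h C K w → t S.:* h S.:* (C S.:* (K S.:* w)) S.:= C S.:* ((t S.:* K) S.:* (w S.:* h))) ℝ.refl (1# ℝ.- τ) half C K two)
        (ℝ.trans (ℝ.*-congˡ (ℝ.trans (ℝ.*-cong [1-τ]*K≈1 two*half≈1) (ℝ.*-identityˡ 1#))) (ℝ.*-identityʳ C)))
      (ℝ.*-comm _ _) (*-monoˡ-≤ 0≤s (<⇒≤ (proj₂ n,_)))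
    base : ℕ → |ℝ|
    base N = two ℝ.- τ ^ʳ N
    0≤base : ∀ N → 0# ≤ base N
    0≤base N = ≤-resp ℝ.refl (S.solve 1 (λ x → S.one S.:+ (S.one S.:- x) S.:= (S.one S.:+ S.one) S.:- x) ℝ.refl (τ ^ʳ N))
      (0≤x+y (<⇒≤ 0<1) (≤⇒0≤- (τ^≤1 N)))
    base≤2 : ∀ N → base N ≤ two
    base≤2 N = 0≤-⇒≤ (≤-resp ℝ.refl (S.solve 1 (λ x → x S.:= (S.one S.:+ S.one) S.:- ((S.one S.:+ S.one) S.:- x)) ℝ.refl (τ ^ʳ N)) (0≤τ^ N))
    base-step : ∀ N → base N ℝ.* (1# ℝ.+ s ℝ.* τ ^ʳ N) ≤ base (suc N)
    base-step N = 0≤-⇒≤ (≤-resp ℝ.refl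
      (ℝ.trans (S.solve 4 (λ t h x w → (S.one S.:- t) S.:* h S.:* (x S.:* x) S.:= ((w S.:- x) S.:+ w S.:* h S.:* ((S.one S.:- t) S.:* x)) S.:- (w S.:- x) S.:* (S.one S.:+ (S.one S.:- t) S.:* h S.:* x)) ℝ.refl τ half (τ ^ʳ N) two)
        (ℝ.+-congʳ (ℝ.trans (ℝ.+-congˡ (ℝ.trans (ℝ.*-congʳ two*half≈1) (ℝ.*-identityˡ _)))
          (S.solve 3 (λ t x w → (w S.:- x) S.:+ (S.one S.:- t) S.:* x S.:= w S.:- t S.:* x) ℝ.refl τ (τ ^ʳ N) two))))
      (0≤x*y 0≤s (0≤x*x (τ ^ʳ N))))
    bernoulli : ∀ {x} m → 0# ≤ x → 1# ℝ.+ m · 1# ℝ.* x ≤ (1# ℝ.+ x) ^ʳ m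
    bernoulli {x} zero    0≤x = ≤-reflexive (S.solve 1 (λ x → S.one S.:+ S.nil S.:* x S.:= S.one) ℝ.refl x)
    bernoulli {x} (suc m) 0≤x = ≤-trans
      (0≤-⇒≤ (≤-resp ℝ.refl (S.solve 2 (λ x k → x S.:* (k S.:* x) S.:= (S.one S.:+ x) S.:* (S.one S.:+ k S.:* x) S.:- (S.one S.:+ (S.one S.:+ k) S.:* x)) ℝ.refl x (m · 1#))
        (0≤x*y 0≤x (0≤x*y (0≤n·1 m) 0≤x))))
      (*-monoˡ-≤ (0≤x+y (<⇒≤ 0<1) 0≤x) (bernoulli m 0≤x))
    0≤^ : ∀ {x} m → 0# ≤ x → 0# ≤ x ^ʳ m
    0≤^ zero    0≤x = <⇒≤ 0<1
    0≤^ (suc m) 0≤x = 0≤x*y 0≤x (0≤^ m 0≤x)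
    ^-mono : ∀ {x y} → 0# ≤ x → x ≤ y → ∀ m → x ^ʳ m ≤ y ^ʳ m
    ^-mono 0≤x x≤y zero    = ≤-reflexive ℝ.refl
    ^-mono 0≤x x≤y (suc m) = *-mono-≤ 0≤x (0≤^ m 0≤x) x≤y (^-mono 0≤x x≤y m)
    *-^ : ∀ x y m → (x ℝ.* y) ^ʳ m ≈ʳ x ^ʳ m ℝ.* y ^ʳ m
    *-^ x y zero    = ℝ.sym (ℝ.*-identityˡ 1#)
    *-^ x y (suc m) = ℝ.trans (ℝ.*-congˡ (*-^ x y m))
      (S.solve 4 (λ a b d e → (a S.:* b) S.:* (d S.:* e) S.:= (a S.:* d) S.:* (b S.:* e)) ℝ.refl _ _ _ _)
    f₀ = 1# ℝ.+ ∣ f 0 ∣²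
    0≤f₀ = proj₁ (∣∣≤1+∣∣² (f 0))
    B = f₀ ℝ.* two ^ʳ n
    0≤B : 0# ≤ B
    0≤B = 0≤x*y 0≤f₀ (0≤^ n (<⇒≤ 0<two))
    one^ : ∀ m → 1# ≤ base 0 ^ʳ m
    one^ zero    = ≤-reflexive ℝ.refl
    one^ (suc m) = ≤-resp (ℝ.*-identityˡ 1#) ℝ.refl
      (*-mono-≤ (<⇒≤ 0<1) (<⇒≤ 0<1) (≤-reflexive (S.solve 0 (S.one S.:= (S.one S.:+ S.one) S.:- S.one) ℝ.refl)) (one^ m))
    partial : ∀ N → ∣ f N ∣≤ f₀ ℝ.* base N ^ʳ n
    partial zero    = ∣∣≤-mono (≤-resp (ℝ.*-identityʳ f₀) ℝ.refl (*-monoˡ-≤ 0≤f₀ (one^ n))) (∣∣≤1+∣∣² (f 0))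
    partial (suc N) = ∣∣≤-mono
      (≤-resp (ℝ.sym (ℝ.*-assoc _ _ _)) ℝ.refl (*-monoˡ-≤ 0≤f₀
        (≤-trans (*-monoˡ-≤ (0≤^ n (0≤base N)) factor≤)
          (≤-resp (*-^ _ _ n) ℝ.refl (^-mono (0≤x*y (0≤base N) (0≤x+y (<⇒≤ 0<1) (0≤x*y 0≤s (0≤τ^ N)))) (base-step N) n)))))
      (∣∣≤-cong (sym (f-step N)) ℝ.refl (∣*∣≤ (partial N) (∣+∣≤ ∣1∣≤1 (g≤ N))))
      where
      factor≤ : 1# ℝ.+ C ℝ.* τ ^ʳ N ≤ (1# ℝ.+ s ℝ.* τ ^ʳ N) ^ʳ n
      factor≤ = ≤-trans (+-mono-≤ (≤-reflexive ℝ.refl) (≤-resp ℝ.refl (ℝ.*-assoc _ _ _) (*-mono-≤ 0≤C (0≤τ^ N) C≤n*s (≤-reflexive ℝ.refl))))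
        (bernoulli n (0≤x*y 0≤s (0≤τ^ N)))

  ≪⇒IsLimit : ∀ {f : ℕ → ℂ} {z} → (λ n → f n - z) ≪ id → IsLimit f z
  ≪⇒IsLimit (decay C 0≤C f≤) ε 0<ε = proj₁ small , λ n N≤n → ∣∣≤∧<⇒∣∣< (f≤ n) (proj₂ small n N≤n)
    where small = C*τ^n→0 C 0≤C ε 0<ε

  -- A positive real cannot lie below C τ^N for every N. Applied to plus and minus each coordinate
  -- this excludes apartness from 0, and tightness concludes.
  ≪⇒≈0 : ∀ {z} → (λ (_ : ℕ) → z) ≪ id → z ≈ 0ℂ
  ≪⇒≈0 {z} (decay C 0≤C z≤) =
    component re (λ N → re≤ (z≤ N)) (λ N → re≤ (∣-∣≤ (z≤ N))) ,
    component im (λ N → im≤ (z≤ N)) (λ N → im≤ (∣-∣≤ (z≤ N)))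
    where
    component : (π : ℂ → |ℝ|) → (∀ N → π z ≤ C ℝ.* τ ^ʳ N) → (∀ N → ℝ.- π z ≤ C ℝ.* τ ^ʳ N) → π z ≈ʳ 0#
    component π π≤ -π≤ = proj₁ (ℝ.tight _ _) (apart ∘ Equivalence.to ℝ.#⇔<⊎>)
      where
      absurd : ∀ {x} → (∀ N → x ≤ C ℝ.* τ ^ʳ N) → ¬ (0# < x)
      absurd {x} x≤ 0<x = x≤ (proj₁ small) (proj₂ small (proj₁ small) ℕ.≤-refl)
        where small = C*τ^n→0 C 0≤C x 0<x
      apart : ¬ (π z < 0# ⊎ 0# < π z)
      apart (inj₁ πz<0) = absurd -π≤ (<0⇒0<- πz<0)
      apart (inj₂ 0<πz) = absurd π≤ 0<πz

  -- The rate survives the passage to the limit. `f n` is compared with `f m` for m so late that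
  -- both coordinates of `f m - z` are below τⁿ; these two coordinates account for the constant 2.
  ≪⇒converges : ∀ {f : ℕ → ℂ} → (λ n → f (suc n) - f n) ≪ id → ∃[ z ] (λ n → f n - z) ≪ id
  ≪⇒converges {f} Δ≪ = z , decay (C′ ℝ.+ two) (0≤x+y 0≤C′ 0≤two) bound
    where
    two = 1# ℝ.+ 1#
    0≤two : 0# ≤ two
    0≤two = 0≤x+y (<⇒≤ 0<1) (<⇒≤ 0<1)
    telescope : ∀ n k → sum (λ j → f (suc (n ℕ.+ j)) - f (n ℕ.+ j)) k ≈ f (n ℕ.+ k) - f n
    telescope n zero    = trans (sym (-‿inverseʳ (f n))) (+-congʳ (reflexive (≡.cong f (≡.sym (ℕ.+-identityʳ n)))))
    telescope n (suc k) = trans (+-congʳ (telescope n k)) (trans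
      (ℂS.solve 3 (λ a b d → (a ℂS.:- b) ℂS.:+ (d ℂS.:- a) ℂS.:= d ℂS.:- b) refl (f (n ℕ.+ k)) (f n) (f (suc (n ℕ.+ k))))
      (+-congʳ (reflexive (≡.cong f (≡.sym (ℕ.+-suc n k))))))
    tail≪ : (λ ((n , k) : ℕ × ℕ) → f (n ℕ.+ k) - f n) ≪ proj₁
    tail≪ = ≪-cong (λ (n , k) → telescope n k) (≪-sum (≪-∘ (λ (n , j) → n ℕ.+ j) Δ≪))
    diff≪ : (λ ((n , k , l) : ℕ × ℕ × ℕ) → f (n ℕ.+ k) - f (n ℕ.+ l)) ≪ proj₁
    diff≪ = ≪-cong (λ (n , k , l) → ℂS.solve 3 (λ a b d → (a ℂS.:- b) ℂS.:- (d ℂS.:- b) ℂS.:= a ℂS.:- d) refl (f (n ℕ.+ k)) (f n) (f (n ℕ.+ l)))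
      (≪-- (≪-∘ (λ (n , k , l) → n , k) tail≪) (≪-∘ (λ (n , k , l) → n , l) tail≪))
    C′ = _≪_.C diff≪
    0≤C′ = _≪_.0≤C diff≪
    diff≤ : ∀ {N m n} → N ℕ.≤ m → N ℕ.≤ n → ∣ f m - f n ∣≤ C′ ℝ.* τ ^ʳ N
    diff≤ N≤m N≤n with ℕ.m≤n⇒∃[o]m+o≡n N≤m | ℕ.m≤n⇒∃[o]m+o≡n N≤n
    ... | k , ≡.refl | l , ≡.refl = _≪_.bound diff≪ (_ , k , l)
    cauchy : (π : ℂ → |ℝ|) → (∀ {N m n} → N ℕ.≤ m → N ℕ.≤ n → π (f m) ℝ.- π (f n) ≤ C′ ℝ.* τ ^ʳ N) → ℝ.IsCauchy (π ∘ f)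
    cauchy π π≤ ε 0<ε = N , λ m n N≤m N≤n → above m n N≤m N≤n , below m n N≤m N≤n
      where
      small = C*τ^n→0 C′ 0≤C′ ε 0<ε
      N = proj₁ small
      below : ∀ m n → N ℕ.≤ m → N ℕ.≤ n → π (f m) ℝ.- π (f n) < ε
      below m n N≤m N≤n = ≤-<-trans (π≤ N≤m N≤n) (proj₂ small N ℕ.≤-refl)
      above : ∀ m n → N ℕ.≤ m → N ℕ.≤ n → ℝ.- ε < π (f m) ℝ.- π (f n)
      above m n N≤m N≤n = 0<-⇒< (<-respʳ-≈ (S.solve 3 (λ e x y → e S.:- (y S.:- x) S.:= (x S.:- y) S.:- S.:- e) ℝ.refl ε (π (f m)) (π (f n))) (<⇒0<- (below n m N≤n N≤m)))
    x,_ = ℝ.complete (re ∘ f) (cauchy re (λ N≤m N≤n → re≤ (diff≤ N≤m N≤n)))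
    y,_ = ℝ.complete (im ∘ f) (cauchy im (λ N≤m N≤n → im≤ (diff≤ N≤m N≤n)))
    z = proj₁ x,_ +i proj₁ y,_
    bound : ∀ n → ∣ f n - z ∣≤ (C′ ℝ.+ two) ℝ.* τ ^ʳ n
    bound n = ∣∣≤-cong
      (ℂS.solve 3 (λ a b d → (a ℂS.:- b) ℂS.:+ (b ℂS.:- d) ℂS.:= a ℂS.:- d) refl (f n) (f m) z)
      (S.solve 2 (λ C x → C S.:* x S.:+ (x S.:+ x) S.:= (C S.:+ (S.one S.:+ S.one)) S.:* x) ℝ.refl C′ (τ ^ʳ n))
      (∣+∣≤ (diff≤ ℕ.≤-refl (ℕ.m≤m+n n _)) (components⇒∣∣≤ {f m - z} (0<τ^ n) (proj₁ near-x) (proj₂ near-x) (proj₁ near-y) (proj₂ near-y)))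
      where
      close-x = proj₂ x,_ (τ ^ʳ n) (0<τ^ n)
      close-y = proj₂ y,_ (τ ^ʳ n) (0<τ^ n)
      N₁ = proj₁ close-x
      N₂ = proj₁ close-y
      m = n ℕ.+ (N₁ ℕ.+ N₂)
      near-x = proj₂ close-x m (ℕ.≤-trans (ℕ.m≤m+n N₁ N₂) (ℕ.m≤n+m _ n))
      near-y = proj₂ close-y m (ℕ.≤-trans (ℕ.m≤n+m N₂ N₁) (ℕ.m≤n+m _ n))

-- Unconditional summation over ℕ³.

module Summation {c ℓ₁ ℓ₂ ℓ₃} (ℝ : RealField c ℓ₁ ℓ₂ ℓ₃)
  (τ : RealField.Carrier ℝ) (0<τ : RealField._<_ ℝ (RealField.0# ℝ) τ) (τ<1 : RealField._<_ ℝ τ (RealField.1# ℝ)) where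
  private
    module ℝ = RealField ℝ
  open Complex ℝ using (ℂ; 0ℂ; 1ℂ; HasSum)
  open RealOrder ℝ
  open Geometric τ 0<τ τ<1
  open ComplexBounds ℝ
  open CommutativeRing complexRing hiding (Carrier; zero; 0#; 1#)
  open Sums complexRing
  open Decay ℝ τ 0<τ τ<1
  open IntegerCoefficients complexRing
  open SetoidReasoning setoid

  private
    variable
      a : Level
      I : Set a

  ℕ³ : Set
  ℕ³ = ℕ × ℕ × ℕ

  box : (ℕ³ → ℂ) → ℕ → ℂ
  box f N = sum (λ m → sum (λ k → sum (λ n → f (m , k , n)) N) N) N

  box-cong-< : ∀ {f g : ℕ³ → ℂ} N → (∀ m k n → m ℕ.< N → k ℕ.< N → n ℕ.< N → f (m , k , n) ≈ g (m , k , n)) → box f N ≈ box g N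
  box-cong-< N f≈g = sum-cong-< N (λ m m<N → sum-cong-< N (λ k k<N → sum-cong-< N (λ n n<N → f≈g m k n m<N k<N n<N)))

  box-cong : ∀ {f g : ℕ³ → ℂ} N → (∀ x → f x ≈ g x) → box f N ≈ box g N
  box-cong N f≈g = box-cong-< N (λ m k n _ _ _ → f≈g (m , k , n))

  box-+ : ∀ f g N → box (λ x → f x + g x) N ≈ box f N + box g N
  box-+ f g N = trans (sum-cong N (λ m → trans (sum-cong N (λ k → sum-+ _ _ N)) (sum-+ _ _ N))) (sum-+ _ _ N)

  box-- : ∀ f g N → box (λ x → f x - g x) N ≈ box f N - box g N
  box-- f g N = trans (sum-cong N (λ m → trans (sum-cong N (λ k → sum-- _ _ N)) (sum-- _ _ N))) (sum-- _ _ N)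

  ∣_∣₁ : ℕ³ → ℕ
  ∣ m , k , n ∣₁ = m ℕ.+ k ℕ.+ n

  ≪-box : ∀ {f : I → ℕ³ → ℂ} {d : I → ℕ} →
    (λ ((i , x) : I × ℕ³) → f i x) ≪ (λ (i , x) → d i ℕ.+ ∣ x ∣₁) → (λ ((i , N) : I × ℕ) → box (f i) N) ≪ (λ (i , N) → d i)
  ≪-box {I = I} {f} {d} f≪ = ≪-∘ (λ (i , N) → (i , N) , N) sum-m
    where
    sum-n : (λ (((i , m , k) , N) : (I × ℕ × ℕ) × ℕ) → sum (λ n → f i (m , k , n)) N) ≪ (λ ((i , m , k) , N) → d i ℕ.+ m ℕ.+ k)
    sum-n = ≪-sum (≪-mono (λ ((i , m , k) , n) → ℕ.≤-reflexive (≡.trans (≡.cong (ℕ._+ n) (ℕ.+-assoc (d i) m k)) (ℕ.+-assoc (d i) (m ℕ.+ k) n)))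
      (≪-∘ (λ ((i , m , k) , n) → i , m , k , n) f≪))
    sum-k : (λ (((i , N , m) , M) : (I × ℕ × ℕ) × ℕ) → sum (λ k → sum (λ n → f i (m , k , n)) N) M) ≪ (λ ((i , N , m) , M) → d i ℕ.+ m)
    sum-k = ≪-sum (≪-∘ (λ ((i , N , m) , k) → (i , m , k) , N) sum-n)
    sum-m : (λ (((i , N) , M) : (I × ℕ) × ℕ) → sum (λ m → sum (λ k → sum (λ n → f i (m , k , n)) N) N) M) ≪ (λ ((i , N) , M) → d i)
    sum-m = ≪-sum (≪-∘ (λ ((i , N) , m) → (i , N , m) , N) sum-k)

  δ : ℕ → ℕ → ℂ
  δ zero    zero    = 1ℂ
  δ zero    (suc n) = 0ℂ
  δ (suc m) zero    = 0ℂ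
  δ (suc m) (suc n) = δ m n

  δ-refl : ∀ m → δ m m ≡ 1ℂ
  δ-refl zero    = ≡.refl
  δ-refl (suc m) = δ-refl m

  δ-≢ : ∀ {m n} → m ≢ n → δ m n ≡ 0ℂ
  δ-≢ {zero}  {zero}  m≢n = ⊥-elim (m≢n ≡.refl)
  δ-≢ {zero}  {suc n} m≢n = ≡.refl
  δ-≢ {suc m} {zero}  m≢n = ≡.refl
  δ-≢ {suc m} {suc n} m≢n = δ-≢ (m≢n ∘ ≡.cong suc)

  sum-δ : ∀ (f : ℕ → ℂ) {m N} → m ℕ.< N → sum (λ n → δ m n * f n) N ≈ f m
  sum-δ f {m} {N} m<N = begin
    sum (λ n → δ m n * f n) N
      ≈⟨ sum-extend _ m<N (λ n m<n → vanish (ℕ.<⇒≢ m<n)) ⟩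
    sum (λ n → δ m n * f n) m + δ m m * f m
      ≈⟨ +-cong (sum-≈0 m (λ n n<m → vanish (ℕ.<⇒≢ n<m ∘ ≡.sym))) (trans (*-congʳ (reflexive (δ-refl m))) (*-identityˡ _)) ⟩
    0ℂ + f m
      ≈⟨ +-identityˡ _ ⟩
    f m ∎
    where
    vanish : ∀ {n} → m ≢ n → δ m n * f n ≈ 0ℂ
    vanish m≢n = trans (*-congʳ (reflexive (δ-≢ m≢n))) (zeroˡ _)

  δ³ : ℕ³ → ℕ³ → ℂ
  δ³ (a , b , d) (m , k , n) = δ a m * (δ b k * δ d n)

  _≟³_ : DecidableEquality ℕ³
  _≟³_ = ≡-dec ℕ._≟_ (≡-dec ℕ._≟_ ℕ._≟_)

  open DecMembership _≟³_ using (_∈?_)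

  δ³-refl : ∀ x → δ³ x x ≈ 1ℂ
  δ³-refl (m , k , n) = trans (*-cong (reflexive (δ-refl m)) (trans (*-cong (reflexive (δ-refl k)) (reflexive (δ-refl n))) (*-identityˡ 1ℂ))) (*-identityˡ 1ℂ)

  δ³-≢ : ∀ {x y} → x ≢ y → δ³ x y ≈ 0ℂ
  δ³-≢ {a , b , d} {m , k , n} x≢y with a ℕ.≟ m | b ℕ.≟ k | d ℕ.≟ n
  ... | no a≢m     | _          | _          = trans (*-congʳ (reflexive (δ-≢ a≢m))) (zeroˡ _)
  ... | yes _      | no b≢k     | _          = trans (*-congˡ (trans (*-congʳ (reflexive (δ-≢ b≢k))) (zeroˡ _))) (zeroʳ _)
  ... | yes _      | yes _      | no d≢n     = trans (*-congˡ (trans (*-congˡ (reflexive (δ-≢ d≢n))) (zeroʳ _))) (zeroʳ _)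
  ... | yes ≡.refl | yes ≡.refl | yes ≡.refl = ⊥-elim (x≢y ≡.refl)

  box-δ³ : ∀ (f : ℕ³ → ℂ) a b d {N} → a ℕ.< N → b ℕ.< N → d ℕ.< N → box (λ x → δ³ (a , b , d) x * f x) N ≈ f (a , b , d)
  box-δ³ f a b d {N} a<N b<N d<N = begin
    box (λ x → δ³ (a , b , d) x * f x) N
      ≈⟨ sum-cong N (λ m → trans (sum-cong N (λ k → trans (sum-cong N (λ n → solve 4 (λ a b d f → a :* (b :* d) :* f := a :* (b :* (d :* f))) refl _ _ _ _))
           (trans (sum-*ˡ (δ a m) _ N) (*-congˡ (sum-*ˡ (δ b k) _ N))))) (sum-*ˡ (δ a m) _ N)) ⟩
    sum (λ m → δ a m * sum (λ k → δ b k * sum (λ n → δ d n * f (m , k , n)) N) N) N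
      ≈⟨ sum-δ _ a<N ⟩
    sum (λ k → δ b k * sum (λ n → δ d n * f (a , k , n)) N) N
      ≈⟨ sum-δ _ b<N ⟩
    sum (λ n → δ d n * f (a , b , n)) N
      ≈⟨ sum-δ _ d<N ⟩
    f (a , b , d) ∎

  -- The multiplicity of a point in a list.
  χ : List ℕ³ → ℕ³ → ℂ
  χ []      y = 0ℂ
  χ (x ∷ F) y = δ³ x y + χ F y

  χ-∉ : ∀ {F y} → y ∉ F → χ F y ≈ 0ℂ
  χ-∉ {[]}    y∉F = refl
  χ-∉ {x ∷ F} y∉F = trans (+-cong (δ³-≢ (λ x≡y → y∉F (here (≡.sym x≡y)))) (χ-∉ (y∉F ∘ there))) (+-identityʳ 0ℂ)

  χ-∈ : ∀ {F y} → Unique F → y ∈ F → χ F y ≈ 1ℂ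
  χ-∈ {y = y} (x∉F ∷ _) (here ≡.refl) = trans (+-cong (δ³-refl y) (χ-∉ (All¬⇒¬Any x∉F))) (+-identityʳ 1ℂ)
  χ-∈ (x∉F ∷ u) (there y∈F) = trans (+-cong (δ³-≢ (All.lookup x∉F y∈F)) (χ-∈ u y∈F)) (+-identityˡ 1ℂ)

  InBox : ℕ → ℕ³ → Set
  InBox N (m , k , n) = m ℕ.< N × k ℕ.< N × n ℕ.< N

  -- A list sum becomes a box sum with weight `χ F`. Comparing it with the full box sum then means
  -- comparing `χ F` with 1, to which `≪-box` applies.
  foldr≈box : ∀ (f : ℕ³ → ℂ) F N → All (InBox N) F → foldr _+_ 0ℂ (map f F) ≈ box (λ x → χ F x * f x) N
  foldr≈box f []      N []                      = sym (sum-≈0 N (λ m _ → sum-≈0 N (λ k _ → sum-≈0 N (λ n _ → zeroˡ _))))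
  foldr≈box f ((a , b , d) ∷ F) N ((a< , b< , d<) ∷ F<N) = begin
    f (a , b , d) + foldr _+_ 0ℂ (map f F)
      ≈⟨ +-cong (sym (box-δ³ f a b d a< b< d<)) (foldr≈box f F N F<N) ⟩
    box (λ x → δ³ (a , b , d) x * f x) N + box (λ x → χ F x * f x) N
      ≈⟨ box-+ _ _ N ⟨
    box (λ x → δ³ (a , b , d) x * f x + χ F x * f x) N
      ≈⟨ box-cong N (λ x → sym (distribʳ _ _ _)) ⟩
    box (λ x → χ ((a , b , d) ∷ F) x * f x) N ∎

  InBox-mono : ∀ {M N} → M ℕ.≤ N → ∀ {x} → InBox M x → InBox N x
  InBox-mono M≤N (m< , k< , n<) = ℕ.<-≤-trans m< M≤N , ℕ.<-≤-trans k< M≤N , ℕ.<-≤-trans n< M≤N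

  ∣∣₁<⇒InBox : ∀ {N x} → ∣ x ∣₁ ℕ.< N → InBox N x
  ∣∣₁<⇒InBox {x = m , k , n} x<N =
    ℕ.≤-<-trans (ℕ.≤-trans (ℕ.m≤m+n m k) (ℕ.m≤m+n _ n)) x<N ,
    ℕ.≤-<-trans (ℕ.≤-trans (ℕ.m≤n+m k m) (ℕ.m≤m+n _ n)) x<N ,
    ℕ.≤-<-trans (ℕ.m≤n+m n _) x<N

  enclosing : ∀ F → ∃[ N ] All (InBox N) F
  enclosing []                = 0 , []
  enclosing ((m , k , n) ∷ F) with enclosing F
  ... | N , F<N = suc (m ℕ.+ k ℕ.+ n) ℕ.+ N ,
    ∣∣₁<⇒InBox (s≤s (ℕ.m≤m+n _ N)) ∷ All.map (InBox-mono (ℕ.m≤n+m N _)) F<N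

  -- A list squeezed between two boxes, used as index of `_≪_`: the constant is then the same for
  -- all lists and is known before the finite set F₀ is chosen. `M` leaves room for lists of any
  -- extent.
  record Between : Set where
    field
      N M    : ℕ
      F      : List ℕ³
      unique : Unique F
      inner  : ∀ {x} → InBox N x → x ∈ F
      outer  : All (InBox (suc (N ℕ.+ M))) F

  private
    -- The multiplicity is 1 on F. A point outside F lies outside the inner box, hence has ∣x∣₁ ≥ N
    -- and exponent 0.
    χ-1≪ : (λ ((F , x) : Between × ℕ³) → χ (Between.F F) x - 1ℂ) ≪ (λ (F , x) → Between.N F ∸ ∣ x ∣₁)
    χ-1≪ = ≪-cases (≪-zero _) (≪-neg (≪-const 1ℂ)) cases
      where
      cases : ∀ ((F , x) : Between × ℕ³) → χ (Between.F F) x - 1ℂ ≈ 0ℂ ⊎ (χ (Between.F F) x - 1ℂ ≈ - 1ℂ × Between.N F ∸ ∣ x ∣₁ ≡ 0)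
      cases (F , x) with x ∈? Between.F F
      ... | yes x∈F = inj₁ (trans (+-congʳ (χ-∈ (Between.unique F) x∈F)) (-‿inverseʳ 1ℂ))
      ... | no  x∉F = inj₂ (trans (+-congʳ (χ-∉ x∉F)) (+-identityˡ _) , ℕ.m≤n⇒m∸n≡0 N≤∣x∣)
        where
        N≤∣x∣ : Between.N F ℕ.≤ ∣ x ∣₁
        N≤∣x∣ with Between.N F ℕ.≤? ∣ x ∣₁
        ... | yes N≤ = N≤
        ... | no  N≰ = ⊥-elim (x∉F (Between.inner F (∣∣₁<⇒InBox (ℕ.≰⇒> N≰))))

  -- The decay in ∣x∣₁ is used twice: (N ∸ ∣x∣₁) + ∣x∣₁ ≥ N turns the error of the multiplicity into
  -- O(τ^N), and the second ∣x∣₁ makes this summable over a box of any size.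
  hasSum : ∀ (f : ℕ³ → ℂ) s → f ≪ (λ x → ∣ x ∣₁ ℕ.+ ∣ x ∣₁) → (λ N → box f (suc N) - s) ≪ id → HasSum f s
  hasSum f s f≪ box≪ ε 0<ε = F₀ , λ F unique F₀⊆F →
    let outer,_ = enclosing F
        between = record
          { N      = N
          ; M      = proj₁ outer,_
          ; F      = F
          ; unique = unique
          ; inner  = λ (m< , k< , n<) → F₀⊆F (∈-cartesianProduct⁺ (∈-upTo⁺ m<) (∈-cartesianProduct⁺ (∈-upTo⁺ k<) (∈-upTo⁺ n<)))
          ; outer  = All.map (InBox-mono (ℕ.m≤n⇒m≤1+n (ℕ.m≤n+m _ N))) (proj₂ outer,_)
          }
    in ∣∣≤∧<⇒∣∣< (_≪_.bound total between) (proj₂ small N ℕ.≤-refl)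
    where
    size : Between → ℕ
    size B = suc (Between.N B ℕ.+ Between.M B)
    difference : (λ (B : Between) → box (λ x → (χ (Between.F B) x - 1ℂ) * f x) (size B)) ≪ Between.N
    difference = ≪-∘ (λ B → B , size B) (≪-box
      (≪-mono (λ (B , x) → ℕ.≤-trans (ℕ.+-monoˡ-≤ ∣ x ∣₁ (ℕ.m≤n+m∸n (Between.N B) ∣ x ∣₁))
          (ℕ.≤-reflexive (≡.trans (≡.cong (ℕ._+ ∣ x ∣₁) (ℕ.+-comm ∣ x ∣₁ (Between.N B ∸ ∣ x ∣₁))) (ℕ.+-assoc (Between.N B ∸ ∣ x ∣₁) ∣ x ∣₁ ∣ x ∣₁))))
        (≪-* χ-1≪ (≪-∘ proj₂ f≪))))
    total : (λ (B : Between) → foldr _+_ 0ℂ (map f (Between.F B)) - s) ≪ Between.N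
    total = ≪-cong split (≪-+ difference (≪-mono (λ B → ℕ.m≤m+n _ _) (≪-∘ (λ B → Between.N B ℕ.+ Between.M B) box≪)))
      where
      split : ∀ B → box (λ x → (χ (Between.F B) x - 1ℂ) * f x) (size B) + (box f (size B) - s)
        ≈ foldr _+_ 0ℂ (map f (Between.F B)) - s
      split B = begin
        box (λ x → (χ F x - 1ℂ) * f x) S + (box f S - s)
          ≈⟨ +-congʳ (trans (box-cong S (λ x → solve 2 (λ a b → (a :- one) :* b := a :* b :- b) refl (χ F x) (f x))) (box-- (λ x → χ F x * f x) f S)) ⟩
        (box (λ x → χ F x * f x) S - box f S) + (box f S - s)
          ≈⟨ solve 3 (λ a b d → (a :- b) :+ (b :- d) := a :- d) refl _ _ s ⟩
        box (λ x → χ F x * f x) S - s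
          ≈⟨ +-congʳ (foldr≈box f F S (Between.outer B)) ⟨
        foldr _+_ 0ℂ (map f F) - s ∎
        where
        F = Between.F B
        S = size B
    small = C*τ^n→0 (_≪_.C total) (_≪_.0≤C total) ε 0<ε
    N = proj₁ small
    F₀ : List ℕ³
    F₀ = cartesianProduct (upTo N) (cartesianProduct (upTo N) (upTo N))

-- Limits of (q)ₙ, of 1/(q)ₙ and of Gaussian binomials.

module QAnalysis {c ℓ₁ ℓ₂ ℓ₃} (ℝ : RealField c ℓ₁ ℓ₂ ℓ₃)
  (τ : RealField.Carrier ℝ) (0<τ : RealField._<_ ℝ (RealField.0# ℝ) τ) (τ<1 : RealField._<_ ℝ τ (RealField.1# ℝ))
  (q : Complex.ℂ ℝ) (∣q∣<1 : Complex.∣_∣<_ ℝ q (RealField.1# ℝ)) (q≤τ : ComplexBounds.∣_∣≤_ ℝ q τ) where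
  private
    module ℝ = RealField ℝ
  open Complex ℝ using (ℂ; 0ℂ; 1ℂ; pochhammer; qfac; qfac≠0; 1/qfac; qbinomial)
  open RealFieldProperties ℝ using (0<1)
  open RealOrder ℝ
  open Geometric τ 0<τ τ<1
  open ComplexBounds ℝ
  open CommutativeRing complexRing hiding (Carrier; zero; 0#; 1#)
  open Sums complexRing
  open Decay ℝ τ 0<τ τ<1
  open IntegerCoefficients complexRing
  open QSeries complexRing q public
  open SetoidReasoning setoid

  p≈qfac : ∀ n → p n ≈ qfac q ∣q∣<1 n
  p≈qfac zero    = refl
  p≈qfac (suc n) = *-congʳ (p≈qfac n)

  abstract
    u : ℕ → ℂ
    u = 1/qfac q ∣q∣<1

    u≡1/qfac : ∀ n → u n ≡ 1/qfac q ∣q∣<1 n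
    u≡1/qfac n = ≡.refl

    p*u : ∀ n → p n * u n ≈ 1ℂ
    p*u n = trans (*-congʳ (p≈qfac n)) (*-inverse (qfac q ∣q∣<1 n) (qfac≠0 q ∣q∣<1 n))

  open Reciprocal u p*u public
  open Bailey complexRing q u p*u public

  q^≤ : ∀ n → ∣ q ^ n ∣≤ τ ^ʳ n
  q^≤ zero    = ∣1∣≤1
  q^≤ (suc n) = ∣*∣≤ q≤τ (q^≤ n)

  q^≪ : (λ n → q ^ n) ≪ id
  q^≪ = decay ℝ.1# (<⇒≤ 0<1) (λ n → ∣∣≤-cong refl (ℝ.sym (ℝ.*-identityˡ _)) (q^≤ n))

  private
    product-limit : ∀ {f g : ℕ → ℂ} → g ≪ id → (∀ n → f (suc n) ≈ f n * (1ℂ + g n)) → ∃[ z ] (λ n → f n - z) ≪ id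
    product-limit {f} {g} g≪ f-step = ≪⇒converges (≪-cong
      (λ n → trans (solve 2 (λ f g → f :* g := f :* (one :+ g) :- f) refl (f n) (g n)) (+-congʳ (sym (f-step n))))
      (≪-* (≪-product g≪ f-step) g≪))

  abstract
    pochhammer-limit : ∀ a → ∃[ z ] (λ n → pochhammer a q n - z) ≪ id
    pochhammer-limit a = product-limit {g = λ n → - (a * q ^ n)} (≪-neg (≪-* (≪-const a) q^≪)) (λ n → refl)

  private
    -- 1/(1 - q^(n+1)), as the quotient of (q)ₙ by (q)ₙ₊₁.
    v : ℕ → ℂ
    v n = u (suc n) * p n

    [1-q^n]*v : ∀ n → (1ℂ - q ^ suc n) * v n ≈ 1ℂ
    [1-q^n]*v n = trans (solve 3 (λ x u p → x :* (u :* p) := p :* x :* u) refl _ _ _) (p*u (suc n))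

    v≪ : v ≪ const 0
    v≪ = decay K (<⇒≤ 0<K) (λ n → ∣∣≤-cong refl (ℝ.sym (ℝ.*-identityʳ K)) (∣1-w∣-inverse
      (∣∣≤-mono (≤-resp ℝ.refl (ℝ.*-identityʳ τ) (τ^-antitone {1} {suc n} (s≤s z≤n))) (q^≤ (suc n))) τ<1 [1-τ]*K≈1 0<K ([1-q^n]*v n)))

    abstract
      -- 1/(q)ₙ is itself a product, with factors 1 + q^(n+1)/(1 - q^(n+1)), so the criterion used
      -- for (q)ₙ applies again. This takes the place of a lower bound for ∣(q)_∞∣.
      u-limit : ∃[ z ] (λ n → u n - z) ≪ id
      u-limit = product-limit {g = λ n → v n * q ^ suc n} (≪-* v≪ (≪-mono ℕ.n≤1+n (≪-∘ suc q^≪))) u-factor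
        where
        u-factor : ∀ n → u (suc n) ≈ u n * (1ℂ + v n * q ^ suc n)
        u-factor n = sym (begin
          u n * (1ℂ + v n * q ^ suc n)
            ≈⟨ *-congˡ (+-congʳ (sym ([1-q^n]*v n))) ⟩
          u n * ((1ℂ - q ^ suc n) * v n + v n * q ^ suc n)
            ≈⟨ solve 4 (λ u x w p → u :* ((one :- x) :* (w :* p) :+ (w :* p) :* x) := (p :* u) :* w) refl _ _ _ _ ⟩
          p n * u n * u (suc n)
            ≈⟨ trans (*-congʳ (p*u n)) (*-identityˡ _) ⟩
          u (suc n) ∎)

  p∞ u∞ : ℂ
  p∞ = proj₁ (pochhammer-limit q)
  u∞ = proj₁ u-limit

  p→p∞ : (λ n → p n - p∞) ≪ id
  p→p∞ = ≪-cong (λ n → +-congʳ (sym (p≈qfac n))) (proj₂ (pochhammer-limit q))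

  u→u∞ : (λ n → u n - u∞) ≪ id
  u→u∞ = proj₂ u-limit

  -- `p n * u n` is constantly 1 and tends to `p∞ * u∞`, so the difference of the two is a constant
  -- that is O(τⁿ).
  p∞*u∞≈1 : p∞ * u∞ ≈ 1ℂ
  p∞*u∞≈1 = begin
    p∞ * u∞                        ≈⟨ solve 1 (λ x → x := one :- (one :- x)) refl (p∞ * u∞) ⟩
    1ℂ - (1ℂ - p∞ * u∞)            ≈⟨ +-congˡ (-‿cong (≪⇒≈0 (≪-cong (λ n → +-congʳ (p*u n)) (≪-*-limit p→p∞ u→u∞)))) ⟩
    1ℂ - 0ℂ                        ≈⟨ solve 0 (one :- nil := one) refl ⟩
    1ℂ                             ∎

  u-bounded : u ≪ const 0
  u-bounded = ≪-cong (λ n → solve 2 (λ a b → (a :- b) :+ b := a) refl (u n) u∞) (≪-+ (≪-mono (λ _ → z≤n) u→u∞) (≪-const u∞))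

  p-bounded : p ≪ const 0
  p-bounded = ≪-cong (λ n → solve 2 (λ a b → (a :- b) :+ b := a) refl (p n) p∞) (≪-+ (≪-mono (λ _ → z≤n) p→p∞) (≪-const p∞))

  u∸→u∞ : (λ ((n , m) : ℕ × ℕ) → u∸ n m - u∞) ≪ (λ (n , m) → n ∸ m)
  u∸→u∞ = ≪-cases (≪-∘ (λ (n , m) → n ∸ m) u→u∞) (≪-neg (≪-const u∞)) cases
    where
    cases : ∀ ((n , m) : ℕ × ℕ) → u∸ n m - u∞ ≈ u (n ∸ m) - u∞ ⊎ (u∸ n m - u∞ ≈ - u∞ × n ∸ m ≡ 0)
    cases (n , m) with m ℕ.≤? n
    ... | yes m≤n = inj₁ (+-congʳ (reflexive (≡.trans (≡.cong (λ k → u∸ k m) (≡.sym (ℕ.m+[n∸m]≡n m≤n))) (u∸-+ m (n ∸ m)))))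
    ... | no  m≰n = inj₂ (trans (+-congʳ (reflexive (u∸-< (ℕ.≰⇒> m≰n)))) (+-identityˡ _) , ℕ.m≤n⇒m∸n≡0 (ℕ.<⇒≤ (ℕ.≰⇒> m≰n)))

  -- The common shape of (q)_L/((q)_(L-r) (q)_(L+r+1)) and of [2n, n + j]. Two inverses against one
  -- factor leave 1/(q)_∞, at the rate of the smallest index.
  ratio→u∞ : ∀ {a} {I : Set a} (α β n m : I → ℕ) → (∀ i → n i ∸ m i ℕ.≤ α i) → (∀ i → n i ∸ m i ℕ.≤ β i) →
    (λ i → p (α i) * (u∸ (n i) (m i) * u (β i)) - u∞) ≪ (λ i → n i ∸ m i)
  ratio→u∞ α β n m ≤α ≤β = ≪-cong (λ i → +-congˡ (-‿cong limit≈))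
    (≪-*-limit (≪-mono ≤α (≪-∘ α p→p∞)) (≪-*-limit (≪-∘ (λ i → n i , m i) u∸→u∞) (≪-mono ≤β (≪-∘ β u→u∞))))
    where
    limit≈ : p∞ * (u∞ * u∞) ≈ u∞
    limit≈ = trans (sym (*-assoc _ _ _)) (trans (*-congʳ p∞*u∞≈1) (*-identityˡ u∞))

  qbinomial≈gauss : ∀ k n → qbinomial q ∣q∣<1 k n ≈ gauss k n
  qbinomial≈gauss k n with n ℕ.≤? k
  ... | no n≰k = sym (gauss-< (ℕ.≰⇒> n≰k))
  ... | yes n≤k = begin
    qfac q ∣q∣<1 k * (1/qfac q ∣q∣<1 n * 1/qfac q ∣q∣<1 (k ∸ n))
      ≈⟨ *-cong (p≈qfac k) (*-cong (reflexive (u≡1/qfac n)) (reflexive (u≡1/qfac (k ∸ n)))) ⟨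
    p k * (u n * u (k ∸ n))                      ≡⟨ ≡.cong (λ j → p j * (u n * u (k ∸ n))) (≡.sym (ℕ.m+[n∸m]≡n n≤k)) ⟩
    p (n ℕ.+ (k ∸ n)) * (u n * u (k ∸ n))        ≈⟨ gauss-closed n (k ∸ n) ⟨
    gauss (n ℕ.+ (k ∸ n)) n                      ≡⟨ ≡.cong (λ j → gauss j n) (ℕ.m+[n∸m]≡n n≤k) ⟩
    gauss k n                                    ∎

  gauss-bounded : (λ ((n , m) : ℕ × ℕ) → gauss n m) ≪ const 0
  gauss-bounded = ≪-cong (λ (n , m) → sym (gauss≈ n m)) (≪-* (≪-∘ proj₁ p-bounded) (≪-* (≪-∘ proj₂ u-bounded)
    (≪-cong (λ (n , m) → solve 2 (λ a b → (a :- b) :+ b := a) refl (u∸ n m) u∞) (≪-+ (≪-mono (λ _ → z≤n) u∸→u∞) (≪-const u∞)))))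

-- The truncating division in `T` is exact, because `T n` is `t (suc n)`.
2*T : ∀ n → 2 ℕ.* T n ≡ n ℕ.* n ℕ.+ n
2*T n = ≡.trans (≡.cong (2 ℕ.*_) T≡t) (≡.trans (2t≡ n) (square n))
  where
  square : ∀ n → n ℕ.* suc n ≡ n ℕ.* n ℕ.+ n
  square = solve-∀
  2t≡ : ∀ n → 2 ℕ.* t (suc n) ≡ n ℕ.* suc n
  2t≡ zero    = ≡.refl
  2t≡ (suc n) = ≡.trans (step (t (suc n)) n) (≡.trans (≡.cong (ℕ._+ 2 ℕ.* suc n) (2t≡ n)) (close n))
    where
    step : ∀ T n → 2 ℕ.* (T ℕ.+ suc n) ≡ 2 ℕ.* T ℕ.+ 2 ℕ.* suc n
    step = solve-∀
    close : ∀ n → n ℕ.* suc n ℕ.+ 2 ℕ.* suc n ≡ suc n ℕ.* suc (suc n)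
    close = solve-∀
  T≡t : T n ≡ t (suc n)
  T≡t = ≡.trans (≡.cong (ℕ._/ 2) (≡.trans (≡.sym (2t≡ n)) (ℕ.*-comm 2 (t (suc n))))) (ℕ.m*n/n≡m (t (suc n)) 2)

-- Passage to the limit on both sides.

module Assembly {c ℓ₁ ℓ₂ ℓ₃} (ℝ : RealField c ℓ₁ ℓ₂ ℓ₃)
  (τ : RealField.Carrier ℝ) (0<τ : RealField._<_ ℝ (RealField.0# ℝ) τ) (τ<1 : RealField._<_ ℝ τ (RealField.1# ℝ))
  (q : Complex.ℂ ℝ) (∣q∣<1 : Complex.∣_∣<_ ℝ q (RealField.1# ℝ)) (q≤τ : ComplexBounds.∣_∣≤_ ℝ q τ) where
  private
    module ℝ = RealField ℝ
    module ℂ = Complex ℝ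
  open Complex ℝ using (ℂ; 0ℂ; 1ℂ; ∣_∣<_; pochhammer; 1/qfac; qbinomial; inverse; HasSum; IsPochhammer∞; _≠0)
  open RealOrder ℝ
  open Geometric τ 0<τ τ<1
  open ComplexBounds ℝ
  open CommutativeRing complexRing hiding (Carrier; zero; 0#; 1#)
  open Sums complexRing
  open Decay ℝ τ 0<τ τ<1
  open Summation ℝ τ 0<τ τ<1
  open IntegerCoefficients complexRing
  open QAnalysis ℝ τ 0<τ τ<1 q ∣q∣<1 q≤τ
  open CommutativeExp commutativeSemiring using (^-assocʳ; ^-congˡ)
  open SetoidReasoning setoid

  sgn-bounded : sgn ≪ const 0
  sgn-bounded = decay ℝ.1# (proj₁ ∣1∣≤1) λ n → ∣∣≤-cong refl (ℝ.sym (ℝ.*-identityʳ ℝ.1#)) (sgn≤ n)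
    where
    sgn≤ : ∀ n → ∣ sgn n ∣≤ ℝ.1#
    sgn≤ zero    = ∣1∣≤1
    sgn≤ (suc n) = ∣-∣≤ (sgn≤ n)

  Y≪ : Y ≪ (λ j → 21 ℕ.* t j ℕ.+ 16 ℕ.* j)
  Y≪ = ≪-* sgn-bounded (≪-∘ (λ j → 21 ℕ.* t j ℕ.+ 16 ℕ.* j) q^≪)

  X≪ : X ≪ (λ j → 21 ℕ.* t j ℕ.+ 26 ℕ.* j ℕ.+ 5)
  X≪ = ≪-* (≪-neg sgn-bounded) (≪-∘ (λ j → 21 ℕ.* t j ℕ.+ 26 ℕ.* j ℕ.+ 5) q^≪)

  -- Partial sums of the folded theta series. The Bailey side and the triple product are each
  -- compared with `Θ`, never directly with one another.
  Θ : ℕ → ℂ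
  Θ = sum (λ j → Y j + X j)

  private
    -- The exponent budget: a coefficient that converges only at rate n ∸ r still gives rate n, with
    -- j to spare for the summation, if its term decays with exponent at least r + j.
    n+j≤ : ∀ n r j e → r ℕ.+ j ℕ.≤ e → n ℕ.+ j ℕ.≤ e ℕ.+ (n ∸ r)
    n+j≤ n r j e r+j≤e = ℕ.≤-trans (ℕ.+-monoˡ-≤ j (ℕ.m≤n+m∸n n r))
      (ℕ.≤-trans (ℕ.≤-reflexive (reorder r (n ∸ r) j)) (ℕ.+-monoˡ-≤ (n ∸ r) r+j≤e))
      where
      reorder : ∀ r d j → r ℕ.+ d ℕ.+ j ≡ r ℕ.+ j ℕ.+ d
      reorder = solve-∀

  -- The coefficient of the j-th term lags by up to 2j + 1, so an exponent of 3j + 1 suffices. `Y`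
  -- offers 16j, which is enough for j ≥ 1; at j = 0 its exponent is 0, whence the condition
  -- `r 0 ≡ 0`. `X` has the extra 5.
  Θ-limit : ∀ (g h : ℕ → ℕ → ℂ) z → (r s : ℕ → ℕ) → (∀ j → r j ℕ.≤ suc (j ℕ.+ j)) → (∀ j → s j ℕ.≤ suc (j ℕ.+ j)) → r 0 ≡ 0 →
    (λ ((n , j) : ℕ × ℕ) → g n j - z) ≪ (λ (n , j) → n ∸ r j) →
    (λ ((n , j) : ℕ × ℕ) → h n j - z) ≪ (λ (n , j) → n ∸ s j) →
    (λ n → sum (λ j → Y j * g n j + X j * h n j) (suc n) - z * Θ (suc n)) ≪ id
  Θ-limit g h z r s r≤ s≤ r0≡0 g→z h→z = ≪-cong collect (≪-∘ (λ n → n , suc n) (≪-sum (≪-+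
    (≪-mono (λ (n , j) → n+j≤ n (r j) j _ (Y-exponent j)) (≪-* (≪-∘ proj₂ Y≪) g→z))
    (≪-mono (λ (n , j) → n+j≤ n (s j) j _ (X-exponent j)) (≪-* (≪-∘ proj₂ X≪) h→z)))))
    where
    Y-exponent : ∀ j → r j ℕ.+ j ℕ.≤ 21 ℕ.* t j ℕ.+ 16 ℕ.* j
    Y-exponent zero    = ℕ.≤-reflexive (≡.trans (ℕ.+-identityʳ (r 0)) r0≡0)
    Y-exponent (suc j) = ℕ.≤-trans (ℕ.+-monoˡ-≤ (suc j) (r≤ (suc j)))
      (ℕ.≤-trans (ℕ.≤-trans (ℕ.m≤m+n _ (13 ℕ.* j ℕ.+ 12)) (ℕ.≤-reflexive (e j))) (ℕ.m≤n+m _ (21 ℕ.* t (suc j))))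
      where
      e : ∀ j → suc (suc j ℕ.+ suc j) ℕ.+ suc j ℕ.+ (13 ℕ.* j ℕ.+ 12) ≡ 16 ℕ.* suc j
      e = solve-∀
    X-exponent : ∀ j → s j ℕ.+ j ℕ.≤ 21 ℕ.* t j ℕ.+ 26 ℕ.* j ℕ.+ 5
    X-exponent j = ℕ.≤-trans (ℕ.+-monoˡ-≤ j (s≤ j))
      (ℕ.≤-trans (ℕ.m≤m+n _ (21 ℕ.* t j ℕ.+ 23 ℕ.* j ℕ.+ 4)) (ℕ.≤-reflexive (e (t j) j)))
      where
      e : ∀ T j → suc (j ℕ.+ j) ℕ.+ j ℕ.+ (21 ℕ.* T ℕ.+ 23 ℕ.* j ℕ.+ 4) ≡ 21 ℕ.* T ℕ.+ 26 ℕ.* j ℕ.+ 5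
      e = solve-∀
    collect : ∀ n → sum (λ j → Y j * (g n j - z) + X j * (h n j - z)) (suc n) ≈ sum (λ j → Y j * g n j + X j * h n j) (suc n) - z * Θ (suc n)
    collect n = begin
      sum (λ j → Y j * (g n j - z) + X j * (h n j - z)) (suc n)
        ≈⟨ sum-cong (suc n) (λ j → solve 5 (λ y g x h z → y :* (g :- z) :+ x :* (h :- z) := (y :* g :+ x :* h) :- z :* (y :+ x)) refl (Y j) (g n j) (X j) (h n j) z) ⟩
      sum (λ j → (Y j * g n j + X j * h n j) - z * (Y j + X j)) (suc n)
        ≈⟨ trans (sum-- _ _ (suc n)) (+-congˡ (-‿cong (sum-*ˡ z _ (suc n)))) ⟩
      sum (λ j → Y j * g n j + X j * h n j) (suc n) - z * Θ (suc n) ∎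

  f : ℕ³ → ℂ
  f (m , k , n) = summand m k n

  f≪ : f ≪ (λ x → ∣ x ∣₁ ℕ.+ ∣ x ∣₁)
  f≪ = ≪-mono exponent (≪-cong (λ (m , k , n) → solve 4 (λ a b d e → b :* d :* (a :* e) := a :* (b :* d) :* e) refl _ _ _ _)
    (≪-* (≪-* (≪-∘ (λ (m , k , n) → m) u-bounded) (≪-∘ (λ (m , k , n) → suc (double k)) u-bounded))
      (≪-* (≪-∘ (λ (m , k , n) → k ℕ.* k ℕ.+ k ℕ.+ ((m ℕ.+ k) ℕ.* (m ℕ.+ k) ℕ.+ (m ℕ.+ k)) ℕ.+ (n ℕ.* n ℕ.+ n)) q^≪)
        (≪-∘ (λ (m , k , n) → k , n) gauss-bounded))))
    where
    exponent : ∀ ((m , k , n) : ℕ³) → (m ℕ.+ k ℕ.+ n) ℕ.+ (m ℕ.+ k ℕ.+ n)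
      ℕ.≤ k ℕ.* k ℕ.+ k ℕ.+ ((m ℕ.+ k) ℕ.* (m ℕ.+ k) ℕ.+ (m ℕ.+ k)) ℕ.+ (n ℕ.* n ℕ.+ n) ℕ.+ 0
    exponent (m , k , n) = ℕ.≤-trans (ℕ.≤-trans (ℕ.≤-reflexive (e (m ℕ.+ k) n))
      (ℕ.+-mono-≤ (ℕ.≤-trans (2n≤ (m ℕ.+ k)) (ℕ.m≤n+m _ (k ℕ.* k ℕ.+ k))) (2n≤ n))) (ℕ.≤-reflexive (≡.sym (ℕ.+-identityʳ _)))
      where
      e : ∀ a n → (a ℕ.+ n) ℕ.+ (a ℕ.+ n) ≡ (a ℕ.+ a) ℕ.+ (n ℕ.+ n)
      e = solve-∀
      2n≤ : ∀ n → n ℕ.+ n ℕ.≤ n ℕ.* n ℕ.+ n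
      2n≤ zero    = z≤n
      2n≤ (suc n) = ℕ.+-monoˡ-≤ (suc n) (ℕ.m≤m*n (suc n) (suc n))

  weight : ℕ → ℕ³ → ℂ
  weight L (m , k , n) = p L * u∸ L (m ℕ.+ k)

  weight→1 : (λ ((L , x) : ℕ × ℕ³) → weight L x - 1ℂ) ≪ (λ (L , (m , k , n)) → L ∸ (m ℕ.+ k))
  weight→1 = ≪-cong (λ _ → +-congˡ (-‿cong p∞*u∞≈1))
    (≪-*-limit (≪-mono (λ (L , (m , k , n)) → ℕ.m∸n≤m L (m ℕ.+ k)) (≪-∘ proj₁ p→p∞)) (≪-∘ (λ (L , (m , k , n)) → L , m ℕ.+ k) u∸→u∞))

  -- With s = m + k + n the product of summand and weight error has exponent 2s + (L ∸ (m + k)) ≥ L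
  -- + s.
  box→weighted : (λ L → box f (suc L) - box (λ x → f x * weight L x) (suc L)) ≪ id
  box→weighted = ≪-cong (λ L → trans (-‿cong (trans (box-cong (suc L) (λ x → solve 2 (λ a b → a :* (b :- one) := a :* b :- a) refl (f x) (weight L x)))
      (box-- (λ x → f x * weight L x) f (suc L)))) (solve 2 (λ a b → :- (a :- b) := b :- a) refl _ _))
    (≪-neg (≪-∘ (λ L → L , suc L) (≪-box (≪-mono exponent (≪-* (≪-∘ proj₂ f≪) weight→1)))))
    where
    exponent : ∀ ((L , (m , k , n)) : ℕ × ℕ³) → L ℕ.+ (m ℕ.+ k ℕ.+ n) ℕ.≤ (m ℕ.+ k ℕ.+ n) ℕ.+ (m ℕ.+ k ℕ.+ n) ℕ.+ (L ∸ (m ℕ.+ k))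
    exponent (L , (m , k , n)) = n+j≤ L (m ℕ.+ k) (m ℕ.+ k ℕ.+ n) _ (ℕ.+-monoˡ-≤ (m ℕ.+ k ℕ.+ n) (ℕ.m≤m+n (m ℕ.+ k) n))

  weighted→Θ : (λ L → box (λ x → f x * weight L x) (suc L) - u∞ * Θ (suc L)) ≪ id
  weighted→Θ = ≪-cong (λ L → +-congʳ (sym (finite-identity L)))
    (Θ-limit (λ L j → p L * unit (double j) L) (λ L j → p L * unit (suc (double j)) L) u∞ double (suc ∘ double)
      (λ j → ℕ.m≤n⇒m≤1+n (ℕ.≤-reflexive (double≡+ j))) (λ j → s≤s (ℕ.≤-reflexive (double≡+ j))) ≡.refl
      (ratio→u∞ proj₁ (λ (L , j) → suc (L ℕ.+ double j)) proj₁ (double ∘ proj₂)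
        (λ (L , j) → ℕ.m∸n≤m L (double j)) (λ (L , j) → ℕ.m≤n⇒m≤1+n (ℕ.≤-trans (ℕ.m∸n≤m L (double j)) (ℕ.m≤m+n L _))))
      (ratio→u∞ proj₁ (λ (L , j) → suc (L ℕ.+ suc (double j))) proj₁ (suc ∘ double ∘ proj₂)
        (λ (L , j) → ℕ.m∸n≤m L (suc (double j))) (λ (L , j) → ℕ.m≤n⇒m≤1+n (ℕ.≤-trans (ℕ.m∸n≤m L (suc (double j))) (ℕ.m≤m+n L _)))))

  -- Both x y and v θ(n) approximate f(n) g(n), and p is the inverse of v. The trailing `1ℂ` matches
  -- the empty product that ends `IsPochhammer∞`.
  cancel-limit : ∀ (f g θ : ℕ → ℂ) p v x y → p * v ≈ 1ℂ →
    (λ n → f n - x) ≪ id → (λ n → g n - y) ≪ id → (λ n → f n * g n - v * θ n) ≪ id → (λ n → θ n - p * (x * (y * 1ℂ))) ≪ id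
  cancel-limit f g θ p v x y p*v≈1 f→x g→y fg→vθ = ≪-cong collect (≪-* (≪-const p) (≪-- (≪-*-limit f→x g→y) fg→vθ))
    where
    collect : ∀ n → p * ((f n * g n - x * y) - (f n * g n - v * θ n)) ≈ θ n - p * (x * (y * 1ℂ))
    collect n = begin
      p * ((f n * g n - x * y) - (f n * g n - v * θ n))
        ≈⟨ solve 6 (λ p P x y v θ → p :* ((P :- x :* y) :- (P :- v :* θ)) := p :* v :* θ :- p :* (x :* (y :* one))) refl p (f n * g n) x y v (θ n) ⟩
      p * v * θ n - p * (x * (y * 1ℂ))
        ≈⟨ +-congʳ (trans (*-congʳ p*v≈1) (*-identityˡ _)) ⟩
      θ n - p * (x * (y * 1ℂ)) ∎

  -- The triple product has base q²¹ with x = q⁵ and y = q¹⁶, so that xy is the base. The same τ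
  -- serves for both bases, as ∣q²¹∣ ≤ τ²¹ ≤ τ.
  module TripleProduct (Q x y : ℂ) (∣Q∣<1 : ∣ Q ∣< ℝ.1#) (Q≤τ : ∣ Q ∣≤ τ)
    (Q≈q²¹ : Q ≈ q ^ 21) (x≈q⁵ : x ≈ q ^ 5) (y≈q¹⁶ : y ≈ q ^ 16) where
    private
      module B = QAnalysis ℝ τ 0<τ τ<1 Q ∣Q∣<1 Q≤τ
      module J = JacobiTriple complexRing Q B.u B.p*u

      x*y≈Q : x * y ≈ Q
      x*y≈Q = trans (*-cong x≈q⁵ y≈q¹⁶) (trans (^-+ 5 16 ≡.refl) (sym Q≈q²¹))

      Q^ : ∀ n → Q ^ n ≈ q ^ (21 ℕ.* n)
      Q^ n = trans (^-congˡ n Q≈q²¹) (^-assocʳ q 21 n)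

      Y≈ : ∀ j → J.Y x y x*y≈Q j ≈ Y j
      Y≈ j = *-congˡ (trans (*-cong (Q^ (t j)) (trans (^-congˡ j y≈q¹⁶) (^-assocʳ q 16 j))) (^-+ (21 ℕ.* t j) (16 ℕ.* j) ≡.refl))

      X≈ : ∀ j → J.X x y x*y≈Q j ≈ X j
      X≈ j = *-congˡ (trans (*-cong (Q^ (t (suc j))) (trans (^-congˡ (suc j) x≈q⁵) (^-assocʳ q 5 (suc j)))) (^-+ (21 ℕ.* t (suc j)) (5 ℕ.* suc j) (e (t j) j)))
        where
        e : ∀ T j → 21 ℕ.* (T ℕ.+ j) ℕ.+ 5 ℕ.* suc j ≡ 21 ℕ.* T ℕ.+ 26 ℕ.* j ℕ.+ 5
        e = solve-∀

      coefficient≈ : ∀ n j → B.p (double n) * (B.u∸ n j * B.u (n ℕ.+ j)) ≈ B.gauss (double n) (n ℕ.+ j)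
      coefficient≈ n j = sym (trans (B.gauss≈ (double n) (n ℕ.+ j)) (*-congˡ (trans (*-comm _ _)
        (*-congʳ (reflexive (≡.trans (≡.cong (λ k → B.u∸ k (n ℕ.+ j)) (double≡+ n)) (B.u∸-cancel n n j)))))))

      coefficient→ : (λ ((n , j) : ℕ × ℕ) → B.gauss (double n) (n ℕ.+ j) - B.u∞) ≪ (λ (n , j) → n ∸ j)
      coefficient→ = ≪-cong (λ (n , j) → +-congʳ (coefficient≈ n j)) (B.ratio→u∞ (double ∘ proj₁) (λ (n , j) → n ℕ.+ j) proj₁ proj₂
        (λ (n , j) → ℕ.≤-trans (ℕ.m∸n≤m n j) (≡.subst (n ℕ.≤_) (≡.sym (double≡+ n)) (ℕ.m≤m+n n n))) (λ (n , j) → ℕ.≤-trans (ℕ.m∸n≤m n j) (ℕ.m≤m+n n j)))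

    X∞ Y∞ : ℂ
    X∞ = proj₁ (B.pochhammer-limit x)
    Y∞ = proj₁ (B.pochhammer-limit y)

    num : ℂ
    num = B.p∞ * (X∞ * (Y∞ * 1ℂ))

    private
      product≈ : ∀ n → J.product x y x*y≈Q n ≈ pochhammer x Q n * pochhammer y Q n
      product≈ zero    = sym (*-identityˡ 1ℂ)
      product≈ (suc n) = trans (*-congʳ (*-congʳ (product≈ n))) (solve 4 (λ a b z w → a :* b :* z :* w := (a :* w) :* (b :* z)) refl _ _ _ _)

      theta-sum≈product : ∀ n → sum (λ j → Y j * B.gauss (double n) (n ℕ.+ j) + X j * B.gauss (double n) (n ℕ.+ suc j)) (suc n)
        ≈ pochhammer x Q n * pochhammer y Q n
      theta-sum≈product n = begin
        sum (λ j → Y j * B.gauss (double n) (n ℕ.+ j) + X j * B.gauss (double n) (n ℕ.+ suc j)) (suc n)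
          ≈⟨ sum-cong (suc n) (λ j → +-cong (*-congʳ (Y≈ j)) (*-congʳ (X≈ j))) ⟨
        sum (λ j → J.Y x y x*y≈Q j * B.gauss (double n) (n ℕ.+ j) + J.X x y x*y≈Q j * B.gauss (double n) (n ℕ.+ suc j)) (suc n)
          ≈⟨ J.finite-triple-product x y x*y≈Q n (suc n) ℕ.≤-refl ⟨
        J.product x y x*y≈Q n
          ≈⟨ product≈ n ⟩
        pochhammer x Q n * pochhammer y Q n ∎

      product→Θ : (λ n → pochhammer x Q n * pochhammer y Q n - B.u∞ * Θ (suc n)) ≪ id
      product→Θ = ≪-cong (λ n → +-congʳ { - (B.u∞ * Θ (suc n))} (theta-sum≈product n))
        (Θ-limit (λ n j → B.gauss (double n) (n ℕ.+ j)) (λ n j → B.gauss (double n) (n ℕ.+ suc j)) B.u∞ id suc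
          (λ j → ℕ.m≤n⇒m≤1+n (ℕ.m≤m+n j j)) (λ j → s≤s (ℕ.m≤m+n j j)) ≡.refl
          coefficient→ (≪-∘ (λ (n , j) → n , suc j) coefficient→))

    Θ→num : (λ n → Θ (suc n) - num) ≪ id
    Θ→num = cancel-limit (pochhammer x Q) (pochhammer y Q) (λ n → Θ (suc n)) B.p∞ B.u∞ X∞ Y∞ B.p∞*u∞≈1
      (proj₂ (B.pochhammer-limit x)) (proj₂ (B.pochhammer-limit y)) product→Θ

    isPochhammer∞-num : IsPochhammer∞ (Q ∷ x ∷ y ∷ []) Q num
    isPochhammer∞-num = B.p∞ , X∞ * (Y∞ * 1ℂ) , ≪⇒IsLimit (proj₂ (B.pochhammer-limit Q)) ,
      (X∞ , Y∞ * 1ℂ , ≪⇒IsLimit (proj₂ (B.pochhammer-limit x)) ,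
        (Y∞ , 1ℂ , ≪⇒IsLimit (proj₂ (B.pochhammer-limit y)) , lift refl , refl) , refl) , refl

    box→num : (λ L → box f (suc L) - u∞ * num) ≪ id
    box→num = ≪-cong (λ L → solve 5 (λ b w u θ z → (b :- w) :+ ((w :- u :* θ) :+ u :* (θ :- z)) := b :- u :* z) refl _ _ u∞ (Θ (suc L)) num)
      (≪-+ box→weighted (≪-+ weighted→Θ (≪-* (≪-const u∞) Θ→num)))

  term : ℕ³ → ℂ
  term (m , k , n) = q ℂ.^ (2 ℕ.* T k ℕ.+ 2 ℕ.* T (m ℕ.+ k) ℕ.+ 2 ℕ.* T n)
    ℂ.* (1/qfac q ∣q∣<1 m ℂ.* 1/qfac q ∣q∣<1 (suc (2 ℕ.* k))) ℂ.* qbinomial q ∣q∣<1 k n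

  private
    u≡ : ∀ k → u (suc (double k)) ≡ 1/qfac q ∣q∣<1 (suc (2 ℕ.* k))
    u≡ k = ≡.trans (≡.cong (λ j → u (suc j)) (≡.trans (double≡+ k) (≡.cong (k ℕ.+_) (≡.sym (ℕ.+-identityʳ k))))) (u≡1/qfac (suc (2 ℕ.* k)))

    exponent≡ : ∀ m k n → k ℕ.* k ℕ.+ k ℕ.+ ((m ℕ.+ k) ℕ.* (m ℕ.+ k) ℕ.+ (m ℕ.+ k)) ℕ.+ (n ℕ.* n ℕ.+ n) ≡ 2 ℕ.* T k ℕ.+ 2 ℕ.* T (m ℕ.+ k) ℕ.+ 2 ℕ.* T n
    exponent≡ m k n = ≡.sym (≡.cong₂ ℕ._+_ (≡.cong₂ ℕ._+_ (2*T k) (2*T (m ℕ.+ k))) (2*T n))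

    replace : ∀ {a b : ℕ} {x y z w g h : ℂ} → a ≡ b → x ≡ z → y ≡ w → g ≈ h → q ^ a * (x * y) * g ≈ q ℂ.^ b ℂ.* (z ℂ.* w) ℂ.* h
    replace ≡.refl ≡.refl ≡.refl g≈h = *-congˡ g≈h

  f≈term : ∀ x → f x ≈ term x
  f≈term (m , k , n) = replace {x = u m} {u (suc (double k))} {1/qfac q ∣q∣<1 m} {1/qfac q ∣q∣<1 (suc (2 ℕ.* k))} {gauss k n} {qbinomial q ∣q∣<1 k n}
    (exponent≡ m k n) (u≡1/qfac m) (u≡ k) (sym (qbinomial≈gauss k n))

  ∣q^n∣≤τ : ∀ n → 1 ℕ.≤ n → ∣ q ^ n ∣≤ τ
  ∣q^n∣≤τ n 1≤n = ∣∣≤-mono (≤-resp ℝ.refl (ℝ.*-identityʳ τ) (τ^-antitone 1≤n)) (q^≤ n)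

  isPochhammer∞-den : IsPochhammer∞ (q ∷ []) q p∞
  isPochhammer∞-den = p∞ , 1ℂ , ≪⇒IsLimit (proj₂ (pochhammer-limit q)) , lift refl , sym (*-identityʳ p∞)

  p∞≠0 : p∞ ≠0
  p∞≠0 = *≈1⇒≠0 p∞*u∞≈1

  term-hasSum : ∀ num → (λ L → box f (suc L) - u∞ * num) ≪ id → HasSum term (num ℂ.* inverse p∞ p∞≠0)
  term-hasSum num box→ = hasSum term (num ℂ.* inverse p∞ p∞≠0) (≪-cong f≈term f≪)
    (≪-cong (λ L → +-cong (box-cong (suc L) f≈term) (-‿cong (trans (*-comm u∞ num) (*-congˡ (sym (inverse-unique p∞≠0 p∞*u∞≈1)))))) box→)

  conclusion : ∀ Q x y → Q ≡ q ℂ.^ 21 → x ≡ q ℂ.^ 5 → y ≡ q ℂ.^ 16 →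
    ∃[ num ] ∃[ den ]
      IsPochhammer∞ (Q ∷ x ∷ y ∷ []) Q num ×
      IsPochhammer∞ (q ∷ []) q den ×
      (Σ[ den≠0 ∈ den ≠0 ] HasSum term (num ℂ.* inverse den den≠0))
  conclusion Q x y Q≡ x≡ y≡ = num , p∞ , isPochhammer∞-num , isPochhammer∞-den , p∞≠0 , term-hasSum num box→num
    where
    ^≡ : ∀ n → q ℂ.^ n ≡ q ^ n
    ^≡ n = ≡.refl
    ≈^ : ∀ {z} n → z ≡ q ℂ.^ n → z ≈ q ^ n
    ≈^ n z≡ = reflexive (≡.trans z≡ (^≡ n))
    Q≤τ : ∣ Q ∣≤ τ
    Q≤τ = ≡.subst (λ z → ∣ z ∣≤ τ) (≡.sym (≡.trans Q≡ (^≡ 21))) (∣q^n∣≤τ 21 (s≤s z≤n))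
    open TripleProduct Q x y (∣∣≤∧<⇒∣∣< Q≤τ τ<1) Q≤τ (≈^ 21 Q≡) (≈^ 5 x≡) (≈^ 16 y≡)

mainTheorem7 :
  ∀ {c ℓ₁ ℓ₂ ℓ₃} (ℝ : RealField c ℓ₁ ℓ₂ ℓ₃) →
  let open Complex ℝ
      open RealField ℝ using (1#)
  in
  (q : ℂ) (∣q∣<1 : ∣ q ∣< 1#) →
  ∃[ num ] ∃[ den ]
    IsPochhammer∞ (q ^ 21 ∷ q ^ 5 ∷ q ^ 16 ∷ []) (q ^ 21) num ×
    IsPochhammer∞ (q ∷ []) q den ×
    (Σ[ den≠0 ∈ den ≠0 ]
      HasSum {A = ℕ × ℕ × ℕ}
        (λ (m , k , n) →
          q ^ (2 ℕ.* T k ℕ.+ 2 ℕ.* T (m ℕ.+ k) ℕ.+ 2 ℕ.* T n)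
            * (1/qfac q ∣q∣<1 m * 1/qfac q ∣q∣<1 (suc (2 ℕ.* k)))
            * qbinomial q ∣q∣<1 k n)
        (num * inverse den den≠0))
mainTheorem7 ℝ q ∣q∣<1 = let τ , 0<τ , τ<1 , q≤τ = ComplexBounds.radius ℝ {q} ∣q∣<1 in
  Assembly.conclusion ℝ τ 0<τ τ<1 q ∣q∣<1 q≤τ (q ^ 21) (q ^ 5) (q ^ 16) ≡.refl ≡.refl ≡.refl
  where open Complex ℝ using (_^_)
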